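{- \textsc{Unweighted Vertex Integrity} can be solved in time $5^{\mathrm{vc}(G)} n^{O(1)}$, where $n$ is the number of vertices of the input graph $G$.
   Context: Graphs are finite, simple and undirected. $\mathrm{vc}(G)$ is the vertex cover number of $G$ (minimum size of a set of vertices meeting every edge). The vertex integrity is $\mathrm{vi}(G) = \min_{S \subseteq V(G)} \{ |S| + \max_{D} |D| \}$, the maximum ranging over the vertex sets of connected components $D$ of $G - S$. \textsc{Unweighted Vertex Integrity}: given a graph $G$ and an integer $k$, decide whether $\mathrm{vi}(G) \le k$. -}

module Defs where

open import Data.Bool.Base using (Bool; true; false; T; if_then_else_)
open import Data.Bool.Properties using (T?)
open import Data.Fin.Base using (Fin; fromℕ<; remQuot)
open import Data.Fin.Properties using (all?) renaming (_≟_ to _≟ᶠ_)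
open import Data.Fin.Subset using (Subset; inside; outside; _∈_; _∉_; ∣_∣)
open import Data.Fin.Subset.Properties using (_∈?_)
open import Data.Integer.Base as ℤ using (ℤ; +_; -[1+_])
open import Data.List.Base using (List; []; _∷_; [_]; _++_; map; filter; allFin)
open import Data.List.Extrema.Nat using (min; max)
open import Data.List.Membership.Propositional using () renaming (_∈_ to _∈ˡ_)
open import Data.List.Membership.Propositional.Properties using (∈-allFin)
open import Data.List.Relation.Unary.Any using (here; there)
open import Data.Nat.Base using (ℕ; zero; suc; _+_; _*_; _∸_; _^_; _/_; _%_; _≤_; _<ᵇ_; _≡ᵇ_)
open import Data.Nat.Properties using (_≟_; _<?_)
open import Data.Product.Base using (_×_; _,_)
open import Data.Sum.Base using (_⊎_; inj₁; inj₂)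
open import Data.Unit.Base using (⊤)
import Data.Vec.Base as Vec
open import Level using (0ℓ)
open import Relation.Binary.Construct.Closure.ReflexiveTransitive using (Star; ε; _◅_; _◅◅_)
open import Relation.Binary.Core using (Rel)
open import Relation.Binary.Definitions using (Decidable)
open import Relation.Binary.PropositionalEquality.Core using (_≡_; _≢_; refl)
open import Relation.Nullary.Decidable using (Dec; yes; no; does; map′; _×-dec_; _⊎-dec_; _→-dec_; ¬?)

------------------------------------------------------------------------
-- Decidability of reachability on a finite vertex set, by the
-- Floyd–Warshall recursion: Via ws u v says that v can be reached from u
-- through intermediate vertices taken from ws.

module _ {n} {R : Rel (Fin n) 0ℓ} where

  Via : List (Fin n) → Rel (Fin n) 0ℓ
  Via []       u v = u ≡ v ⊎ R u v
  Via (w ∷ ws) u v = Via ws u v ⊎ (Via ws u w × Via ws w v)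

  via? : Decidable R → ∀ ws → Decidable (Via ws)
  via? R? []       u v = (u ≟ᶠ v) ⊎-dec R? u v
  via? R? (w ∷ ws) u v = via? R? ws u v ⊎-dec (via? R? ws u w ×-dec via? R? ws w v)

  via⇒star : ∀ ws {u v} → Via ws u v → Star R u v
  via⇒star []       (inj₁ refl)    = ε
  via⇒star []       (inj₂ e)       = e ◅ ε
  via⇒star (w ∷ ws) (inj₁ p)       = via⇒star ws p
  via⇒star (w ∷ ws) (inj₂ (p , q)) = via⇒star ws p ◅◅ via⇒star ws q

  direct : ∀ ws {u v} → u ≡ v ⊎ R u v → Via ws u v
  direct []       e = e
  direct (w ∷ ws) e = inj₁ (direct ws e)

  via-trans : ∀ ws {u w v} → w ∈ˡ ws → Via ws u w → Via ws w v → Via ws u v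
  via-trans (_ ∷ ws) (here refl) p q = inj₂ (into p , outof q)
    where
    into : ∀ {u w} → Via (w ∷ ws) u w → Via ws u w
    into (inj₁ p)       = p
    into (inj₂ (p , _)) = p
    outof : ∀ {w v} → Via (w ∷ ws) w v → Via ws w v
    outof (inj₁ q)       = q
    outof (inj₂ (_ , q)) = q
  via-trans (_ ∷ ws) (there w∈) (inj₁ p)       (inj₁ q)        = inj₁ (via-trans ws w∈ p q)
  via-trans (_ ∷ ws) (there w∈) (inj₁ p)       (inj₂ (q , q′)) = inj₂ (via-trans ws w∈ p q , q′)
  via-trans (_ ∷ ws) (there w∈) (inj₂ (p , p′)) (inj₁ q)       = inj₂ (p , via-trans ws w∈ p′ q)
  via-trans (_ ∷ ws) (there w∈) (inj₂ (p , _)) (inj₂ (_ , q))  = inj₂ (p , q)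

  star⇒via : ∀ {u v} → Star R u v → Via (allFin n) u v
  star⇒via ε        = direct (allFin n) (inj₁ refl)
  star⇒via (e ◅ es) =
    via-trans (allFin n) (∈-allFin _) (direct (allFin n) (inj₂ e)) (star⇒via es)

  star? : Decidable R → Decidable (Star R)
  star? R? u v = map′ (via⇒star (allFin n)) star⇒via (via? R? (allFin n) u v)

------------------------------------------------------------------------
-- Graphs, vertex cover number, vertex integrity

record Graph (n : ℕ) : Set where
  field
    adj         : Fin n → Fin n → Bool
    symmetric   : ∀ u v → adj u v ≡ adj v u
    irreflexive : ∀ v → adj v v ≡ false

  Edge : Rel (Fin n) 0ℓ
  Edge u v = T (adj u v)

subsets : ∀ n → List (Subset n)
subsets zero    = [ Vec.[] ]
subsets (suc n) = map (outside Vec.∷_) (subsets n) ++ map (inside Vec.∷_) (subsets n)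

module _ {n} (G : Graph n) where
  open Graph G

  IsVertexCover : Subset n → Set
  IsVertexCover C = ∀ u v → Edge u v → u ∈ C ⊎ v ∈ C

  isVertexCover? : ∀ C → Dec (IsVertexCover C)
  isVertexCover? C =
    all? λ u → all? λ v → T? (adj u v) →-dec ((u ∈? C) ⊎-dec (v ∈? C))

  -- In vc and vi the default value n of min is attained, by the set of
  -- all vertices, so it does not affect the minimum.
  vc : ℕ
  vc = min n (map ∣_∣ (filter isVertexCover? (subsets n)))

  EdgeAvoiding : Subset n → Rel (Fin n) 0ℓ
  EdgeAvoiding S u v = u ∉ S × v ∉ S × Edge u v

  edgeAvoiding? : ∀ S → Decidable (EdgeAvoiding S)
  edgeAvoiding? S u v = ¬? (u ∈? S) ×-dec (¬? (v ∈? S) ×-dec T? (adj u v))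

  -- For u ∉ S, the vertex set of the connected component of u in G − S.
  component : Subset n → Fin n → Subset n
  component S u = Vec.tabulate λ v → does (star? (edgeAvoiding? S) u v)

  -- Every component of G − S is listed, once for each of its vertices.
  components : Subset n → List (Subset n)
  components S = map (component S) (filter (λ u → ¬? (u ∈? S)) (allFin n))

  vi : ℕ
  vi = min n (map (λ S → ∣ S ∣ + max 0 (map ∣_∣ (components S))) (subsets n))

------------------------------------------------------------------------
-- Random access machines with structured control flow.
--
-- A state has registers, which a program names by constants, and an
-- indirectly addressed memory.  Every operation costs one time unit.  To
-- make this a realistic measure there is a word bound W: an execution is
-- only allowed to perform operations whose results are at most W, so no
-- cell ever exceeds the largest of W, the constants of the program and
-- the numbers in the input.

data Op : Set where
  add sub mul div mod less equal : Op

bit : Bool → ℕ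
bit b = if b then 1 else 0

⟦_⟧ : Op → ℕ → ℕ → ℕ
⟦ add   ⟧ x y       = x + y
⟦ sub   ⟧ x y       = x ∸ y
⟦ mul   ⟧ x y       = x * y
⟦ div   ⟧ x zero    = 0
⟦ div   ⟧ x (suc y) = x / suc y
⟦ mod   ⟧ x zero    = 0
⟦ mod   ⟧ x (suc y) = x % suc y
⟦ less  ⟧ x y       = bit (x <ᵇ y)
⟦ equal ⟧ x y       = bit (x ≡ᵇ y)

data Expr : Set where
  lit  : ℕ → Expr
  reg  : ℕ → Expr
  load : Expr → Expr
  op   : Op → Expr → Expr → Expr

infixr 5 _⨾_

data Program : Set where
  skip  : Program
  set   : ℕ → Expr → Program
  store : Expr → Expr → Program
  _⨾_   : Program → Program → Program
  cond  : Expr → Program → Program → Program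
  while : Expr → Program → Program

record State : Set where
  constructor state
  field
    regs : ℕ → ℕ
    mem  : ℕ → ℕ

open State public

_[_≔_] : (ℕ → ℕ) → ℕ → ℕ → (ℕ → ℕ)
(f [ a ≔ x ]) b = if does (b ≟ a) then x else f b

eval : State → Expr → ℕ
eval s (lit x)    = x
eval s (reg r)    = regs s r
eval s (load e)   = mem s (eval s e)
eval s (op o d e) = ⟦ o ⟧ (eval s d) (eval s e)

cost : Expr → ℕ
cost (lit x)    = 1
cost (reg r)    = 1
cost (load e)   = 1 + cost e
cost (op o d e) = 1 + (cost d + cost e)

Fits : ℕ → State → Expr → Set
Fits W s (lit x)    = ⊤
Fits W s (reg r)    = ⊤
Fits W s (load e)   = Fits W s e
Fits W s (op o d e) = Fits W s d × Fits W s e × eval s (op o d e) ≤ W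

-- W ⊢ p , s ⇓[ t ] s′ : started in s with word bound W, the program p
-- halts in s′ after t time units.
infix 4 _⊢_,_⇓[_]_

data _⊢_,_⇓[_]_ (W : ℕ) : Program → State → ℕ → State → Set where

  ⇓-skip  : ∀ {s} → W ⊢ skip , s ⇓[ 1 ] s

  ⇓-set   : ∀ {s r e} → Fits W s e →
            W ⊢ set r e , s ⇓[ 1 + cost e ] state (regs s [ r ≔ eval s e ]) (mem s)

  ⇓-store : ∀ {s d e} → Fits W s d → Fits W s e →
            W ⊢ store d e , s ⇓[ 1 + (cost d + cost e) ]
              state (regs s) (mem s [ eval s d ≔ eval s e ])

  ⇓-seq   : ∀ {p q s s′ s″ t t′} →
            W ⊢ p , s ⇓[ t ] s′ → W ⊢ q , s′ ⇓[ t′ ] s″ →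
            W ⊢ p ⨾ q , s ⇓[ t + t′ ] s″

  ⇓-then  : ∀ {e p q s s′ t} → Fits W s e → eval s e ≢ 0 →
            W ⊢ p , s ⇓[ t ] s′ → W ⊢ cond e p q , s ⇓[ 1 + (cost e + t) ] s′

  ⇓-else  : ∀ {e p q s s′ t} → Fits W s e → eval s e ≡ 0 →
            W ⊢ q , s ⇓[ t ] s′ → W ⊢ cond e p q , s ⇓[ 1 + (cost e + t) ] s′

  ⇓-exit  : ∀ {e p s} → Fits W s e → eval s e ≡ 0 →
            W ⊢ while e p , s ⇓[ 1 + cost e ] s

  ⇓-loop  : ∀ {e p s s′ s″ t t′} → Fits W s e → eval s e ≢ 0 →
            W ⊢ p , s ⇓[ t ] s′ → W ⊢ while e p , s′ ⇓[ t′ ] s″ →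
            W ⊢ while e p , s ⇓[ 1 + (cost e + (t + t′)) ] s″

------------------------------------------------------------------------
-- Input: the number n of vertices in register 0, the sign (1 for
-- negative) and absolute value of k in registers 1 and 2, and the
-- adjacency matrix in memory, with entry (i , j) at address n * i + j.

input : ∀ {n} → Graph n → ℤ → State
input {n} G k = state registers matrix
  where
  sign : ℤ → ℕ
  sign (+ _)    = 0
  sign -[1+ _ ] = 1

  registers : ℕ → ℕ
  registers 0 = n
  registers 1 = sign k
  registers 2 = ℤ.∣ k ∣
  registers _ = 0

  entry : Fin n × Fin n → ℕ
  entry (i , j) = bit (Graph.adj G i j)

  matrix : ℕ → ℕ
  matrix a with a <? n * n
  ... | yes a<n² = entry (remQuot n (fromℕ< a<n²))
  ... | no  _    = 0

-- A bound 5^vc(G) · n^O(1).  The polynomial is written c · (1 + n)^c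
-- rather than c · n^c so that it does not vanish on the empty graph.
-- Taking it also as the word bound gives words whose length is
-- logarithmic in the running time, that is, O(vc(G) + log n) bits.
bound : ∀ {n} → ℕ → Graph n → ℕ
bound {n} c G = 5 ^ vc G * (c * suc n ^ c)

-- Fix a vertex cover and a bound ℓ ≥ 1 on the component sizes.  A solution
-- deletes a set X of cover vertices, and its components partition the rest of
-- the cover.  When the components are added one by one, the price of adding a
-- part P, given the union A of the earlier parts and the set R of the cover
-- vertices still to come, depends on (X , A , P , R) only: of the vertices
-- outside the cover that see P but not A, those that see R must be deleted, and
-- of the others just as many as it takes to get down to ℓ vertices.  Hence a
-- dynamic program over the 4-colourings (X , A , P , R) of the cover finds the
-- best solution.  With the digits X = 0, A = 1, P = 2, R = 3 a transition lies
-- between its source (P recoloured to R) and its target (P recoloured to A), so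
-- that a single pass through the codes in decreasing order suffices.
--
-- The cover comes from a breadth-first search in the binary tree that branches
-- on the ends of an uncovered edge.  The first cover is found at a node
-- J ≤ 4 · 2 ^ vc, and has at most log₂ J vertices, so that there are at most
-- J ² ≤ 16 · 4 ^ vc colourings.
--
-- The program is compiled from terms with bounded sums, whose values and times
-- have bounds B ^ a · M ^ b, where B = 16 (n + 1) and M = 5 ^ vc, with exponents
-- that are computed from the syntax.

module Submission where

open import Algebra.Properties.CommutativeSemigroup using (interchange)
open import Data.Bool using (Bool; true; false; T; _∧_; _∨_; not; if_then_else_)
open import Data.Bool.Properties using (T-∧; T-∨; T?)
open import Data.Empty using (⊥; ⊥-elim)
open import Data.Fin using (Fin; zero; suc; toℕ; fromℕ<; remQuot; combine; _↑ʳ_)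
open import Data.Fin.Patterns
open import Data.Fin.Properties
  using (toℕ<n; toℕ-injective; fromℕ<-toℕ; toℕ-fromℕ<; toℕ-combine; remQuot-combine; suc-injective)
  renaming (_≟_ to _≟ᶠ_)
open import Data.Fin.Subset using (Subset; inside; outside; _∈_; _∉_; ∣_∣; ⊤)
open import Data.Fin.Subset.Properties using (_∈?_; ∈⊤; ∣⊤∣≡n)
open import Data.List using (List; []; _∷_; map; filter; allFin; length)
open import Data.List.Extrema.Nat using (max; min≤⊤; min≤xs; max≤v⁺; xs≤max; argmin-sel)
import Data.List.Membership.Propositional as List
open import Data.List.Membership.Propositional.Properties
  using (∈-map⁺; ∈-map⁻; ∈-++⁺ˡ; ∈-++⁺ʳ; ∈-filter⁺; ∈-filter⁻; ∈-allFin)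
open import Data.List.Relation.Unary.All as All using (All; []; _∷_)
import Data.List.Relation.Unary.All.Properties as All
open import Data.List.Relation.Unary.AllPairs using ([]; _∷_)
open import Data.List.Relation.Unary.Any using (here)
open import Data.List.Relation.Unary.Unique.Propositional using (Unique)
open import Data.Nat hiding (_≟_; _≤?_; parity)
open import Data.Nat.Divisibility using (divides)
open import Data.Nat.DivMod
  using (m/n≤m; m%n≤m; m%n<n; n/1≡n; m/n<m; m/n*n≤m; m*n/n≡m; m/n/o≡m/[n*o]; m≡m%n+[m/n]*n; m<n*o⇒m/o<n; m≥n⇒m/n>0;
         m<n⇒m%n≡m; m<n⇒m/n≡0; [m+kn]%n≡m%n; +-distrib-/-∣ˡ; +-distrib-/-∣ʳ; /-congˡ; %-congˡ)
open import Data.Nat.Properties hiding (_≤?_; suc-injective)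
open import Data.Nat.Solver using (module +-*-Solver)
open import Data.Product as Product using (Σ-syntax; ∃-syntax; _×_; _,_; proj₁; proj₂)
open import Data.Sum as Sum using (_⊎_; inj₁; inj₂)
open import Data.Unit using (tt)
open import Data.Vec using (Vec; []; _∷_; lookup; tabulate) renaming (_[_]≔_ to _[_]:=_)
open import Data.Vec.Properties
  using (lookup∘tabulate; tabulate∘lookup; lookup∘update; lookup∘update′; lookup⇒[]=; []=⇒lookup)
open import Function using (_∘_; id)
open import Function.Bundles using (Equivalence)
open import Relation.Binary.Construct.Closure.ReflexiveTransitive as Star using (Star; ε; _◅_; _◅◅_)
open import Relation.Binary.PropositionalEquality
open import Relation.Nullary using (¬_; ¬?; Dec; yes; no; does; contradiction)
open import Defs

-- Terms and their compilation

-- Prices can be fixed part by part because each vertex outside the cover is settled once, when the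
-- first part that it sees is added. If it also sees cover vertices still to come, keeping it would
-- join two components, so it is deleted then and is gone before the next of its parts arrives.
-- Vertices that see only deleted vertices become isolated, whence ℓ ≥ 1; the case that everything
-- is deleted is answered by comparing n with the budget.
--
-- Table entries are unspent budgets, counted from one more than the budget, so that a positive
-- entry means success and truncated subtraction turns every overdraft into 0. Memory that was never
-- written is thus an empty table.
--
-- The word bound equals the time bound, and the machine does not know vc. A minimum cover occurs
-- only in the proof, as a path in the search tree that limits how long the search can last. Terms
-- contain loops of polynomial length only; the single factor M in the running time comes from the
-- number of search nodes and the number of codes.

infixl 6 _⊕_ _⊖_
infixl 7 _⊗_

data Term (l : ℕ) : Set where
  con : ℕ → Term l
  var : Fin l → Term l
  at  : Term l → Term l
  bin : Op → Term l → Term l → Term l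
  ite : Term l → Term l → Term l → Term l
  sum : Term l → Term (suc l) → Term l

pattern _⊕_ a b = bin add a b
pattern _⊖_ a b = bin sub a b
pattern _⊗_ a b = bin mul a b

choose : ℕ → ℕ → ℕ → ℕ
choose zero    a b = b
choose (suc _) a b = a

-- It unfolds at the largest index because the compiled loop counts its register down to 0.
sumN : ℕ → (ℕ → ℕ) → ℕ
sumN zero    f = 0
sumN (suc k) f = f k + sumN k f

value : ∀ {l} → (ℕ → ℕ) → Vec ℕ l → Term l → ℕ
value μ ρ (con c)     = c
value μ ρ (var i)     = lookup ρ i
value μ ρ (at t)      = μ (value μ ρ t)
value μ ρ (bin o a b) = ⟦ o ⟧ (value μ ρ a) (value μ ρ b)
value μ ρ (ite c a b) = choose (value μ ρ c) (value μ ρ a) (value μ ρ b)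
value μ ρ (sum N b)   = sumN (value μ ρ N) (λ i → value μ (i ∷ ρ) b)

-- Variables live in the registers σ, all below d.  The result is left in
-- register d, and registers from d on are scratch space.
compile : ∀ {l} → Vec ℕ l → ℕ → Term l → Program
compile σ d (con c)     = set d (lit c)
compile σ d (var i)     = set d (reg (lookup σ i))
compile σ d (at t)      = compile σ d t ⨾ set d (load (reg d))
compile σ d (bin o a b) =
  compile σ d a ⨾ compile σ (1 + d) b ⨾ set d (op o (reg d) (reg (1 + d)))
compile σ d (ite c a b) = compile σ d c ⨾ cond (reg d) (compile σ d a) (compile σ d b)
compile σ d (sum N b)   =
  compile σ (1 + d) N ⨾ set d (lit 0) ⨾
  while (reg (1 + d))
    (set (1 + d) (op sub (reg (1 + d)) (lit 1)) ⨾
     compile (1 + d ∷ σ) (2 + d) b ⨾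
     set d (op add (reg (2 + d)) (reg d)))

-- The pair (a , b) stands for the bound B ^ a * M ^ b.
Degree : Set
Degree = ℕ × ℕ

degree : ∀ {l} → Vec Degree l → Term l → Degree
degree Γ (con c)         = c , 0
degree Γ (var i)         = lookup Γ i
-- All memory cells are kept below `B * M`, whatever their address.
degree Γ (at t)          = 1 , 1
degree Γ (bin add a b)   =
  1 + (proj₁ (degree Γ a) ⊔ proj₁ (degree Γ b)) , proj₂ (degree Γ a) ⊔ proj₂ (degree Γ b)
degree Γ (bin mul a b)   =
  proj₁ (degree Γ a) + proj₁ (degree Γ b) , proj₂ (degree Γ a) + proj₂ (degree Γ b)
degree Γ (bin sub a b)   = degree Γ a
degree Γ (bin div a b)   = degree Γ a
degree Γ (bin mod a b)   = degree Γ a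
degree Γ (bin less a b)  = 0 , 0
degree Γ (bin equal a b) = 0 , 0
degree Γ (ite c a b)     =
  proj₁ (degree Γ a) ⊔ proj₁ (degree Γ b) , proj₂ (degree Γ a) ⊔ proj₂ (degree Γ b)
degree Γ (sum N b)       =
  proj₁ (degree Γ N) + proj₁ (degree (degree Γ N ∷ Γ) b) ,
  proj₂ (degree Γ N) + proj₂ (degree (degree Γ N ∷ Γ) b)

-- An exponent of `B` alone: `loopBound` admits only sums whose number of terms is bounded by a
-- power of `B`, so evaluating a term never costs a factor `M`.
timeDegree : ∀ {l} → Vec Degree l → Term l → ℕ
timeDegree Γ (con c)     = 1
timeDegree Γ (var i)     = 1
timeDegree Γ (at t)      = 1 + timeDegree Γ t
timeDegree Γ (bin o a b) = 1 + (timeDegree Γ a ⊔ timeDegree Γ b)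
timeDegree Γ (ite c a b) = 1 + (timeDegree Γ c ⊔ (timeDegree Γ a ⊔ timeDegree Γ b))
timeDegree Γ (sum N b)   =
  1 + (timeDegree Γ N ⊔ (proj₁ (degree Γ N) + timeDegree (degree Γ N ∷ Γ) b))

module _ (A : ℕ) where

  fits : Degree → Bool
  fits (a , b) = (a ≤ᵇ A) ∧ (b ≤ᵇ 1)

  loopBound : Degree → Bool
  loopBound (a , b) = (a ≤ᵇ A) ∧ (b ≤ᵇ 0)

  -- A Boolean test, so that for the concrete terms of the program it is settled by evaluation, with
  -- `tt` as the proof. Only operations and sums can violate the word bound, hence only they are
  -- checked.
  admissible : ∀ {l} → Vec Degree l → Term l → Bool
  admissible Γ (con c)     = true
  admissible Γ (var i)     = true
  admissible Γ (at t)      = admissible Γ t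
  admissible Γ (bin o a b) = fits (degree Γ (bin o a b)) ∧ (admissible Γ a ∧ admissible Γ b)
  admissible Γ (ite c a b) = admissible Γ c ∧ (admissible Γ a ∧ admissible Γ b)
  admissible Γ (sum N b)   =
    loopBound (degree Γ N) ∧ (fits (degree Γ (sum N b)) ∧
    (admissible Γ N ∧ admissible (degree Γ N ∷ Γ) b))

∧-fst : ∀ {x y} → T (x ∧ y) → T x
∧-fst = proj₁ ∘ Equivalence.to T-∧

∧-snd : ∀ {x y} → T (x ∧ y) → T y
∧-snd = proj₂ ∘ Equivalence.to T-∧

update-same : ∀ (f : ℕ → ℕ) a x → (f [ a ≔ x ]) a ≡ x
update-same f a x with a ≡ᵇ a | ≡⇒≡ᵇ a a refl
... | true | _ = refl

update-other : ∀ (f : ℕ → ℕ) {a b} x → b ≢ a → (f [ a ≔ x ]) b ≡ f b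
update-other f {a} {b} x b≢a with b ≡ᵇ a in eq
... | true  = contradiction (≡ᵇ⇒≡ b a (subst T (sym eq) tt)) b≢a
... | false = refl

sumN-≤ : ∀ N {f m} → (∀ i → i < N → f i ≤ m) → sumN N f ≤ N * m
sumN-≤ zero    h = z≤n
sumN-≤ (suc N) h = +-mono-≤ (h N ≤-refl) (sumN-≤ N (λ i i<N → h i (m≤n⇒m≤1+n i<N)))

choose-≤ : ∀ c {a b m} → a ≤ m → b ≤ m → choose c a b ≤ m
choose-≤ zero    a≤ b≤ = b≤
choose-≤ (suc _) a≤ b≤ = a≤

div-≤ : ∀ x y → ⟦ div ⟧ x y ≤ x
div-≤ x zero    = z≤n
div-≤ x (suc y) = m/n≤m x (suc y)

mod-≤ : ∀ x y → ⟦ mod ⟧ x y ≤ x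
mod-≤ x zero    = z≤n
mod-≤ x (suc y) = m%n≤m x (suc y)

bit-≤ : ∀ b → bit b ≤ 1
bit-≤ true  = ≤-refl
bit-≤ false = z≤n

module Machine (B M A W : ℕ) (16≤B : 16 ≤ B) (1≤M : 1 ≤ M) (B^a*M≤W : ∀ a → a ≤ A → B ^ a * M ≤ W) where

  instance
    B≢0 : NonZero B
    B≢0 = >-nonZero (≤-trans (s≤s z≤n) 16≤B)

    M≢0 : NonZero M
    M≢0 = >-nonZero 1≤M

  size : Degree → ℕ
  size (a , b) = B ^ a * M ^ b

  size-mono : ∀ {a b a′ b′} → a ≤ a′ → b ≤ b′ → size (a , b) ≤ size (a′ , b′)
  size-mono a≤ b≤ = *-mono-≤ (^-monoʳ-≤ B a≤) (^-monoʳ-≤ M b≤)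

  1≤B^ : ∀ a → 1 ≤ B ^ a
  1≤B^ a = m^n>0 B a

  1≤size : ∀ δ → 1 ≤ size δ
  1≤size (a , b) = *-mono-≤ (m^n>0 B a) (m^n>0 M b)

  -- This is where the constant 16 comes from: the overhead of every construct of the compiler is at
  -- most a factor 16, reached by loops, and one more factor `B` swallows it.
  absorb : ∀ {k x} a → k ≤ 16 → x ≤ k * B ^ a → x ≤ B ^ suc a
  absorb a k≤ x≤ = ≤-trans x≤ (*-monoˡ-≤ (B ^ a) (≤-trans k≤ 16≤B))

  n≤B^n : ∀ n → n ≤ B ^ n
  n≤B^n zero    = z≤n
  n≤B^n (suc n) = absorb {k = 2} n (s≤s (s≤s z≤n))
    (≤-trans (+-mono-≤ (1≤B^ n) (n≤B^n n)) (+-monoʳ-≤ (B ^ n) (m≤m+n (B ^ n) 0)))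

  size-+ : ∀ {x y} a b a′ b′ → x ≤ size (a , b) → y ≤ size (a′ , b′) →
           x + y ≤ size (1 + (a ⊔ a′) , b ⊔ b′)
  size-+ {x} {y} a b a′ b′ x≤ y≤ = begin
    x + y                                   ≤⟨ +-mono-≤ x≤′ y≤′ ⟩
    s + s                                   ≤⟨ +-monoʳ-≤ s (m≤m+n s 0) ⟩
    2 * s                                   ≤⟨ *-monoˡ-≤ s (≤-trans (s≤s (s≤s z≤n)) 16≤B) ⟩
    B * s                                   ≡⟨ *-assoc B (B ^ (a ⊔ a′)) _ ⟨
    size (1 + (a ⊔ a′) , b ⊔ b′)            ∎
    where
    open ≤-Reasoning
    s = size (a ⊔ a′ , b ⊔ b′)
    x≤′ : x ≤ s
    x≤′ = ≤-trans x≤ (size-mono (m≤m⊔n a a′) (m≤m⊔n b b′))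
    y≤′ : y ≤ s
    y≤′ = ≤-trans y≤ (size-mono (m≤n⊔m a a′) (m≤n⊔m b b′))

  size-* : ∀ {x y} a b a′ b′ → x ≤ size (a , b) → y ≤ size (a′ , b′) →
           x * y ≤ size (a + a′ , b + b′)
  size-* {x} {y} a b a′ b′ x≤ y≤ = begin
    x * y                               ≤⟨ *-mono-≤ x≤ y≤ ⟩
    B ^ a * M ^ b * (B ^ a′ * M ^ b′)   ≡⟨ [m*n]*[o*p]≡[m*o]*[n*p] (B ^ a) (M ^ b) (B ^ a′) (M ^ b′) ⟩
    B ^ a * B ^ a′ * (M ^ b * M ^ b′)   ≡⟨ cong₂ _*_ (^-distribˡ-+-* B a a′) (^-distribˡ-+-* M b b′) ⟨
    size (a + a′ , b + b′)              ∎
    where open ≤-Reasoning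

  record Bounded {l} (Γ : Vec Degree l) (ρ : Vec ℕ l) : Set where
    constructor bounded
    field within : ∀ i → lookup ρ i ≤ size (lookup Γ i)

  open Bounded public

  MemBounded : (ℕ → ℕ) → Set
  MemBounded μ = ∀ a → μ a ≤ size (1 , 1)

  bounded-∷ : ∀ {l} {Γ : Vec Degree l} {ρ δ x} → x ≤ size δ → Bounded Γ ρ → Bounded (δ ∷ Γ) (x ∷ ρ)
  bounded-∷ x≤ (bounded b) = bounded λ { zero → x≤ ; (suc i) → b i }

  module _ {μ : ℕ → ℕ} (μ≤ : MemBounded μ) where

    value≤ : ∀ {l} {Γ : Vec Degree l} {ρ} → Bounded Γ ρ → ∀ t → value μ ρ t ≤ size (degree Γ t)
    value≤ ρ≤ (con c)         = ≤-trans (n≤B^n c) (≤-reflexive (sym (*-identityʳ (B ^ c))))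
    value≤ ρ≤ (var i)         = within ρ≤ i
    value≤ ρ≤ (at t)          = μ≤ _
    value≤ {Γ = Γ} ρ≤ (bin add a b)   = size-+ (proj₁ (degree Γ a)) (proj₂ (degree Γ a)) _ _ (value≤ ρ≤ a)
        (value≤ ρ≤ b)
    value≤ {Γ = Γ} ρ≤ (bin mul a b)   = size-* (proj₁ (degree Γ a)) (proj₂ (degree Γ a)) _ _ (value≤ ρ≤ a)
        (value≤ ρ≤ b)
    value≤ ρ≤ (bin sub a b)   = ≤-trans (m∸n≤m _ (value μ _ b)) (value≤ ρ≤ a)
    value≤ ρ≤ (bin div a b)   = ≤-trans (div-≤ _ (value μ _ b)) (value≤ ρ≤ a)
    value≤ ρ≤ (bin mod a b)   = ≤-trans (mod-≤ _ (value μ _ b)) (value≤ ρ≤ a)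
    value≤ ρ≤ (bin less a b)  = bit-≤ _
    value≤ ρ≤ (bin equal a b) = bit-≤ _
    value≤ {Γ = Γ} {ρ} ρ≤ (ite c a b) = choose-≤ (value μ ρ c)
      (≤-trans (value≤ ρ≤ a) (size-mono (m≤m⊔n (proj₁ (degree Γ a)) _) (m≤m⊔n (proj₂ (degree Γ a)) _)))
      (≤-trans (value≤ ρ≤ b) (size-mono (m≤n⊔m (proj₁ (degree Γ a)) _) (m≤n⊔m (proj₂ (degree Γ a)) _)))
    value≤ {Γ = Γ} {ρ} ρ≤ (sum N b) = ≤-trans
      (sumN-≤ (value μ ρ N) λ i i<N →
        value≤ (bounded-∷ (≤-trans (<⇒≤ i<N) (value≤ ρ≤ N)) ρ≤) b)
      (size-* (proj₁ (degree Γ N)) (proj₂ (degree Γ N)) _ _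
        (value≤ ρ≤ N) ≤-refl)

  fits⇒≤W : ∀ {x} δ → T (fits A δ) → x ≤ size δ → x ≤ W
  fits⇒≤W (a , b) f x≤ = ≤-trans x≤ (≤-trans
    (*-monoʳ-≤ (B ^ a) (≤-trans (^-monoʳ-≤ M (≤ᵇ⇒≤ b 1 (∧-snd {a ≤ᵇ A} f))) (≤-reflexive (*-identityʳ M))))
    (B^a*M≤W a (≤ᵇ⇒≤ a A (∧-fst f))))

  loopBound⇒fits : ∀ δ → T (loopBound A δ) → T (fits A δ)
  loopBound⇒fits (a , zero) f = f
  loopBound⇒fits (a , suc b) f with () ← ∧-snd {a ≤ᵇ A} f

  Output : Program → (ℕ → ℕ) → (ℕ → ℕ) → ℕ → ℕ → ℕ → Set
  Output p f μ τ d v = ∃[ t ] ∃[ f′ ]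
    (W ⊢ p , state f μ ⇓[ t ] state f′ μ) × t ≤ B ^ τ × f′ d ≡ v × (∀ r → r < d → f′ r ≡ f r)

  loop-time : ∀ {tN a aN τN τb} → tN ≤ B ^ τN → a ≤ B ^ aN →
              tN + (2 + (a * (10 + B ^ τb) + 2)) ≤ B ^ suc (τN ⊔ (aN + τb))
  loop-time {tN} {a} {aN} {τN} {τb} tN≤ a≤ = absorb {k = 16} m ≤-refl (begin
    tN + (2 + (a * (10 + B ^ τb) + 2)) ≤⟨ +-mono-≤ (≤-trans tN≤ (^-monoʳ-≤ B (m≤m⊔n τN _)))
                                            (+-mono-≤ 2≤ (+-mono-≤ iter 2≤)) ⟩
    X + (2 * X + (11 * X + 2 * X))     ≡⟨ cong (X +_) (trans (cong (2 * X +_) (sym (*-distribʳ-+ X 11 2)))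
        (sym (*-distribʳ-+ X 2 13))) ⟩
    16 * X                             ∎)
    where
    open ≤-Reasoning
    m = τN ⊔ (aN + τb)
    X = B ^ m
    2≤ : 2 ≤ 2 * X
    2≤ = *-monoʳ-≤ 2 (1≤B^ m)
    iter : a * (10 + B ^ τb) ≤ 11 * X
    iter = begin
      a * (10 + B ^ τb)           ≤⟨ *-mono-≤ a≤ (+-monoˡ-≤ (B ^ τb) (*-monoʳ-≤ 10 (1≤B^ τb))) ⟩
      B ^ aN * (10 * B ^ τb + B ^ τb) ≡⟨ cong (B ^ aN *_) (+-comm (10 * B ^ τb) (B ^ τb)) ⟩
      B ^ aN * (11 * B ^ τb)      ≡⟨ *-assoc (B ^ aN) 11 _ ⟨
      B ^ aN * 11 * B ^ τb        ≡⟨ cong (_* B ^ τb) (*-comm (B ^ aN) 11) ⟩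
      11 * B ^ aN * B ^ τb        ≡⟨ *-assoc 11 (B ^ aN) (B ^ τb) ⟩
      11 * (B ^ aN * B ^ τb)      ≡⟨ cong (11 *_) (^-distribˡ-+-* B aN τb) ⟨
      11 * B ^ (aN + τb)          ≤⟨ *-monoʳ-≤ 11 (^-monoʳ-≤ B (m≤n⊔m τN (aN + τb))) ⟩
      11 * X                      ∎

  branch-time : ∀ {x y z t₁ t₂} → t₁ ≤ B ^ x → t₂ ≤ B ^ y → y ≤ z →
                t₁ + (2 + t₂) ≤ B ^ suc (x ⊔ z)
  branch-time {x} {y} {z} t₁≤ t₂≤ y≤z = absorb {k = 4} m (s≤s (s≤s (s≤s (s≤s z≤n))))
    (+-mono-≤ (≤-trans t₁≤ (^-monoʳ-≤ B (m≤m⊔n x z)))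
      (+-mono-≤ (1≤B^ m) (+-mono-≤ (1≤B^ m)
        (≤-trans t₂≤ (≤-trans (^-monoʳ-≤ B (≤-trans y≤z (m≤n⊔m x z))) (m≤m+n _ 0))))))
    where m = x ⊔ z

  module _ {μ : ℕ → ℕ} (μ≤ : MemBounded μ) where

    compile-correct : ∀ {l} {Γ : Vec Degree l} {ρ} (σ : Vec ℕ l) d t {f} →
      Bounded Γ ρ → T (admissible A Γ t) →
      (∀ i → lookup σ i < d) → (∀ i → f (lookup σ i) ≡ lookup ρ i) →
      Output (compile σ d t) f μ (timeDegree Γ t) d (value μ ρ t)

    -- A round costs 2 for the test, 4 for each of the two assignments, and the time of the body;
    -- the failing test costs the final 2. The accumulator is arbitrary for the sake of the
    -- induction, and bounding it together with the whole remaining sum by `W` bounds all partial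
    -- sums at once.
    loop-correct : ∀ {l} {Γ : Vec Degree l} {ρ} (σ : Vec ℕ l) d {δ} t →
      Bounded Γ ρ → T (admissible A (δ ∷ Γ) t) → (∀ i → lookup σ i < d) →
      ∀ N → N ≤ size δ → N ≤ W → sumN N (λ i → value μ (i ∷ ρ) t) ≤ W →
      ∀ {f} → f (1 + d) ≡ N → (∀ i → f (lookup σ i) ≡ lookup ρ i) → ∀ {acc} → f d ≡ acc →
      acc + sumN N (λ i → value μ (i ∷ ρ) t) ≤ W →
      ∃[ T ] ∃[ f′ ]
        (W ⊢ while (reg (1 + d))
              (set (1 + d) (op sub (reg (1 + d)) (lit 1)) ⨾
               compile (1 + d ∷ σ) (2 + d) t ⨾
               set d (op add (reg (2 + d)) (reg d))) , state f μ ⇓[ T ] state f′ μ) ×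
        T ≤ N * (10 + B ^ timeDegree (δ ∷ Γ) t) + 2 ×
        f′ d ≡ acc + sumN N (λ i → value μ (i ∷ ρ) t) ×
        (∀ r → r < d → f′ r ≡ f r)
    loop-correct σ d t ρ≤ ok σ< zero N≤ N≤W s≤W fN fσ facc a≤W =
      _ , _ , ⇓-exit _ fN , ≤-refl , trans facc (sym (+-identityʳ _)) , λ _ _ → refl
    loop-correct {Γ = Γ} {ρ} σ d {δ} t ρ≤ ok σ< (suc N) N≤ N≤W s≤W {f} fN fσ {acc} facc a≤W =
      let
        v  = value μ (N ∷ ρ) t
        f₁ = f [ 1 + d ≔ f (1 + d) ∸ 1 ]
        f₁N : f₁ (1 + d) ≡ N
        f₁N = trans (update-same f (1 + d) _) (cong (_∸ 1) fN)
        σ≢ : ∀ i → lookup σ i ≢ 1 + d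
        σ≢ i eq = <-irrefl eq (m≤n⇒m≤1+n (σ< i))
        f₁σ : ∀ i → f₁ (lookup (1 + d ∷ σ) i) ≡ lookup (N ∷ ρ) i
        f₁σ = λ { zero → f₁N ; (suc i) → trans (update-other f _ (σ≢ i)) (fσ i) }
        t₂ , f₂ , run₂ , t₂≤ , f₂v , f₂o = compile-correct (1 + d ∷ σ) (2 + d) t {f₁}
          (bounded-∷ (≤-trans (n≤1+n N) N≤) ρ≤) ok
          (λ { zero → ≤-refl ; (suc i) → m≤n⇒m≤1+n (m≤n⇒m≤1+n (σ< i)) }) f₁σ
        f₂d : f₂ d ≡ acc
        f₂d = trans (f₂o d (m≤n⇒m≤1+n ≤-refl))
                (trans (update-other f _ (λ eq → <-irrefl eq ≤-refl)) facc)
        new : f₂ (2 + d) + f₂ d ≡ v + acc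
        new = cong₂ _+_ f₂v f₂d
        f₃ = f₂ [ d ≔ f₂ (2 + d) + f₂ d ]
        f₃-other : ∀ r → r < d → f₃ r ≡ f r
        f₃-other = λ r r<d → trans (update-other f₂ _ (λ eq → <-irrefl eq r<d))
          (trans (f₂o r (m≤n⇒m≤1+n (m≤n⇒m≤1+n r<d))) (update-other f _ (λ eq → <-irrefl eq (m≤n⇒m≤1+n r<d))))
        f₃N : f₃ (1 + d) ≡ N
        f₃N = trans (update-other f₂ _ (λ eq → <-irrefl (sym eq) ≤-refl)) (trans (f₂o (1 + d) ≤-refl) f₁N)
        S = sumN N (λ i → value μ (i ∷ ρ) t)
        shift : v + acc + S ≡ acc + (v + S)
        shift = trans (cong (_+ S) (+-comm v acc)) (+-assoc acc v S)
        t₄ , f₄ , run₄ , t₄≤ , f₄v , f₄o = loop-correct σ d t ρ≤ ok σ< N (≤-trans (n≤1+n N) N≤)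
          (≤-trans (n≤1+n N) N≤W) (≤-trans (m≤n+m S v) s≤W) {f₃} f₃N
          (λ i → trans (f₃-other _ (σ< i)) (fσ i)) {v + acc}
          (trans (update-same f₂ d _) new) (≤-trans (≤-reflexive shift) a≤W)
        add≤W : f₂ (2 + d) + f₂ d ≤ W
        add≤W = ≤-trans (≤-reflexive new) (≤-trans (m≤m+n (v + acc) S) (≤-trans (≤-reflexive shift) a≤W))
        sub≤W : f (1 + d) ∸ 1 ≤ W
        sub≤W = ≤-trans (m∸n≤m _ 1) (≤-trans (≤-reflexive fN) N≤W)
        X = B ^ timeDegree (δ ∷ Γ) t
        time≤ : 1 + (1 + ((4 + (t₂ + 4)) + t₄)) ≤ (10 + X) + N * (10 + X) + 2
        time≤ = begin
          2 + ((4 + (t₂ + 4)) + t₄) ≡⟨ cong (λ z → 2 + (4 + z + t₄)) (+-comm t₂ 4) ⟩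
          10 + t₂ + t₄              ≤⟨ +-mono-≤ (+-monoʳ-≤ 10 t₂≤) t₄≤ ⟩
          10 + X + (N * (10 + X) + 2) ≡⟨ +-assoc (10 + X) (N * (10 + X)) 2 ⟨
          (10 + X) + N * (10 + X) + 2 ∎
      in _ , f₄ ,
         ⇓-loop _ (λ eq → 1+n≢0 (trans (sym fN) eq))
           (⇓-seq (⇓-set (_ , _ , sub≤W)) (⇓-seq run₂ (⇓-set (_ , _ , add≤W)))) run₄ ,
         time≤ ,
         trans f₄v shift ,
         λ r r<d → trans (f₄o r r<d) (f₃-other r r<d)
      where open ≤-Reasoning

    compile-correct σ d (con c) {f} ρ≤ ok σ< fσ =
      _ , _ , ⇓-set _ , absorb {k = 2} 0 (s≤s (s≤s z≤n)) ≤-refl , update-same f d _ ,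
      λ r r<d → update-other f _ (λ eq → <-irrefl eq r<d)
    compile-correct σ d (var i) {f} ρ≤ ok σ< fσ =
      _ , _ , ⇓-set _ , absorb {k = 2} 0 (s≤s (s≤s z≤n)) ≤-refl , trans (update-same f d _) (fσ i) ,
      λ r r<d → update-other f _ (λ eq → <-irrefl eq r<d)
    compile-correct {Γ = Γ} σ d (at t) {f} ρ≤ ok σ< fσ
      with compile-correct σ d t {f} ρ≤ ok σ< fσ
    ... | t₁ , f₁ , run₁ , t₁≤ , f₁v , f₁o =
      _ , _ , ⇓-seq run₁ (⇓-set _) ,
      absorb {k = 4} (timeDegree Γ t) (s≤s (s≤s (s≤s (s≤s z≤n))))
        (+-mono-≤ t₁≤ (*-monoʳ-≤ 3 (1≤B^ (timeDegree Γ t)))) ,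
      trans (update-same f₁ d _) (cong μ f₁v) ,
      λ r r<d → trans (update-other f₁ _ (λ eq → <-irrefl eq r<d)) (f₁o r r<d)
    compile-correct {Γ = Γ} {ρ} σ d (bin o a b) {f} ρ≤ ok σ< fσ
      with compile-correct σ d a {f} ρ≤ (∧-fst (∧-snd {fits A (degree Γ (bin o a b))} ok)) σ< fσ
    ... | t₁ , f₁ , run₁ , t₁≤ , f₁v , f₁o
      with compile-correct σ (1 + d) b {f₁} ρ≤ (∧-snd {admissible A Γ a} (∧-snd {fits A (degree Γ (bin o a b))} ok))
             (λ i → m≤n⇒m≤1+n (σ< i)) (λ i → trans (f₁o _ (σ< i)) (fσ i))
    ... | t₂ , f₂ , run₂ , t₂≤ , f₂v , f₂o =
      _ , _ ,
      ⇓-seq run₁ (⇓-seq run₂ (⇓-set (_ , _ , ≤-trans (≤-reflexive result)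
        (fits⇒≤W (degree Γ (bin o a b)) (∧-fst ok) (value≤ μ≤ ρ≤ (bin o a b)))))) ,
      absorb {k = 6} (timeDegree Γ a ⊔ timeDegree Γ b) (s≤s (s≤s (s≤s (s≤s (s≤s (s≤s z≤n))))))
        (+-mono-≤ (≤-trans t₁≤ (^-monoʳ-≤ B (m≤m⊔n (timeDegree Γ a) _)))
          (+-mono-≤ (≤-trans t₂≤ (^-monoʳ-≤ B (m≤n⊔m (timeDegree Γ a) _)))
            (*-monoʳ-≤ 4 (1≤B^ (timeDegree Γ a ⊔ timeDegree Γ b))))) ,
      trans (update-same f₂ d _) result ,
      λ r r<d → trans (update-other f₂ _ (λ eq → <-irrefl eq r<d))
        (trans (f₂o r (m≤n⇒m≤1+n r<d)) (f₁o r r<d))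
      where
      result : ⟦ o ⟧ (f₂ d) (f₂ (1 + d)) ≡ value μ ρ (bin o a b)
      result = cong₂ ⟦ o ⟧ (trans (f₂o d ≤-refl) f₁v) f₂v
    compile-correct {Γ = Γ} {ρ} σ d (ite c a b) {f} ρ≤ ok σ< fσ
      with compile-correct σ d c {f} ρ≤ (∧-fst ok) σ< fσ
    ... | t₁ , f₁ , run₁ , t₁≤ , f₁v , f₁o with value μ ρ c
    ... | suc _
      with compile-correct σ d a {f₁} ρ≤ (∧-fst (∧-snd {admissible A Γ c} ok)) σ<
             (λ i → trans (f₁o _ (σ< i)) (fσ i))
    ... | t₂ , f₂ , run₂ , t₂≤ , f₂v , f₂o =
      _ , f₂ , ⇓-seq run₁ (⇓-then _ (λ eq → 1+n≢0 (trans (sym f₁v) eq)) run₂) ,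
      branch-time {x = timeDegree Γ c} t₁≤ t₂≤ (m≤m⊔n (timeDegree Γ a) _) ,
      f₂v , λ r r<d → trans (f₂o r r<d) (f₁o r r<d)
    compile-correct {Γ = Γ} {ρ} σ d (ite c a b) {f} ρ≤ ok σ< fσ
      | t₁ , f₁ , run₁ , t₁≤ , f₁v , f₁o | zero
      with compile-correct σ d b {f₁} ρ≤ (∧-snd {admissible A Γ a} (∧-snd {admissible A Γ c} ok)) σ<
             (λ i → trans (f₁o _ (σ< i)) (fσ i))
    ... | t₂ , f₂ , run₂ , t₂≤ , f₂v , f₂o =
      _ , f₂ , ⇓-seq run₁ (⇓-else _ f₁v run₂) ,
      branch-time {x = timeDegree Γ c} t₁≤ t₂≤ (m≤n⊔m (timeDegree Γ a) _) ,
      f₂v , λ r r<d → trans (f₂o r r<d) (f₁o r r<d)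
    compile-correct {Γ = Γ} {ρ} σ d (sum N b) {f} ρ≤ ok σ< fσ
      with compile-correct σ (1 + d) N {f} ρ≤
             (∧-fst (∧-snd {fits A (degree Γ (sum N b))} (∧-snd {loopBound A (degree Γ N)} ok)))
             (λ i → m≤n⇒m≤1+n (σ< i)) fσ
    ... | t₁ , f₁ , run₁ , t₁≤ , f₁v , f₁o
      with loop-correct σ d {degree Γ N} b ρ≤
             (∧-snd {admissible A Γ N} (∧-snd {fits A (degree Γ (sum N b))} (∧-snd {loopBound A (degree Γ N)} ok)))
             σ< (value μ ρ N) (value≤ μ≤ ρ≤ N)
             (fits⇒≤W (degree Γ N) (loopBound⇒fits (degree Γ N) (∧-fst ok)) (value≤ μ≤ ρ≤ N))
             (fits⇒≤W (degree Γ (sum N b)) (∧-fst (∧-snd {loopBound A (degree Γ N)} ok)) (value≤ μ≤ ρ≤ (sum N b)))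
             {f₁ [ d ≔ 0 ]} (trans (update-other f₁ _ (λ eq → <-irrefl (sym eq) ≤-refl)) f₁v)
             (λ i → trans (update-other f₁ _ (λ eq → <-irrefl eq (σ< i)))
               (trans (f₁o _ (m≤n⇒m≤1+n (σ< i))) (fσ i)))
             {0} (update-same f₁ d 0)
             (fits⇒≤W (degree Γ (sum N b)) (∧-fst (∧-snd {loopBound A (degree Γ N)} ok)) (value≤ μ≤ ρ≤ (sum N b)))
    ... | t₂ , f₂ , run₂ , t₂≤ , f₂v , f₂o =
      _ , f₂ , ⇓-seq run₁ (⇓-seq (⇓-set _) run₂) ,
      ≤-trans (+-monoʳ-≤ t₁ (+-monoʳ-≤ 2 t₂≤)) (loop-time {aN = proj₁ (degree Γ N)} {timeDegree Γ N}
          {timeDegree (degree Γ N ∷ Γ) b} t₁≤ N≤) ,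
      f₂v ,
      λ r r<d → trans (f₂o r r<d) (trans (update-other f₁ _ (λ eq → <-irrefl eq r<d)) (f₁o r (m≤n⇒m≤1+n r<d)))
      where
      N≤ : value μ ρ N ≤ B ^ proj₁ (degree Γ N)
      N≤ = loopBound-size (degree Γ N) (∧-fst ok) (value≤ μ≤ ρ≤ N)
        where
        loopBound-size : ∀ {x} δ → T (loopBound A δ) → x ≤ size δ → x ≤ B ^ proj₁ δ
        loopBound-size (a , zero)  f x≤ = ≤-trans x≤ (≤-reflexive (*-identityʳ (B ^ a)))
        loopBound-size (a , suc b) f x≤ with () ← ∧-snd {a ≤ᵇ A} f

-- Hoare triples with time bounds

assign : ∀ {D} → Fin D → Term D → Program
assign {D} r t = compile (tabulate toℕ) D t ⨾ set (toℕ r) (reg D)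

write : ∀ {D} → Term D → Term D → Program
write {D} a t =
  compile (tabulate toℕ) D a ⨾ compile (tabulate toℕ) (1 + D) t ⨾ store (reg D) (reg (1 + D))

module Triples (B M A W : ℕ) (16≤B : 16 ≤ B) (1≤M : 1 ≤ M) (B^a*M≤W : ∀ a → a ≤ A → B ^ a * M ≤ W)
               {D : ℕ} (Γ : Vec Degree D) where

  open Machine B M A W 16≤B 1≤M B^a*M≤W public

  Holds : (ℕ → ℕ) → Vec ℕ D → Set
  Holds f ρ = ∀ i → f (toℕ i) ≡ lookup ρ i

  -- A triple for total correctness. Only the first `D` registers are described; the scratch
  -- registers above them may hold anything before and after.
  record Runs (p : Program) (T : ℕ) (ρ : Vec ℕ D) (μ : ℕ → ℕ) (Q : Vec ℕ D → (ℕ → ℕ) → Set) : Set where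
    constructor runs
    field run : ∀ f → Holds f ρ → ∃[ t ] ∃[ f′ ] ∃[ ρ′ ] ∃[ μ′ ]
            (W ⊢ p , state f μ ⇓[ t ] state f′ μ′) × t ≤ T × Holds f′ ρ′ × Q ρ′ μ′

  open Runs public

  slower : ∀ {p T T′ ρ μ Q} → T ≤ T′ → Runs p T ρ μ Q → Runs p T′ ρ μ Q
  slower T≤T′ (runs go) = runs λ f h → let _ , _ , _ , _ , r , t≤T , rest = go f h in
    _ , _ , _ , _ , r , ≤-trans t≤T T≤T′ , rest

  weaken : ∀ {p T ρ μ P Q} → (∀ {ρ′ μ′} → P ρ′ μ′ → Q ρ′ μ′) → Runs p T ρ μ P → Runs p T ρ μ Q
  weaken P⇒Q (runs go) = runs λ f h → let _ , _ , _ , _ , r , t≤T , h′ , q = go f h in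
    _ , _ , _ , _ , r , t≤T , h′ , P⇒Q q

  sequence : ∀ {p q T T′ ρ μ P Q} → Runs p T ρ μ P → (∀ ρ′ μ′ → P ρ′ μ′ → Runs q T′ ρ′ μ′ Q) →
             Runs (p ⨾ q) (T + T′) ρ μ Q
  run (sequence run₁ run₂) f h with run run₁ f h
  ... | _ , f₁ , ρ₁ , μ₁ , r₁ , t₁≤ , h₁ , P₁ with run (run₂ ρ₁ μ₁ P₁) f₁ h₁
  ... | _ , f₂ , ρ₂ , μ₂ , r₂ , t₂≤ , h₂ , Q₂ =
    _ , _ , _ , _ , ⇓-seq r₁ r₂ , +-mono-≤ t₁≤ t₂≤ , h₂ , Q₂

  private
    scope : ∀ i → lookup (tabulate {n = D} toℕ) i < D
    scope i = ≤-trans (≤-reflexive (cong suc (lookup∘tabulate toℕ i))) (toℕ<n i)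

    at-tabulate : ∀ {f : ℕ → ℕ} {ρ : Vec ℕ D} → Holds f ρ →
                  ∀ i → f (lookup (tabulate {n = D} toℕ) i) ≡ lookup ρ i
    at-tabulate {f} h i = trans (cong f (lookup∘tabulate toℕ i)) (h i)

  assign-runs : ∀ r t {ρ μ Q} → Bounded Γ ρ → MemBounded μ → T (admissible A Γ t) →
                Q (ρ [ r ]:= value μ ρ t) μ →
                Runs (assign r t) (B ^ suc (timeDegree Γ t)) ρ μ Q
  run (assign-runs r t {ρ} {μ} ρ≤ μ≤ ok q) f h
    with compile-correct μ≤ (tabulate toℕ) D t {f} ρ≤ ok scope (at-tabulate {f} {ρ} h)
  ... | _ , f₁ , run₁ , t₁≤ , f₁v , f₁o =
    _ , _ , _ , _ , ⇓-seq run₁ (⇓-set _) ,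
    absorb {k = 3} (timeDegree Γ t) (s≤s (s≤s (s≤s z≤n)))
      (+-mono-≤ t₁≤ (*-monoʳ-≤ 2 (1≤B^ (timeDegree Γ t)))) ,
    holds , q
    where
    holds : Holds (f₁ [ toℕ r ≔ f₁ D ]) (ρ [ r ]:= value μ ρ t)
    holds i with i ≟ᶠ r
    ... | yes refl = trans (update-same f₁ (toℕ r) _) (trans f₁v (sym (lookup∘update r ρ _)))
    ... | no i≢r   = trans (update-other f₁ _ (λ eq → i≢r (toℕ-injective eq)))
                       (trans (f₁o (toℕ i) (toℕ<n i)) (trans (h i) (sym (lookup∘update′ i≢r ρ _))))

  write-runs : ∀ a t {ρ μ Q} → Bounded Γ ρ → MemBounded μ →
               T (admissible A Γ a) → T (admissible A Γ t) →
               Q ρ (μ [ value μ ρ a ≔ value μ ρ t ]) →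
               Runs (write a t) (B ^ suc (timeDegree Γ a ⊔ timeDegree Γ t)) ρ μ Q
  run (write-runs a t {ρ} {μ} {Q} ρ≤ μ≤ oka okt q) f h
    with compile-correct μ≤ (tabulate toℕ) D a {f} ρ≤ oka scope (at-tabulate {f} {ρ} h)
  ... | _ , f₁ , run₁ , t₁≤ , f₁v , f₁o
    with compile-correct μ≤ (tabulate toℕ) (1 + D) t {f₁} ρ≤ okt (λ i → m≤n⇒m≤1+n (scope i))
           (λ i → trans (f₁o _ (scope i)) (at-tabulate {f} {ρ} h i))
  ... | _ , f₂ , run₂ , t₂≤ , f₂v , f₂o =
    _ , _ , _ , _ , ⇓-seq run₁ (⇓-seq run₂ (⇓-store _ _)) ,
    absorb {k = 5} m (s≤s (s≤s (s≤s (s≤s (s≤s z≤n)))))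
      (+-mono-≤ (≤-trans t₁≤ (^-monoʳ-≤ B (m≤m⊔n (timeDegree Γ a) _)))
        (+-mono-≤ (≤-trans t₂≤ (^-monoʳ-≤ B (m≤n⊔m (timeDegree Γ a) _)))
          (*-monoʳ-≤ 3 (1≤B^ m)))) ,
    (λ i → trans (f₂o _ (m≤n⇒m≤1+n (toℕ<n i))) (trans (f₁o _ (toℕ<n i)) (h i))) ,
    subst (Q ρ) (cong₂ (λ x y → μ [ x ≔ y ]) (sym (trans (f₂o D ≤-refl) f₁v)) (sym f₂v)) q
    where m = timeDegree Γ a ⊔ timeDegree Γ t

  -- The index of the invariant bounds the number of rounds still possible. The loop may stop before
  -- the index is used up, as the search for a cover does, hence the unspecified `k′` at the end.
  while-runs : ∀ r {p T} (I : ℕ → Vec ℕ D → (ℕ → ℕ) → Set) →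
    (∀ k ρ μ → I k ρ μ → lookup ρ r ≢ 0 → ∃[ k′ ] k ≡ suc k′ × Runs p T ρ μ (I k′)) →
    ∀ k {ρ μ} → I k ρ μ →
    Runs (while (reg (toℕ r)) p) (k * (2 + T) + 2) ρ μ
      (λ ρ′ μ′ → lookup ρ′ r ≡ 0 × ∃[ k′ ] I k′ ρ′ μ′)
  run (while-runs r {p} {T} I step k {ρ} {μ} i) f h with lookup ρ r in eq
  ... | zero = _ , _ , _ , _ , ⇓-exit _ (trans (h r) eq) , m≤n+m 2 (k * (2 + T)) , h , eq , k , i
  ... | suc _ with step k ρ μ i (λ z → 1+n≢0 (trans (sym eq) z))
  ... | k′ , refl , once with run once f h
  ... | _ , f₁ , ρ₁ , μ₁ , r₁ , t₁≤ , h₁ , i₁ with run (while-runs r I step k′ i₁) f₁ h₁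
  ... | _ , f₂ , ρ₂ , μ₂ , r₂ , t₂≤ , h₂ , q =
    _ , _ , _ , _ , ⇓-loop _ (λ z → 1+n≢0 (trans (sym (trans (h r) eq)) z)) r₁ r₂ ,
    ≤-trans (s≤s (s≤s (+-mono-≤ t₁≤ t₂≤))) (≤-reflexive (cong (2 +_) (sym (+-assoc T (k′ * (2 + T)) 2)))) ,
    h₂ , q

  run-after : ∀ {p q s T T′ ρ μ r v} →
    ∃[ t ] ∃[ f ] (W ⊢ p , s ⇓[ t ] state f μ) × t ≤ T × Holds f ρ →
    Runs q T′ ρ μ (λ ρ′ _ → lookup ρ′ r ≡ v) →
    ∃[ t ] ∃[ s′ ] (W ⊢ p ⨾ q , s ⇓[ t ] s′) × t ≤ T + T′ × regs s′ (toℕ r) ≡ v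
  run-after {r = r} (_ , f , run₁ , t₁≤ , h₁) (runs go) with go f h₁
  ... | _ , _ , _ , _ , run₂ , t₂≤ , h₂ , q = _ , _ , ⇓-seq run₁ run₂ , +-mono-≤ t₁≤ t₂≤ , trans (h₂ r) q

-- Counting and colourings

∧-intro : ∀ {x y} → T x → T y → T (x ∧ y)
∧-intro p q = Equivalence.from T-∧ (p , q)

not-intro : ∀ {x} → ¬ T x → T (not x)
not-intro {true}  f = f tt
not-intro {false} f = tt

not-elim : ∀ {x} → T (not x) → ¬ T x
not-elim {false} _ ()

≡ᵇ-true : ∀ {x y} → x ≡ y → T (x ≡ᵇ y)
≡ᵇ-true {x} {y} = ≡⇒≡ᵇ x y

≡ᵇ-eq : ∀ x {y} → T (x ≡ᵇ y) → x ≡ y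
≡ᵇ-eq x {y} = ≡ᵇ⇒≡ x y

T-does : ∀ {A : Set} (d : Dec A) → T (does d) → A
T-does (yes a) _ = a

does-T : ∀ {A : Set} (d : Dec A) → A → T (does d)
does-T (yes _) _ = tt
does-T (no ¬a) a = ¬a a

sumF : ∀ {n} → (Fin n → ℕ) → ℕ
sumF {zero}  f = 0
sumF {suc n} f = f zero + sumF (f ∘ suc)

anyF : ∀ {n} → (Fin n → Bool) → Bool
anyF {zero}  p = false
anyF {suc n} p = p zero ∨ anyF (p ∘ suc)

count : ∀ {n} → (Fin n → Bool) → ℕ
count p = sumF (bit ∘ p)

any-witness : ∀ {n} (p : Fin n → Bool) → T (anyF p) → ∃[ i ] T (p i)
any-witness {suc n} p t with p zero in eq
... | true = zero , subst T (sym eq) tt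
... | false with any-witness (p ∘ suc) t
...   | i , q = suc i , q

any-intro : ∀ {n} (p : Fin n → Bool) i → T (p i) → T (anyF p)
any-intro p zero    t = Equivalence.from T-∨ (inj₁ t)
any-intro p (suc i) t = Equivalence.from (T-∨ {p zero}) (inj₂ (any-intro (p ∘ suc) i t))

sumF-mono : ∀ {n} {f g : Fin n → ℕ} → (∀ i → f i ≤ g i) → sumF f ≤ sumF g
sumF-mono {zero}  h = z≤n
sumF-mono {suc n} h = +-mono-≤ (h zero) (sumF-mono (h ∘ suc))

sumF-cong : ∀ {n} {f g : Fin n → ℕ} → (∀ i → f i ≡ g i) → sumF f ≡ sumF g
sumF-cong {zero}  h = refl
sumF-cong {suc n} h = cong₂ _+_ (h zero) (sumF-cong (h ∘ suc))

sumF-+ : ∀ {n} (f g : Fin n → ℕ) → sumF (λ i → f i + g i) ≡ sumF f + sumF g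
sumF-+ {zero}  f g = refl
sumF-+ {suc n} f g = trans (cong (f zero + g zero +_) (sumF-+ (f ∘ suc) (g ∘ suc)))
  (interchange +-commutativeSemigroup (f zero) (g zero) _ _)

count-≤ : ∀ {n} (p : Fin n → Bool) → count p ≤ n
count-≤ {zero}  p = z≤n
count-≤ {suc n} p = +-mono-≤ (bit-≤ (p zero)) (count-≤ (p ∘ suc))

bit-mono : ∀ {x y} → (T x → T y) → bit x ≤ bit y
bit-mono {false}         h = z≤n
bit-mono {true}  {true}  h = ≤-refl
bit-mono {true}  {false} h = ⊥-elim (h tt)

bit-disjoint : ∀ {x y z} → (T x → T z) → (T y → T z) → (T x → T y → ⊥) → bit x + bit y ≤ bit z
bit-disjoint {false}         f g h = bit-mono g
bit-disjoint {true} {true}   f g h = ⊥-elim (h tt tt)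
bit-disjoint {true} {false} {z} f g h = bit-mono {true} {z} f

bit-cover : ∀ {x y z} → (T z → T x ⊎ T y) → bit z ≤ bit x + bit y
bit-cover {x} {y} {false} h = z≤n
bit-cover {true}  {y}     {true} h = s≤s z≤n
bit-cover {false} {true}  {true} h = ≤-refl
bit-cover {false} {false} {true} h with h tt
... | inj₁ ()
... | inj₂ ()

count-mono : ∀ {n} {p q : Fin n → Bool} → (∀ i → T (p i) → T (q i)) → count p ≤ count q
count-mono h = sumF-mono λ i → bit-mono (h i)

count-disjoint : ∀ {n} {p q r : Fin n → Bool} → (∀ i → T (p i) → T (r i)) →
  (∀ i → T (q i) → T (r i)) → (∀ i → T (p i) → T (q i) → ⊥) → count p + count q ≤ count r
count-disjoint {p = p} {q} f g h = ≤-trans (≤-reflexive (sym (sumF-+ (bit ∘ p) (bit ∘ q))))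
  (sumF-mono λ i → bit-disjoint (f i) (g i) (h i))

count-cover : ∀ {n} {p q r : Fin n → Bool} → (∀ i → T (r i) → T (p i) ⊎ T (q i)) →
  count r ≤ count p + count q
count-cover {p = p} {q} h = ≤-trans (sumF-mono λ i → bit-cover (h i))
  (≤-reflexive (sumF-+ (bit ∘ p) (bit ∘ q)))

count-none : ∀ {n} {p : Fin n → Bool} → (∀ i → ¬ T (p i)) → count p ≡ 0
count-none {zero}      h = refl
count-none {suc n} {p} h with p zero in eq
... | true  = ⊥-elim (h zero (subst T (sym eq) tt))
... | false = count-none (h ∘ suc)

count-some : ∀ {n} {p : Fin n → Bool} i → T (p i) → 1 ≤ count p
count-some {p = p} zero    t with p zero
... | true = s≤s z≤n
count-some {p = p} (suc i) t = ≤-trans (count-some i t) (m≤n+m _ (bit (p zero)))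

-- It supplies the arbitrary set of exclusive vertices whose deletion brings a new component down to
-- ℓ vertices.
thin : ∀ {n} (p : Fin n → Bool) {z} → z ≤ count p →
       ∃[ q ] (∀ i → T (q i) → T (p i)) × count q ≡ z
thin {zero}  p z≤n = (λ ()) , (λ ()) , refl
thin {suc n} p {z} z≤ with p zero in eq
... | false with thin (p ∘ suc) z≤
...   | q , q⊆p , #q = (λ { zero → false ; (suc i) → q i }) , (λ { zero () ; (suc i) → q⊆p i }) , #q
thin {suc n} p {zero} z≤ | true = (λ _ → false) , (λ _ ()) , count-none {p = λ (_ : Fin (suc n)) → false} (λ _ ())
thin {suc n} p {suc z} (s≤s z≤) | true with thin (p ∘ suc) z≤
... | q , q⊆p , #q = (λ { zero → true ; (suc i) → q i }) ,
  (λ { zero _ → subst T (sym eq) tt ; (suc i) → q⊆p i }) , cong suc #q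

∣tabulate∣ : ∀ {n} (p : Fin n → Bool) → ∣ tabulate p ∣ ≡ count p
∣tabulate∣ {zero}  p = refl
∣tabulate∣ {suc n} p with p zero
... | true  = cong suc (∣tabulate∣ (p ∘ suc))
... | false = ∣tabulate∣ (p ∘ suc)

∈-tabulate : ∀ {n} {p : Fin n → Bool} {i} → T (p i) → i ∈ tabulate p
∈-tabulate {p = p} {i} t = lookup⇒[]= i (tabulate p) (trans (lookup∘tabulate p i) (T⇒≡ t))
  where
  T⇒≡ : ∀ {x} → T x → x ≡ true
  T⇒≡ {true} _ = refl

tabulate-∈ : ∀ {n} {p : Fin n → Bool} {i} → i ∈ tabulate p → T (p i)
tabulate-∈ {p = p} {i} i∈ = subst T (sym (trans (sym (lookup∘tabulate p i)) ([]=⇒lookup i∈))) tt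

-- Colours: 0 for the deleted vertices of the cover, 1 for those in finished
-- components, 2 for those in the component being added, 3 for the remaining
-- ones, and 4 for the vertices outside the cover.
recolour : ℕ → ℕ → ℕ
recolour a c = choose (bit (c ≡ᵇ 2)) a c

module Colouring {n} (G : Graph n) where

  open Graph G public

  Colours : Set
  Colours = Fin n → ℕ

  is : Colours → ℕ → Fin n → Bool
  is κ c v = κ v ≡ᵇ c

  nb : Colours → ℕ → Fin n → Bool
  nb κ c v = anyF λ u → adj v u ∧ (κ u ≡ᵇ c)

  -- The fresh vertices are those settled by the part being added. A vertex that sees a finished
  -- component as well was settled when the first such component was added; the present part was
  -- then still to come, so the vertex was split and deleted.
  fresh split exclusive conflict : Colours → Fin n → Bool
  fresh κ v     = is κ 4 v ∧ (not (nb κ 1 v) ∧ nb κ 2 v)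
  split κ v     = fresh κ v ∧ nb κ 3 v
  exclusive κ v = fresh κ v ∧ not (nb κ 3 v)
  conflict κ v  = is κ 2 v ∧ nb κ 3 v

  price : ℕ → Colours → ℕ
  price ℓ κ = count (split κ) + ((count (is κ 2) + count (exclusive κ)) ∸ ℓ)

  feasible : ℕ → Colours → Bool
  feasible ℓ κ = (count (conflict κ) ≡ᵇ 0) ∧ not (ℓ <ᵇ count (is κ 2))

  Nb : Colours → ℕ → Fin n → Set
  Nb κ c v = ∃[ u ] Edge v u × κ u ≡ c

  nb⇒Nb : ∀ {κ c v} → T (nb κ c v) → Nb κ c v
  nb⇒Nb {κ} {c} {v} t with any-witness _ t
  ... | u , h = u , ∧-fst h , ≡ᵇ-eq (κ u) (∧-snd {adj v u} h)

  Nb⇒nb : ∀ {κ c v} → Nb κ c v → T (nb κ c v)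
  Nb⇒nb {κ} {c} {v} (u , e , eq) = any-intro (λ u → adj v u ∧ (κ u ≡ᵇ c)) u (∧-intro e (≡ᵇ-true eq))

  flip : ∀ {u v} → Edge u v → Edge v u
  flip {u} {v} = subst T (symmetric u v)

  Avoid : (Fin n → Bool) → Fin n → Fin n → Set
  Avoid σ = EdgeAvoiding G (tabulate σ)

  reach : (Fin n → Bool) → Fin n → Fin n → Bool
  reach σ u v = does (star? (edgeAvoiding? G (tabulate σ)) u v)

  reach⇒star : ∀ {σ u v} → T (reach σ u v) → Star (Avoid σ) u v
  reach⇒star {σ} {u} {v} = T-does (star? (edgeAvoiding? G (tabulate σ)) u v)

  star⇒reach : ∀ {σ u v} → Star (Avoid σ) u v → T (reach σ u v)
  star⇒reach {σ} {u} {v} = does-T (star? (edgeAvoiding? G (tabulate σ)) u v)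

  avoid : ∀ {σ u v} → ¬ T (σ u) → ¬ T (σ v) → Edge u v → Avoid σ u v
  avoid {σ} u∉ v∉ e = (λ u∈ → u∉ (tabulate-∈ {p = σ} u∈)) , (λ v∈ → v∉ (tabulate-∈ {p = σ} v∈)) , e

  record Legal (κ : Colours) : Set where
    field
      classes : ∀ v → κ v ≤ 4
      cover   : ∀ {u v} → Edge u v → κ u ≡ 4 → κ v ≢ 4

  data Class (c : ℕ) : Set where
    c0 : c ≡ 0 → Class c
    c1 : c ≡ 1 → Class c
    c2 : c ≡ 2 → Class c
    c3 : c ≡ 3 → Class c
    c4 : c ≡ 4 → Class c

  class : ∀ {c} → c ≤ 4 → Class c
  class {0} _ = c0 refl
  class {1} _ = c1 refl
  class {2} _ = c2 refl
  class {3} _ = c3 refl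
  class {4} _ = c4 refl
  class {suc (suc (suc (suc (suc _))))} (s≤s (s≤s (s≤s (s≤s ()))))

  Done : Colours → Fin n → Set
  Done κ u = κ u ≡ 1 ⊎ (κ u ≡ 4 × Nb κ 1 u)

  -- What a positive table entry `b` certifies: a deletion set for the finished components alone. By
  -- `closed`, nothing undeleted links them to the rest; by `only`, the vertices outside the cover
  -- that do not touch them are still undecided. Sizes are recorded at cover vertices only, because
  -- every other finished vertex is adjacent to one of these.
  record Partial (K ℓ : ℕ) (κ : Colours) (b : ℕ) : Set where
    field
      σ       : Fin n → Bool
      deleted : ∀ {v} → κ v ≡ 0 → T (σ v)
      only    : ∀ {v} → T (σ v) → κ v ≡ 0 ⊎ (κ v ≡ 4 × Nb κ 1 v)
      budget  : count σ + ℓ + b ≤ K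
      closed  : ∀ {u v} → ¬ T (σ u) → ¬ T (σ v) → Edge u v → Done κ u → Done κ v
      sizes   : ∀ {u} → κ u ≡ 1 → count (reach σ u) ≤ ℓ

  -- Positivity makes the truncated subtractions exact, which `budget` requires; colour 0 is all
  -- that has been paid for.
  partial-base : ∀ {K ℓ κ} → (∀ v → κ v ≢ 1) → 0 < K ∸ ℓ ∸ count (is κ 0) →
                 Partial K ℓ κ (K ∸ ℓ ∸ count (is κ 0))
  partial-base {K} {ℓ} {κ} no1 pos = record
    { σ = is κ 0
    ; deleted = ≡ᵇ-true
    ; only = λ {v} t → inj₁ (≡ᵇ-eq (κ v) t)
    ; budget = ≤-reflexive (trans (cong (_+ (K ∸ ℓ ∸ x)) (+-comm x ℓ))
        (trans (cong (ℓ + x +_) (∸-+-assoc K ℓ x)) (m+[n∸m]≡n ℓ+x≤K)))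
    ; closed = λ { _ _ _ (inj₁ eq) → contradiction eq (no1 _) ; _ _ _ (inj₂ (_ , w , _ , eq)) → contradiction eq
        (no1 w) }
    ; sizes = λ eq → contradiction eq (no1 _)
    }
    where
    x = count (is κ 0)
    ℓ+x≤K : ℓ + x ≤ K
    ℓ+x≤K = ≮⇒≥ λ K< → <-irrefl (sym (trans (∸-+-assoc K ℓ x) (m≤n⇒m∸n≡0 (<⇒≤ K<)))) pos

  partial-cong : ∀ {K ℓ κ κ′ b} → (∀ v → κ v ≡ κ′ v) → Partial K ℓ κ b → Partial K ℓ κ′ b
  partial-cong {κ = κ} {κ′} eq g = record
    { σ = σ
    ; deleted = λ e → deleted (trans (eq _) e)
    ; only = λ t → Sum.map (trans (sym (eq _))) (Product.map (trans (sym (eq _))) nbs) (only t)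
    ; budget = budget
    ; closed = λ a b e d → Sum.map (trans (sym (eq _))) (Product.map (trans (sym (eq _))) nbs)
        (closed a b e (Sum.map (trans (eq _)) (Product.map (trans (eq _)) nbs′) d))
    ; sizes = λ e → sizes (trans (eq _) e)
    }
    where
    open Partial g
    nbs : ∀ {v} → Nb κ 1 v → Nb κ′ 1 v
    nbs (w , e , q) = w , e , trans (sym (eq w)) q
    nbs′ : ∀ {v} → Nb κ′ 1 v → Nb κ 1 v
    nbs′ (w , e , q) = w , e , trans (eq w) q

  recolour-fixed : ∀ a {c} → c ≢ 2 → recolour a c ≡ c
  recolour-fixed a {0} h = refl
  recolour-fixed a {1} h = refl
  recolour-fixed a {2} h = contradiction refl h
  recolour-fixed a {suc (suc (suc c))} h = refl

  recolour-3 : ∀ {c d} → d ≢ 3 → recolour 3 c ≡ d → c ≡ d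
  recolour-3 {0} h eq = eq
  recolour-3 {1} h eq = eq
  recolour-3 {2} h eq = contradiction (sym eq) h
  recolour-3 {suc (suc (suc c))} h eq = eq

  recolour-1 : ∀ {c d} → d ≢ 1 → recolour 1 c ≡ d → c ≡ d
  recolour-1 {0} h eq = eq
  recolour-1 {1} h eq = eq
  recolour-1 {2} h eq = contradiction (sym eq) h
  recolour-1 {suc (suc (suc c))} h eq = eq

  recolour-1-1 : ∀ {c} → recolour 1 c ≡ 1 → c ≡ 1 ⊎ c ≡ 2
  recolour-1-1 {1} eq = inj₁ refl
  recolour-1-1 {2} eq = inj₂ refl

  module _ {K ℓ κ b} (legal : Legal κ) (g : Partial K ℓ (recolour 3 ∘ κ) b)
           (ok : T (feasible ℓ κ)) (pos : 0 < b ∸ price ℓ κ) where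

    open Legal legal
    open Partial g

    private
      p e z : ℕ
      p = count (is κ 2)
      e = count (exclusive κ)
      z = (p + e) ∸ ℓ

      p≤ℓ : p ≤ ℓ
      p≤ℓ = ≮⇒≥ λ ℓ<p → not-elim (∧-snd {count (conflict κ) ≡ᵇ 0} ok) (<⇒<ᵇ ℓ<p)

      z≤e : z ≤ e
      z≤e = ≤-trans (∸-monoʳ-≤ (p + e) p≤ℓ) (≤-reflexive (m+n∸m≡n p e))

      dropped : ∃[ q ] (∀ i → T (q i) → T (exclusive κ i)) × count q ≡ z
      dropped = thin (exclusive κ) z≤e

      D : Fin n → Bool
      D = proj₁ dropped

      σ′ : Fin n → Bool
      σ′ v = σ v ∨ (split κ v ∨ D v)

      old : ∀ v → T (σ v) → T (σ′ v)
      old v t = Equivalence.from T-∨ (inj₁ t)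

      cut : ∀ v → T (split κ v) → T (σ′ v)
      cut v t = Equivalence.from (T-∨ {σ v}) (inj₂ (Equivalence.from T-∨ (inj₁ t)))

      drop : ∀ v → T (D v) → T (σ′ v)
      drop v t = Equivalence.from (T-∨ {σ v}) (inj₂ (Equivalence.from (T-∨ {split κ v}) (inj₂ t)))

      block : Fin n → Bool
      block v = is κ 2 v ∨ (exclusive κ v ∧ not (D v))

      Block : Fin n → Set
      Block v = κ v ≡ 2 ⊎ (T (fresh κ v) × ¬ T (σ′ v))

      Block⇒block : ∀ {v} → Block v → T (block v)
      Block⇒block (inj₁ eq) = Equivalence.from T-∨ (inj₁ (≡ᵇ-true eq))
      Block⇒block {v} (inj₂ (f , v∉)) = Equivalence.from (T-∨ {is κ 2 v})
        (inj₂ (∧-intro (∧-intro f (not-intro λ t → v∉ (cut v (∧-intro f t)))) (not-intro λ t → v∉ (drop v t))))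

      κ₋ κ₊ : Colours
      κ₋ = recolour 3 ∘ κ
      κ₊ = recolour 1 ∘ κ

      mk₊ : ∀ {v} → κ v ≡ 1 ⊎ κ v ≡ 2 → κ₊ v ≡ 1
      mk₊ (inj₁ eq) rewrite eq = refl
      mk₊ (inj₂ eq) rewrite eq = refl

      fix : ∀ {a v c} → c ≢ 2 → κ v ≡ c → recolour a (κ v) ≡ c
      fix {a} c≢2 eq = trans (recolour-fixed a (λ q → c≢2 (trans (sym eq) q))) eq

      nb₋₊ : ∀ {v} → Nb κ₋ 1 v → Nb κ₊ 1 v
      nb₋₊ (w , e , eq) = w , e , mk₊ (inj₁ (recolour-3 (λ ()) eq))

      done₋₊ : ∀ {v} → Done κ₋ v → Done κ₊ v
      done₋₊ (inj₁ eq)       = inj₁ (mk₊ (inj₁ (recolour-3 (λ ()) eq)))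
      done₋₊ (inj₂ (eq , h)) = inj₂ (fix (λ ()) (recolour-3 (λ ()) eq) , nb₋₊ h)

      fresh⇒4 : ∀ {v} → T (fresh κ v) → κ v ≡ 4
      fresh⇒4 {v} t = ≡ᵇ-eq (κ v) (∧-fst t)

      fresh⇒¬1 : ∀ {v} → T (fresh κ v) → ¬ Nb κ 1 v
      fresh⇒¬1 {v} t h = not-elim (∧-fst (∧-snd {is κ 4 v} t)) (Nb⇒nb {κ} h)

      fresh⇒2 : ∀ {v} → T (fresh κ v) → Nb κ 2 v
      fresh⇒2 {v} t = nb⇒Nb {κ} (∧-snd {not (nb κ 1 v)} (∧-snd {is κ 4 v} t))

      fresh-intro : ∀ {v} → κ v ≡ 4 → ¬ Nb κ 1 v → Nb κ 2 v → T (fresh κ v)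
      fresh-intro eq ¬1 h = ∧-intro (≡ᵇ-true eq) (∧-intro (not-intro λ t → ¬1 (nb⇒Nb {κ} t)) (Nb⇒nb {κ} h))

      fresh⇒done : ∀ {v} → T (fresh κ v) → Done κ₊ v
      fresh⇒done t with fresh⇒2 t
      ... | w , e , eq = inj₂ (fix (λ ()) (fresh⇒4 t) , w , e , mk₊ (inj₂ eq))

      block-done : ∀ {v} → Block v → Done κ₊ v
      block-done (inj₁ eq)      = inj₁ (mk₊ (inj₂ eq))
      block-done (inj₂ (f , _)) = fresh⇒done f

      ¬done₋ : ∀ {v} → κ v ≡ 2 → ¬ Done κ₋ v
      ¬done₋ eq (inj₁ q)       with () ← trans (sym eq) (recolour-3 (λ ()) q)
      ¬done₋ eq (inj₂ (q , _)) with () ← trans (sym eq) (recolour-3 (λ ()) q)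

      -- Every way out of the block is barred. Colour 0 is deleted. A finished neighbour of a vertex
      -- of the part would make that vertex finished too, by `closed`, and fresh vertices have no
      -- neighbour of colour 1. A neighbour of colour 3 is a conflict for a vertex of the part and
      -- makes a fresh vertex split, hence deleted. Two vertices outside the cover are never
      -- adjacent.
      block-closed : ∀ {u v} → ¬ T (σ′ u) → ¬ T (σ′ v) → Edge u v → Block u → Block v
      block-closed {u} {v} u∉ v∉ uv (inj₁ u2) with class (classes v)
      ... | c0 eq = contradiction (old _ (deleted (fix (λ ()) eq))) v∉
      ... | c1 eq = contradiction (closed (v∉ ∘ old _) (u∉ ∘ old _) (flip uv) (inj₁ (fix (λ ()) eq))) (¬done₋ u2)
      ... | c2 eq = inj₁ eq
      ... | c3 eq = contradiction
        (count-some {p = conflict κ} u (∧-intro (≡ᵇ-true u2) (Nb⇒nb {κ} (v , uv , eq))))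
        (≤⇒≯ (≤-reflexive (≡ᵇ-eq (count (conflict κ)) (∧-fst ok))))
      ... | c4 eq = inj₂ (fresh-intro eq
              (λ { (w , e , w1) → ¬done₋ u2 (closed (v∉ ∘ old _) (u∉ ∘ old _) (flip uv)
                     (inj₂ (fix (λ ()) eq , w , e , fix (λ ()) w1))) })
              (u , flip uv , u2) , v∉)
      block-closed {u} {v} u∉ v∉ uv (inj₂ (f , _)) with class (classes v)
      ... | c0 eq = contradiction (old _ (deleted (fix (λ ()) eq))) v∉
      ... | c1 eq = contradiction (v , uv , eq) (fresh⇒¬1 f)
      ... | c2 eq = inj₁ eq
      ... | c3 eq = contradiction (cut _ (∧-intro f (Nb⇒nb {κ} (v , uv , eq)))) u∉
      ... | c4 eq = contradiction eq (cover uv (fresh⇒4 f))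

      split-done : ∀ {u} → ¬ T (σ′ u) → Done κ₊ u → Done κ₋ u ⊎ Block u
      split-done u∉ (inj₁ eq) with recolour-1-1 eq
      ... | inj₁ q = inj₁ (inj₁ (fix (λ ()) q))
      ... | inj₂ q = inj₂ (inj₁ q)
      split-done {u} u∉ (inj₂ (eq , w , e , eq′)) with T? (nb κ 1 u)
      ... | yes t with nb⇒Nb {κ} t
      ...   | x , f , q = inj₁ (inj₂ (fix (λ ()) (recolour-1 (λ ()) eq) , x , f , fix (λ ()) q))
      split-done {u} u∉ (inj₂ (eq , w , e , eq′)) | no ¬t with recolour-1-1 eq′
      ... | inj₁ q = contradiction (Nb⇒nb {κ} (w , e , q)) ¬t
      ... | inj₂ q = inj₂ (inj₂ (fresh-intro (recolour-1 (λ ()) eq) (¬t ∘ Nb⇒nb {κ}) (w , e , q) , u∉))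

      avoid-old : ∀ {u v} → Avoid σ′ u v → Avoid σ u v
      avoid-old (u∉ , v∉ , e) = avoid {σ} (λ t → u∉ (∈-tabulate {p = σ′} (old _ t)))
          (λ t → v∉ (∈-tabulate {p = σ′} (old _ t))) e

      block-star : ∀ {u v} → Star (Avoid σ′) u v → Block u → Block v
      block-star ε h = h
      block-star ((u∉ , v∉ , e) ◅ es) h =
        block-star es (block-closed (u∉ ∘ ∈-tabulate) (v∉ ∘ ∈-tabulate) e h)

      -- The `z` dropped vertices are added on both sides, so that the truncated difference in the
      -- definition of `z` appears only in `p + e ≤ ℓ + z`.
      block-size : count block ≤ ℓ
      block-size = +-cancelʳ-≤ z _ _ (begin
        count block + z                                    ≤⟨ +-monoˡ-≤ z
            (count-cover {p = is κ 2} {rest} {block} λ i → Equivalence.to (T-∨ {is κ 2 i})) ⟩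
        p + count rest + z                                 ≡⟨ +-assoc p _ z ⟩
        p + (count rest + z)                               ≡⟨ cong (λ x → p + (count rest + x))
            (proj₂ (proj₂ dropped)) ⟨
        p + (count rest + count D)                         ≤⟨ +-monoʳ-≤ p
            (count-disjoint {p = rest} {D} {exclusive κ} (λ _ → ∧-fst) (proj₁ (proj₂ dropped))
                                                                (λ i t → not-elim (∧-snd {exclusive κ i} t))) ⟩
        p + e                                              ≤⟨ m≤n+m∸n (p + e) ℓ ⟩
        ℓ + z                                              ∎)
        where
        open ≤-Reasoning
        rest : Fin n → Bool
        rest v = exclusive κ v ∧ not (D v)

      price≤b : price ℓ κ ≤ b
      price≤b = ≮⇒≥ λ b< → <-irrefl (sym (m≤n⇒m∸n≡0 (<⇒≤ b<))) pos

    -- Soundness of a transition. The split vertices and `z` exclusive ones join the deleted set;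
    -- what is left of the part and its exclusive vertices is closed under the remaining edges, so
    -- each component that meets the part lies inside the block and has at most ℓ vertices. The part
    -- may be disconnected: its components are then smaller still.
    partial-step : Partial K ℓ (recolour 1 ∘ κ) (b ∸ price ℓ κ)
    partial-step = record
      { σ = σ′
      ; deleted = λ eq → old _ (deleted (fix (λ ()) (recolour-1 (λ ()) eq)))
      ; only = only′
      ; budget = begin
          count σ′ + ℓ + (b ∸ price ℓ κ)              ≤⟨ +-monoˡ-≤ _ (+-monoˡ-≤ ℓ σ′≤) ⟩
          count σ + price ℓ κ + ℓ + (b ∸ price ℓ κ)   ≡⟨ cong (_+ (b ∸ price ℓ κ)) (+-comm (count σ + price ℓ κ) ℓ) ⟩
          ℓ + (count σ + price ℓ κ) + (b ∸ price ℓ κ) ≡⟨ cong (_+ (b ∸ price ℓ κ)) (sym (+-assoc ℓ (count σ) _)) ⟩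
          ℓ + count σ + price ℓ κ + (b ∸ price ℓ κ)   ≡⟨ +-assoc (ℓ + count σ) _ _ ⟩
          ℓ + count σ + (price ℓ κ + (b ∸ price ℓ κ)) ≡⟨ cong₂ _+_ (+-comm ℓ (count σ)) (m+[n∸m]≡n price≤b) ⟩
          count σ + ℓ + b                             ≤⟨ budget ⟩
          K                                           ∎
      ; closed = closed′
      ; sizes = sizes′
      }
      where
      open ≤-Reasoning
      σ′≤ : count σ′ ≤ count σ + price ℓ κ
      σ′≤ = ≤-trans (count-cover (λ i → Equivalence.to (T-∨ {σ i})))
        (+-monoʳ-≤ (count σ) (≤-trans (count-cover (λ i → Equivalence.to (T-∨ {split κ i})))
          (+-monoʳ-≤ (count (split κ)) (≤-reflexive (proj₂ (proj₂ dropped))))))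
      only′ : ∀ {v} → T (σ′ v) → κ₊ v ≡ 0 ⊎ (κ₊ v ≡ 4 × Nb κ₊ 1 v)
      touched : ∀ {v} → T (fresh κ v) → κ₊ v ≡ 0 ⊎ (κ₊ v ≡ 4 × Nb κ₊ 1 v)
      touched f with fresh⇒2 f
      ... | w , e , eq = inj₂ (fix (λ ()) (fresh⇒4 f) , w , e , mk₊ (inj₂ eq))
      only′ {v} t with Equivalence.to (T-∨ {σ v}) t
      ... | inj₁ s with only s
      ...   | inj₁ eq       = inj₁ (fix (λ ()) (recolour-3 (λ ()) eq))
      ...   | inj₂ (eq , h) = inj₂ (fix (λ ()) (recolour-3 (λ ()) eq) , nb₋₊ h)
      only′ {v} t | inj₂ s with Equivalence.to (T-∨ {split κ v}) s
      ... | inj₁ q = touched (∧-fst q)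
      ... | inj₂ q = touched (∧-fst (proj₁ (proj₂ dropped) v q))
      closed′ : ∀ {u v} → ¬ T (σ′ u) → ¬ T (σ′ v) → Edge u v → Done κ₊ u → Done κ₊ v
      closed′ u∉ v∉ e d with split-done u∉ d
      ... | inj₁ d₋ = done₋₊ (closed (u∉ ∘ old _) (v∉ ∘ old _) e d₋)
      ... | inj₂ h  = block-done (block-closed u∉ v∉ e h)
      sizes′ : ∀ {u} → κ₊ u ≡ 1 → count (reach σ′ u) ≤ ℓ
      sizes′ {u} eq with recolour-1-1 eq
      ... | inj₁ q = ≤-trans (count-mono {p = reach σ′ u} {reach σ u} λ v t → star⇒reach {σ} {u} {v}
          (Star.map avoid-old (reach⇒star {σ′} {u} {v} t)))
                       (sizes (fix (λ ()) q))
      ... | inj₂ q = ≤-trans (count-mono {p = reach σ′ u} {block} λ v t → Block⇒block {v}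
          (block-star (reach⇒star {σ′} {u} {v} t) (inj₁ q))) block-size

∈-subsets : ∀ {n} (S : Subset n) → S List.∈ subsets n
∈-subsets []            = here refl
∈-subsets (outside ∷ S) = ∈-++⁺ˡ (∈-map⁺ (outside ∷_) (∈-subsets S))
∈-subsets {suc n} (inside ∷ S) =
  ∈-++⁺ʳ (map (outside ∷_) (subsets n)) (∈-map⁺ (inside ∷_) (∈-subsets S))

-- Vertex integrity, and the payments of an optimal solution

module Parameters {n} (G : Graph n) where

  open Colouring G

  vc-attained : ∃[ C ] IsVertexCover G C × ∣ C ∣ ≡ vc G
  vc-attained with argmin-sel id n (map ∣_∣ (filter (isVertexCover? G) (subsets n)))
  ... | inj₁ eq = ⊤ , (λ _ _ _ → inj₁ ∈⊤) , trans (∣⊤∣≡n n) (sym eq)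
  ... | inj₂ m∈ with ∈-map⁻ ∣_∣ m∈
  ...   | C , C∈ , eq = C , proj₂ (∈-filter⁻ (isVertexCover? G) {xs = subsets n} C∈) , sym eq

  integrity : Subset n → ℕ
  integrity S = ∣ S ∣ + max 0 (map ∣_∣ (components G S))

  vi≤n : vi G ≤ n
  vi≤n = min≤⊤ n (map integrity (subsets n))

  vi≤ : ∀ σ ℓ → (∀ u → ¬ T (σ u) → count (reach σ u) ≤ ℓ) → vi G ≤ count σ + ℓ
  vi≤ σ ℓ h = ≤-trans
    (All.lookup (min≤xs n (map integrity (subsets n))) (∈-map⁺ integrity (∈-subsets (tabulate σ))))
    (+-mono-≤ (≤-reflexive (∣tabulate∣ σ))
      (max≤v⁺ {xs = map ∣_∣ (components G (tabulate σ))} z≤n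
        (All.map⁺ (All.map⁺ (All.tabulate λ {u} u∈ → ≤-trans (≤-reflexive (∣tabulate∣ (reach σ u)))
          (h u (λ t → proj₂ (∈-filter⁻ (λ u → ¬? (u ∈? tabulate σ)) {xs = allFin n} u∈) (∈-tabulate t))))))))

  -- The first alternative is the default value of `min`. It causes no harm later, since the answer
  -- is initialized to yes when `n` is within the budget.
  vi-attained : vi G ≡ n ⊎ ∃[ σ ] ∃[ ℓ ] vi G ≡ count σ + ℓ × (∀ u → ¬ T (σ u) → count (reach σ u) ≤ ℓ)
  vi-attained with argmin-sel id n (map integrity (subsets n))
  ... | inj₁ eq = inj₁ eq
  ... | inj₂ v∈ with ∈-map⁻ integrity v∈
  ...   | S , _ , eq = inj₂ (lookup S , max 0 (map ∣_∣ (components G S)) ,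
          trans eq (cong (_+ max 0 (map ∣_∣ (components G S)))
              (trans (cong ∣_∣ (sym (tabulate∘lookup S))) (∣tabulate∣ (lookup S)))) ,
          λ u u∉ → bounded u (λ u∈ → u∉ (subst T (sym ([]=⇒lookup u∈)) tt)))
    where
    bounded : ∀ u → u ∉ S → count (reach (lookup S) u) ≤ max 0 (map ∣_∣ (components G S))
    bounded u u∉ = ≤-trans
      (≤-reflexive (trans (sym (∣tabulate∣ (reach (lookup S) u)))
        (cong (λ X → ∣ component G X u ∣) (tabulate∘lookup S))))
      (All.lookup (xs≤max 0 (map ∣_∣ (components G S)))
        (∈-map⁺ ∣_∣ (∈-map⁺ (component G S) (∈-filter⁺ (λ u → ¬? (u ∈? S)) (∈-allFin u) u∉))))

  -- Once the cover consists of deleted and finished vertices, an undeleted vertex outside it either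
  -- belongs to a finished component or has lost all its neighbours. The latter is a component of
  -- size 1, which is where `1 ≤ ℓ` enters; `0 < b` makes the inequality strict.
  partial-final : ∀ {K ℓ κ b} → Legal κ → (∀ v → κ v ≢ 2) → (∀ v → κ v ≢ 3) → 1 ≤ ℓ → 0 < b →
                  Partial K ℓ κ b → vi G < K
  partial-final {K} {ℓ} {κ} {b} legal no2 no3 1≤ℓ 0<b g =
    ≤-trans (s≤s (vi≤ σ ℓ small)) (≤-trans (m<m+n (count σ + ℓ) 0<b) budget)
    where
    open Partial g
    open Legal legal
    done-size : ∀ {u} → ¬ T (σ u) → Done κ u → count (reach σ u) ≤ ℓ
    done-size u∉ (inj₁ eq) = sizes eq
    done-size {u} u∉ (inj₂ (eq , w , e , w1)) = ≤-trans
      (count-mono {p = reach σ u} {reach σ w} λ v t → star⇒reach {σ} {w} {v}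
          (avoid {σ} w∉ u∉ (flip e) ◅ reach⇒star {σ} {u} {v} t))
      (sizes w1)
      where
      w∉ : ¬ T (σ w)
      w∉ t with only t
      ... | inj₁ q       with () ← trans (sym w1) q
      ... | inj₂ (q , _) with () ← trans (sym w1) q
    isolated : ∀ {u} → ¬ T (σ u) → κ u ≡ 4 → ¬ Nb κ 1 u → ∀ v → Star (Avoid σ) u v → u ≡ v
    isolated u∉ u4 ¬nb v ε = refl
    isolated {u} u∉ u4 ¬nb v (_◅_ {j = w} (_ , w∉ , e) _) with class (classes w)
    ... | c0 eq = contradiction (∈-tabulate (deleted eq)) w∉
    ... | c1 eq = contradiction (w , e , eq) ¬nb
    ... | c2 eq = contradiction eq (no2 w)
    ... | c3 eq = contradiction eq (no3 w)
    ... | c4 eq = contradiction eq (cover e u4)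
    single : ∀ {m} (p : Fin m → Bool) u → (∀ v → T (p v) → u ≡ v) → count p ≤ 1
    single p zero h = +-mono-≤ (bit-≤ (p zero))
      (≤-reflexive (count-none {p = p ∘ suc} λ i t → contradiction (h (suc i) t) λ ()))
    single p (suc u) h with p zero in eq
    ... | true with () ← h zero (subst T (sym eq) tt)
    ... | false = single (p ∘ suc) u (λ v t → suc-injective (h (suc v) t))
    small : ∀ u → ¬ T (σ u) → count (reach σ u) ≤ ℓ
    small u u∉ with class (classes u)
    ... | c0 eq = contradiction (deleted eq) u∉
    ... | c1 eq = sizes eq
    ... | c2 eq = contradiction eq (no2 u)
    ... | c3 eq = contradiction eq (no3 u)
    ... | c4 eq with T? (nb κ 1 u)
    ...   | yes t = done-size u∉ (inj₂ (eq , nb⇒Nb {κ} t))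
    ...   | no ¬t = ≤-trans (single (reach σ u) u λ v t → isolated u∉ eq (¬t ∘ Nb⇒nb {κ}) v
        (reach⇒star {σ} {u} {v} t)) 1≤ℓ

  -- The deletions of a solution σ outside the cover that a colouring has accounted for.
  paid : (Fin n → Bool) → Colours → Fin n → Bool
  paid σ κ v = (is κ 4 v ∧ σ v) ∧ nb κ 1 v

  -- Completeness of a transition. The hypotheses describe colour 2 as the trace on the cover of the
  -- component of `v₀` after deleting a given solution `σ`; only the inclusions that the argument
  -- uses are stated.
  module _ {σ ℓ κ} (legal : Legal κ)
           (in-σ : ∀ {v} → κ v ≡ 0 → T (σ v))
           (out-σ : ∀ {v} → T (σ v) → κ v ≡ 0 ⊎ κ v ≡ 4)
           (whole : ∀ {u v} → κ u ≡ 2 → Star (Avoid σ) u v → κ v ≢ 1 × κ v ≢ 3)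
           (v₀ : Fin n) (v₀-size : count (reach σ v₀) ≤ ℓ)
           (connected : ∀ {u} → κ u ≡ 2 → Star (Avoid σ) v₀ u) where

    open Legal legal

    private
      2∉σ : ∀ {v} c → κ v ≡ c → c ≢ 0 → c ≢ 4 → ¬ T (σ v)
      2∉σ c eq c≢0 c≢4 t with out-σ t
      ... | inj₁ q = c≢0 (trans (sym eq) q)
      ... | inj₂ q = c≢4 (trans (sym eq) q)

      excl-in excl-out : Fin n → Bool
      excl-in v  = exclusive κ v ∧ σ v
      excl-out v = exclusive κ v ∧ not (σ v)

      κ₋ κ₊ : Colours
      κ₋ = recolour 3 ∘ κ
      κ₊ = recolour 1 ∘ κ

      fresh-nb : ∀ {v} → T (fresh κ v) → Nb κ 2 v
      fresh-nb {v} t = nb⇒Nb {κ} (∧-snd {not (nb κ 1 v)} (∧-snd {is κ 4 v} t))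

      -- A kept exclusive vertex is adjacent to the part, so both sets lie in the component of `v₀`,
      -- and their colours tell them apart.
      excl-size : count (is κ 2) + count excl-out ≤ ℓ
      excl-size = ≤-trans (count-disjoint {p = is κ 2} {excl-out} {reach σ v₀}
        (λ i t → star⇒reach {σ} {v₀} {i} (connected (≡ᵇ-eq (κ i) t)))
        (λ i t → star⇒reach {σ} {v₀} {i} (out i t))
        (λ i t t′ → clash (trans (sym (≡ᵇ-eq (κ i) t)) (≡ᵇ-eq (κ i) (∧-fst (∧-fst (∧-fst t′)))))))
        v₀-size
        where
        clash : 2 ≡ 4 → ⊥
        clash ()
        out : ∀ i → T (excl-out i) → Star (Avoid σ) v₀ i
        out i t with fresh-nb {i} (∧-fst (∧-fst t))
        ... | w , e , w2 = connected w2 ◅◅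
          (avoid {σ} (2∉σ 2 w2 (λ ()) (λ ())) (not-elim (∧-snd {exclusive κ i} t)) (flip e) ◅ ε)

      -- If kept, the vertex would lead from colour 2 to colour 3 inside one component.
      split⊆σ : ∀ i → T (split κ i) → T (σ i)
      split⊆σ i t with T? (σ i)
      ... | yes s = s
      ... | no ¬s with fresh-nb {i} (∧-fst t) | nb⇒Nb {κ} (∧-snd {fresh κ i} t)
      ...   | w , e , w2 | x , f , x3 = contradiction x3 (proj₂ (whole w2
        (avoid {σ} (2∉σ 2 w2 (λ ()) (λ ())) ¬s (flip e) ◅ avoid {σ} ¬s (2∉σ 3 x3 (λ ()) (λ ())) f ◅ ε)))

    feasible-component : T (feasible ℓ κ)
    feasible-component = ∧-intro
      (≡ᵇ-true (count-none {p = conflict κ} λ i t → no-conflict i t))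
      (not-intro λ t → ≤⇒≯ (≤-trans (m≤m+n _ (count excl-out)) excl-size) (<ᵇ⇒< _ _ t))
      where
      no-conflict : ∀ i → ¬ T (conflict κ i)
      no-conflict i t with ≡ᵇ-eq (κ i) (∧-fst t) | nb⇒Nb {κ} (∧-snd {is κ 2 i} t)
      ... | i2 | x , f , x3 = proj₂ (whole i2
        (avoid {σ} (2∉σ 2 i2 (λ ()) (λ ())) (2∉σ 3 x3 (λ ()) (λ ())) f ◅ ε)) x3

    -- The price is a lower bound for what the solution itself pays for this component: it deletes
    -- all split vertices, and by `excl-size` at least the excess over ℓ among the exclusive ones.
    -- No vertex is paid for twice, since fresh vertices have no neighbour of colour 1 before the
    -- step.
    paid-grows : count (paid σ κ₋) + price ℓ κ ≤ count (paid σ κ₊)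
    paid-grows = begin
      count (paid σ κ₋) + price ℓ κ                                     ≤⟨ +-monoʳ-≤ (count (paid σ κ₋))
          (+-monoʳ-≤ (count (split κ)) excl≤) ⟩
      count (paid σ κ₋) + (count (split κ) + count excl-in)              ≤⟨ +-monoʳ-≤ (count (paid σ κ₋))
          (count-disjoint {p = split κ} {excl-in} {new}

                                                                                                                  (λ i t → ∧-intro (∧-fst t) (split⊆σ i t))

                                                                                                                  (λ i t → ∧-intro (∧-fst (∧-fst t)) (∧-snd {exclusive κ i} t))

                                                                                                                  (λ i t t′ → not-elim (∧-snd {fresh κ i} (∧-fst t′)) (∧-snd {fresh κ i} t))) ⟩
      count (paid σ κ₋) + count new                                      ≤⟨ count-disjoint {p = paid σ κ₋} {new}
          {paid σ κ₊} old new⊆ apart ⟩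
      count (paid σ κ₊)                                                  ∎
      where
      open ≤-Reasoning
      new : Fin n → Bool
      new v = fresh κ v ∧ σ v
      excl≤ : (count (is κ 2) + count (exclusive κ)) ∸ ℓ ≤ count excl-in
      excl≤ = m≤n+o⇒m∸n≤o (count (is κ 2) + count (exclusive κ)) ℓ (begin
        count (is κ 2) + count (exclusive κ)                ≤⟨ +-monoʳ-≤ (count (is κ 2))
            (count-cover {p = excl-out} {excl-in} {exclusive κ} cover-excl) ⟩
        count (is κ 2) + (count excl-out + count excl-in)   ≡⟨ +-assoc (count (is κ 2)) _ _ ⟨
        count (is κ 2) + count excl-out + count excl-in     ≤⟨ +-monoˡ-≤ (count excl-in) excl-size ⟩
        ℓ + count excl-in                                   ∎)
        where
        cover-excl : ∀ i → T (exclusive κ i) → T (excl-out i) ⊎ T (excl-in i)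
        cover-excl i t with T? (σ i)
        ... | yes s = inj₂ (∧-intro t s)
        ... | no ¬s = inj₁ (∧-intro t (not-intro ¬s))
      κ₋-1 : ∀ {w} → κ₋ w ≡ 1 → κ w ≡ 1
      κ₋-1 = recolour-3 λ ()
      to₊ : ∀ c {w} → c ≢ 2 → κ w ≡ c → κ₊ w ≡ c
      to₊ c c≢2 eq = trans (recolour-fixed 1 (λ q → c≢2 (trans (sym eq) q))) eq
      2to₊ : ∀ {w} → κ w ≡ 2 → κ₊ w ≡ 1
      2to₊ eq rewrite eq = refl
      old : ∀ i → T (paid σ κ₋ i) → T (paid σ κ₊ i)
      old i t with nb⇒Nb {κ₋} (∧-snd {is κ₋ 4 i ∧ σ i} t)
      ... | w , e , w1 = ∧-intro
        (∧-intro (≡ᵇ-true (to₊ 4 (λ ()) (recolour-3 (λ ()) (≡ᵇ-eq (κ₋ i) (∧-fst (∧-fst t))))))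
            (∧-snd {is κ₋ 4 i} (∧-fst t)))
        (Nb⇒nb {κ₊} (w , e , to₊ 1 (λ ()) (κ₋-1 w1)))
      new⊆ : ∀ i → T (new i) → T (paid σ κ₊ i)
      new⊆ i t with fresh-nb {i} (∧-fst t)
      ... | w , e , w2 = ∧-intro
        (∧-intro (≡ᵇ-true (to₊ 4 (λ ()) (≡ᵇ-eq (κ i) (∧-fst (∧-fst t))))) (∧-snd {fresh κ i} t))
        (Nb⇒nb {κ₊} (w , e , 2to₊ w2))
      apart : ∀ i → T (paid σ κ₋ i) → T (new i) → ⊥
      apart i t t′ with nb⇒Nb {κ₋} (∧-snd {is κ₋ 4 i ∧ σ i} t)
      ... | w , e , w1 = not-elim (∧-fst (∧-snd {is κ 4 i} (∧-fst t′))) (Nb⇒nb {κ} (w , e , κ₋-1 w1))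

-- Codes of colourings

-- The place value of `v`, which is 4 to its position in the list, and 0 outside the list. A single
-- number per vertex thus tells both whether it is in the cover and where its digit is.
weight : List ℕ → ℕ → ℕ
weight []      v = 0
weight (x ∷ L) v = choose (bit (v ≡ᵇ x)) 1 (4 * weight L v)

-- A colouring of the cover L is written in base 4, below the number ℓ.
code : List ℕ → ℕ → (ℕ → ℕ) → ℕ
code []      ℓ d = ℓ
code (x ∷ L) ℓ d = d x + 4 * code L ℓ d

digit : List ℕ → ℕ → ℕ → ℕ
digit L q v = ⟦ mod ⟧ (⟦ div ⟧ q (weight L v)) 4

colour : List ℕ → ℕ → ℕ → ℕ
colour L q v = choose (weight L v) (digit L q v) 4

level : List ℕ → ℕ → ℕ
level L q = ⟦ div ⟧ q (4 ^ length L)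

≡ᵇ-refl : ∀ x → (x ≡ᵇ x) ≡ true
≡ᵇ-refl zero    = refl
≡ᵇ-refl (suc x) = ≡ᵇ-refl x

≢⇒≡ᵇ-false : ∀ {x y} → x ≢ y → (x ≡ᵇ y) ≡ false
≢⇒≡ᵇ-false {x} {y} x≢y with x ≡ᵇ y in eq
... | true  = contradiction (≡ᵇ-eq x (subst T (sym eq) tt)) x≢y
... | false = refl

weight-head : ∀ x L → weight (x ∷ L) x ≡ 1
weight-head x L rewrite ≡ᵇ-refl x = refl

weight-tail : ∀ {x v} L → v ≢ x → weight (x ∷ L) v ≡ 4 * weight L v
weight-tail {x} {v} L v≢x rewrite ≢⇒≡ᵇ-false v≢x = refl

weight-∉ : ∀ {v L} → All (v ≢_) L → weight L v ≡ 0
weight-∉ {L = []}    []        = refl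
weight-∉ {L = x ∷ L} (v≢x ∷ a) = trans (weight-tail L v≢x) (cong (4 *_) (weight-∉ a))

weight-0 : ∀ L {v} → weight L v ≡ 0 → All (v ≢_) L
weight-0 []      z = []
weight-0 (x ∷ L) {v} z with v ≟ x
... | yes refl = contradiction (trans (sym (weight-head x L)) z) 1+n≢0
... | no v≢x   = v≢x ∷ weight-0 L (*-cancelˡ-≡ (weight L v) 0 4 (trans (sym (weight-tail L v≢x)) z))

weight-≤ : ∀ L v → weight L v ≤ 4 ^ length L
weight-≤ []      v = z≤n
weight-≤ (x ∷ L) v with v ≡ᵇ x
... | true  = m^n>0 4 (suc (length L))
... | false = *-monoʳ-≤ 4 (weight-≤ L v)

[r+4c]%4 : ∀ {r} c → r < 4 → (r + 4 * c) % 4 ≡ r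
[r+4c]%4 {r} c r<4 = trans (cong (λ x → (r + x) % 4) (*-comm 4 c)) (trans ([m+kn]%n≡m%n r c 4) (m<n⇒m%n≡m r<4))

[r+4c]/4 : ∀ {r} c → r < 4 → (r + 4 * c) / 4 ≡ c
[r+4c]/4 {r} c r<4 = trans (+-distrib-/-∣ʳ r {4 * c} (divides c (*-comm 4 c)))
  (cong₂ _+_ (m<n⇒m/n≡0 r<4) (trans (cong (_/ 4) (*-comm 4 c)) (m*n/n≡m c 4)))

div-4* : ∀ q w → ⟦ div ⟧ q (4 * w) ≡ ⟦ div ⟧ (q / 4) w
div-4* q zero    = refl
div-4* q (suc w) = sym (m/n/o≡m/[n*o] q 4 (suc w))

div-1 : ∀ q → ⟦ div ⟧ q 1 ≡ q
div-1 = n/1≡n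

digit-head : ∀ q x L → digit (x ∷ L) q x ≡ q % 4
digit-head q x L rewrite weight-head x L = cong (_% 4) (div-1 q)

digit-tail : ∀ q {x v} L → v ≢ x → digit (x ∷ L) q v ≡ digit L (q / 4) v
digit-tail q {x} {v} L v≢x rewrite weight-tail L v≢x = cong (_% 4) (div-4* q (weight L v))

digit-< : ∀ L q v → digit L q v < 4
digit-< L q v = m%n<n (⟦ div ⟧ q (weight L v)) 4

head-< : ∀ {x} {d : ℕ → ℕ} L → (∀ u → weight (x ∷ L) u ≢ 0 → d u < 4) → d x < 4
head-< {x} L d< = d< x λ eq → 1+n≢0 (trans (sym (weight-head x L)) eq)

tail-< : ∀ {x} {d : ℕ → ℕ} {L} → All (x ≢_) L → (∀ u → weight (x ∷ L) u ≢ 0 → d u < 4) →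
         ∀ u → weight L u ≢ 0 → d u < 4
tail-< {x} {L = L} x∉ d< u h = d< u λ eq → h (*-cancelˡ-≡ (weight L u) 0 4 (trans (sym (weight-tail L u≢x)) eq))
  where
  u≢x : u ≢ x
  u≢x refl = h (weight-∉ x∉)

digit-code : ∀ L ℓ {d v} → (∀ u → weight L u ≢ 0 → d u < 4) → weight L v ≢ 0 → Unique L →
             digit L (code L ℓ d) v ≡ d v
digit-code [] ℓ d< w≢0 uniq = contradiction refl w≢0
digit-code (x ∷ L) ℓ {d} {v} d< w≢0 (x∉ ∷ uniq) with v ≟ x
... | yes refl = trans (digit-head _ x L) ([r+4c]%4 (code L ℓ d) (d< x w≢0))
... | no v≢x   = trans (digit-tail _ L v≢x) (trans (cong (λ q → digit L q v)
    ([r+4c]/4 (code L ℓ d) (head-< {x} {d} L d<)))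
  (digit-code L ℓ (tail-< {d = d} x∉ d<) (λ eq → w≢0 (trans (weight-tail L v≢x) (cong (4 *_) eq))) uniq))

level-code : ∀ L ℓ {d} → (∀ u → weight L u ≢ 0 → d u < 4) → Unique L → level L (code L ℓ d) ≡ ℓ
level-code [] ℓ d< uniq = div-1 ℓ
level-code (x ∷ L) ℓ {d} d< (x∉ ∷ uniq) = trans (div-4* _ (4 ^ length L))
  (trans (cong (λ q → level L q) ([r+4c]/4 (code L ℓ d) (head-< {x} {d} L d<)))
      (level-code L ℓ (tail-< {d = d} x∉ d<) uniq))

code-cong : ∀ L ℓ {d d′} → (∀ v → ¬ All (v ≢_) L → d v ≡ d′ v) → code L ℓ d ≡ code L ℓ d′
code-cong []      ℓ h = refl
code-cong (x ∷ L) ℓ h = cong₂ _+_ (h x λ { (x≢x ∷ _) → x≢x refl })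
  (cong (4 *_) (code-cong L ℓ λ v v∈ → h v λ { (_ ∷ a) → v∈ a }))

decode : ∀ L q → Unique L → code L (level L q) (digit L q) ≡ q
decode []      q uniq        = div-1 q
decode (x ∷ L) q (x∉ ∷ uniq) = begin
  digit (x ∷ L) q x + 4 * code L (level (x ∷ L) q) (digit (x ∷ L) q)
    ≡⟨ cong₂ (λ r c → r + 4 * c) (digit-head q x L)
         (trans (cong (λ ℓ → code L ℓ (digit (x ∷ L) q)) (div-4* q (4 ^ length L)))
           (code-cong L (level L (q / 4)) λ v v∈ → digit-tail q L λ { refl → v∈ x∉ })) ⟩
  q % 4 + 4 * code L (level L (q / 4)) (digit L (q / 4))
    ≡⟨ cong (λ c → q % 4 + 4 * c) (decode L (q / 4) uniq) ⟩
  q % 4 + 4 * (q / 4)   ≡⟨ cong (q % 4 +_) (*-comm 4 (q / 4)) ⟩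
  q % 4 + (q / 4) * 4   ≡⟨ m≡m%n+[m/n]*n q 4 ⟨
  q                     ∎
  where open ≡-Reasoning

code-+ : ∀ L ℓ d d′ → code L ℓ d + code L 0 d′ ≡ code L ℓ (λ v → d v + d′ v)
code-+ []      ℓ d d′ = +-identityʳ ℓ
code-+ (x ∷ L) ℓ d d′ = trans (interchange +-commutativeSemigroup (d x) _ (d′ x) _)
  (cong (d x + d′ x +_) (trans (sym (*-distribˡ-+ 4 (code L ℓ d) (code L 0 d′))) (cong (4 *_) (code-+ L ℓ d d′))))

code-< : ∀ L ℓ {d} → (∀ v → weight L v ≢ 0 → d v < 4) → Unique L → code L ℓ d < suc ℓ * 4 ^ length L
code-< []      ℓ d< uniq = s≤s (≤-reflexive (sym (*-identityʳ ℓ)))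
code-< (x ∷ L) ℓ {d} d< (x∉ ∷ uniq) = begin
  suc (d x) + 4 * code L ℓ d      ≤⟨ +-monoˡ-≤ (4 * code L ℓ d) (head-< {x} {d} L d<) ⟩
  4 + 4 * code L ℓ d              ≡⟨ *-suc 4 (code L ℓ d) ⟨
  4 * suc (code L ℓ d)            ≤⟨ *-monoʳ-≤ 4 (code-< L ℓ (tail-< {d = d} x∉ d<) uniq) ⟩
  4 * (suc ℓ * 4 ^ length L)      ≡⟨ *-assoc 4 (suc ℓ) (4 ^ length L) ⟨
  4 * suc ℓ * 4 ^ length L        ≡⟨ cong (_* 4 ^ length L) (*-comm 4 (suc ℓ)) ⟩
  suc ℓ * 4 * 4 ^ length L        ≡⟨ *-assoc (suc ℓ) 4 (4 ^ length L) ⟩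
  suc ℓ * 4 ^ length (x ∷ L)      ∎
  where open ≤-Reasoning

sumN-cong : ∀ N {f g} → (∀ i → i < N → f i ≡ g i) → sumN N f ≡ sumN N g
sumN-cong zero    h = refl
sumN-cong (suc N) h = cong₂ _+_ (h N ≤-refl) (sumN-cong N λ i i<N → h i (m≤n⇒m≤1+n i<N))

sumN-+ : ∀ N f g → sumN N (λ i → f i + g i) ≡ sumN N f + sumN N g
sumN-+ zero    f g = refl
sumN-+ (suc N) f g = trans (cong (f N + g N +_) (sumN-+ N f g)) (interchange +-commutativeSemigroup (f N) (g N) _ _)

sumN-* : ∀ N c f → sumN N (λ i → c * f i) ≡ c * sumN N f
sumN-* zero    c f = sym (*-zeroʳ c)
sumN-* (suc N) c f = trans (cong (c * f N +_) (sumN-* N c f)) (sym (*-distribˡ-+ c (f N) _))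

sumN-zero : ∀ N {f} → (∀ i → i < N → f i ≡ 0) → sumN N f ≡ 0
sumN-zero zero    h = refl
sumN-zero (suc N) h = cong₂ _+_ (h N ≤-refl) (sumN-zero N λ i i<N → h i (m≤n⇒m≤1+n i<N))

sumN-single : ∀ N x (h : ℕ → ℕ) → x < N → sumN N (λ v → h v * bit (v ≡ᵇ x)) ≡ h x
sumN-single (suc N) x h x<N with N ≟ x
... | yes refl rewrite ≡ᵇ-refl N = trans (cong₂ _+_ (*-identityʳ (h N))
        (sumN-zero N λ i i<N → trans (cong (λ b → h i * bit b) (≢⇒≡ᵇ-false (<⇒≢ i<N))) (*-zeroʳ (h i))))
        (+-identityʳ (h N))
... | no N≢x rewrite ≢⇒≡ᵇ-false N≢x = trans (cong (_+ sumN N (λ v → h v * bit (v ≡ᵇ x))) (*-zeroʳ (h N)))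
        (sumN-single N x h (≤∧≢⇒< (s≤s⁻¹ x<N) (N≢x ∘ sym)))

-- The program has no access to the list, only to the place values, and sums over all vertices
-- instead; this identifies such sums with codes.
sum-weights : ∀ {n} L h → Unique L → All (_< n) L → sumN n (λ v → h v * weight L v) ≡ code L 0 h
sum-weights {n} []      h uniq a = sumN-zero n λ i _ → *-zeroʳ (h i)
sum-weights {n} (x ∷ L) h (x∉ ∷ uniq) (x< ∷ a) = begin
  sumN n (λ v → h v * weight (x ∷ L) v)
    ≡⟨ sumN-cong n (λ v _ → term v) ⟩
  sumN n (λ v → h v * bit (v ≡ᵇ x) + 4 * (h v * weight L v))
    ≡⟨ sumN-+ n _ _ ⟩
  sumN n (λ v → h v * bit (v ≡ᵇ x)) + sumN n (λ v → 4 * (h v * weight L v))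
    ≡⟨ cong₂ _+_ (sumN-single n x h x<) (trans (sumN-* n 4 _) (cong (4 *_) (sum-weights L h uniq a))) ⟩
  h x + 4 * code L 0 h ∎
  where
  open ≡-Reasoning
  term : ∀ v → h v * weight (x ∷ L) v ≡ h v * bit (v ≡ᵇ x) + 4 * (h v * weight L v)
  term v with v ≟ x
  ... | yes refl rewrite ≡ᵇ-refl x | weight-∉ x∉ | *-zeroʳ (h x) = sym (+-identityʳ (h x * 1))
  ... | no v≢x rewrite ≢⇒≡ᵇ-false v≢x | *-zeroʳ (h v) =
    trans (sym (*-assoc (h v) 4 _)) (trans (cong (_* weight L v) (*-comm (h v) 4)) (*-assoc 4 (h v) _))

-- The value in q of the digits 2: adding it turns them into 3, subtracting it into 1.
current : List ℕ → ℕ → ℕ → ℕ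
current L n q = sumN n λ v → choose (bit (colour L q v ≡ᵇ 2)) (weight L v) 0

recolour-+ : ∀ c → c + bit (c ≡ᵇ 2) ≡ recolour 3 c
recolour-+ 0 = refl
recolour-+ 1 = refl
recolour-+ 2 = refl
recolour-+ (suc (suc (suc c))) = +-identityʳ _

recolour-∸ : ∀ c → recolour 1 c + bit (c ≡ᵇ 2) ≡ c
recolour-∸ 0 = refl
recolour-∸ 1 = refl
recolour-∸ 2 = refl
recolour-∸ (suc (suc (suc c))) = +-identityʳ _

recolour-< : ∀ {a c} → a < 4 → c < 4 → recolour a c < 4
recolour-< {c = c} a< c< with c ≡ᵇ 2
... | true  = a<
... | false = c<

module Shift {n} (L : List ℕ) (uniq : Unique L) (small : All (_< n) L) (q : ℕ) where

  private
    ℓ = level L q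
    h : ℕ → ℕ
    h v = bit (digit L q v ≡ᵇ 2)

  current-code : current L n q ≡ code L 0 h
  current-code = trans (sumN-cong n λ v _ → term v) (sum-weights L h uniq small)
    where
    term : ∀ v → choose (bit (colour L q v ≡ᵇ 2)) (weight L v) 0 ≡ h v * weight L v
    term v with weight L v
    ... | zero = sym (*-zeroʳ (bit (⟦ mod ⟧ (⟦ div ⟧ q 0) 4 ≡ᵇ 2)))
    ... | suc w with ⟦ mod ⟧ (⟦ div ⟧ q (suc w)) 4 ≡ᵇ 2
    ...   | true  = sym (+-identityʳ (suc w))
    ...   | false = refl

  -- There are no carries, as only digits 2 are raised, and by 1. The level on top is therefore kept
  -- as well.
  source : q + current L n q ≡ code L ℓ (recolour 3 ∘ digit L q)
  source = begin
    q + current L n q                              ≡⟨ cong₂ _+_ (sym (decode L q uniq)) current-code ⟩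
    code L ℓ (digit L q) + code L 0 h              ≡⟨ code-+ L ℓ (digit L q) h ⟩
    code L ℓ (λ v → digit L q v + h v)             ≡⟨ code-cong L ℓ (λ v _ → recolour-+ (digit L q v)) ⟩
    code L ℓ (recolour 3 ∘ digit L q)              ∎
    where open ≡-Reasoning

  -- Read backwards: adding 1 at the positions of the digits 2 to the recoloured code gives `q`
  -- again, so the subtraction is exact.
  target : q ∸ current L n q ≡ code L ℓ (recolour 1 ∘ digit L q)
  target = begin
    q ∸ current L n q                              ≡⟨ cong₂ _∸_ (sym back) current-code ⟩
    code L ℓ (recolour 1 ∘ digit L q) + code L 0 h ∸ code L 0 h ≡⟨ m+n∸n≡m _ (code L 0 h) ⟩
    code L ℓ (recolour 1 ∘ digit L q)              ∎
    where
    open ≡-Reasoning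
    back : code L ℓ (recolour 1 ∘ digit L q) + code L 0 h ≡ q
    back = trans (code-+ L ℓ (recolour 1 ∘ digit L q) h)
      (trans (code-cong L ℓ (λ v _ → recolour-∸ (digit L q v))) (decode L q uniq))

  recoloured : ∀ {a q′} → a < 4 → q′ ≡ code L ℓ (recolour a ∘ digit L q) →
               ∀ v → colour L q′ v ≡ recolour a (colour L q v)
  recoloured {a} {q′} a<4 refl v with weight L v in eq
  ... | zero  = refl
  ... | suc w = trans (cong (λ w → ⟦ mod ⟧ (⟦ div ⟧ q′ w) 4) (sym eq))
    (trans (digit-code L ℓ {d = recolour a ∘ digit L q} {v} (λ u _ → recolour-< {a} a<4 (digit-< L q u))
        (λ z → 1+n≢0 (trans (sym eq) z)) uniq)
      (cong (λ w → recolour a (⟦ mod ⟧ (⟦ div ⟧ q w) 4)) eq))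

  same-level : ∀ {a q′} → a < 4 → q′ ≡ code L ℓ (recolour a ∘ digit L q) → level L q′ ≡ ℓ
  same-level {a} a<4 refl = level-code L ℓ (λ u _ → recolour-< {a} a<4 (digit-< L q u)) uniq

2≢3 : 2 ≢ 3
2≢3 ()

anyF-cong : ∀ {n} {p q : Fin n → Bool} → (∀ i → p i ≡ q i) → anyF p ≡ anyF q
anyF-cong {zero}  h = refl
anyF-cong {suc n} h = cong₂ _∨_ (h zero) (anyF-cong (h ∘ suc))

count-cong : ∀ {n} {p q : Fin n → Bool} → (∀ i → p i ≡ q i) → count p ≡ count q
count-cong h = sumF-cong λ i → cong bit (h i)

recolour3-≡ᵇ : ∀ c d → d ≢ 2 → d ≢ 3 → (recolour 3 c ≡ᵇ d) ≡ (c ≡ᵇ d)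
recolour3-≡ᵇ 0 d d2 d3 = refl
recolour3-≡ᵇ 1 d d2 d3 = refl
recolour3-≡ᵇ 2 d d2 d3 = trans (≢⇒≡ᵇ-false (d3 ∘ sym)) (sym (≢⇒≡ᵇ-false (d2 ∘ sym)))
recolour3-≡ᵇ (suc (suc (suc c))) d d2 d3 = refl

extend : ∀ {n} → (Fin n → ℕ) → ℕ → ℕ
extend {n} κ v with v <? n
... | yes v<n = κ (fromℕ< v<n)
-- The default has to be a base-4 digit, for the sake of `extend-<`.
... | no _    = 0

extend-toℕ : ∀ {n} (κ : Fin n → ℕ) i → extend κ (toℕ i) ≡ κ i
extend-toℕ {n} κ i with toℕ i <? n
... | yes i<n = cong κ (fromℕ<-toℕ i i<n)
... | no i≮n  = contradiction (toℕ<n i) i≮n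

-- Soundness and completeness of the table

module Table {n} (G : Graph n) (L : List ℕ) (uniq : Unique L) (small : All (_< n) L)
             (cover : ∀ u v → Graph.Edge G u v → weight L (toℕ u) ≢ 0 ⊎ weight L (toℕ v) ≢ 0)
             (K : ℕ) where

  open Colouring G
  open Parameters G

  colours : ℕ → Colours
  colours q v = colour L q (toℕ v)

  -- A table entry is the part of the budget K still unspent, and 0 if nothing
  -- feasible is known.  Without finished components there is no need for a table.
  val : (ℕ → ℕ) → ℕ → ℕ
  val τ q = choose (bit (anyF (is (colours q) 1))) (τ (q + current L n q))
              (K ∸ level L q ∸ count (is (colours q) 0))

  step : (ℕ → ℕ) → ℕ → ℕ
  step τ q = choose (bit (feasible (level L q) (colours q))) (val τ q ∸ price (level L q) (colours q)) 0

  Final : ℕ → Set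
  Final q = 1 ≤ level L q × (∀ v → colours q v ≢ 2) × (∀ v → colours q v ≢ 3)

  Sound : (ℕ → ℕ) → Set
  Sound τ = ∀ q → 0 < τ q → Partial K (level L q) (colours q) (τ q)

  colour-≤ : ∀ q v → colour L q v ≤ 4
  colour-≤ q v with weight L v
  ... | zero  = ≤-refl
  ... | suc w = <⇒≤ (m%n<n (⟦ div ⟧ q (suc w)) 4)

  colour-4 : ∀ q v → colour L q v ≡ 4 → weight L v ≡ 0
  colour-4 q v eq with weight L v
  ... | zero  = refl
  ... | suc w = contradiction eq (<⇒≢ (m%n<n (⟦ div ⟧ q (suc w)) 4))

  legal : ∀ q → Legal (colours q)
  legal q = record
    { classes = λ v → colour-≤ q (toℕ v)
    ; cover = λ {u} {v} e u4 v4 → neither (cover u v e) (colour-4 q (toℕ u) u4) (colour-4 q (toℕ v) v4) }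
    where
    neither : ∀ {x y} → x ≢ 0 ⊎ y ≢ 0 → x ≡ 0 → y ≢ 0
    neither (inj₁ x≢0) x0 _  = x≢0 x0
    neither (inj₂ y≢0) _ y0 = y≢0 y0

  module _ (q : ℕ) where
    open Shift {n} L uniq small q

    colours-source : ∀ v → colours (q + current L n q) v ≡ recolour 3 (colours q v)
    colours-source v = recoloured (s≤s (s≤s (s≤s (s≤s z≤n)))) source (toℕ v)

    colours-target : ∀ v → colours (q ∸ current L n q) v ≡ recolour 1 (colours q v)
    colours-target v = recoloured (s≤s (s≤s z≤n)) target (toℕ v)

    level-source : level L (q + current L n q) ≡ level L q
    level-source = same-level (s≤s (s≤s (s≤s (s≤s z≤n)))) source

    level-target : level L (q ∸ current L n q) ≡ level L q
    level-target = same-level (s≤s (s≤s z≤n)) target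

  at-level : ∀ {ℓ ℓ′ κ b} → ℓ ≡ ℓ′ → Partial K ℓ κ b → Partial K ℓ′ κ b
  at-level refl g = g

  sound-val : ∀ {τ} → Sound τ → ∀ q → 0 < val τ q →
              Partial K (level L q) (recolour 3 ∘ colours q) (val τ q)
  sound-val {τ} sound q pos with anyF (is (colours q) 1) in eq
  ... | true  = at-level (level-source q)
                  (partial-cong (colours-source q) (sound (q + current L n q) pos))
  ... | false = subst (Partial K (level L q) (recolour 3 ∘ colours q)) same
      (partial-base no1 (≤-trans pos (≤-reflexive (sym same))))
    where
    no1 : ∀ v → recolour 3 (colours q v) ≢ 1
    no1 v v1 = subst T eq (any-intro (is (colours q) 1) v (≡ᵇ-true (recolour-3 {colours q v} (λ ()) v1)))
    same : K ∸ level L q ∸ count (is (recolour 3 ∘ colours q) 0) ≡ K ∸ level L q ∸ count (is (colours q) 0)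
    same = cong (K ∸ level L q ∸_) (count-cong {p = is (recolour 3 ∘ colours q) 0} {is (colours q) 0} λ v →
        recolour3-≡ᵇ (colours q v) 0 (λ ()) (λ ()))

  sound-step : ∀ {τ} → Sound τ → ∀ q → 0 < step τ q →
               Partial K (level L (q ∸ current L n q)) (colours (q ∸ current L n q)) (step τ q)
  sound-step {τ} sound q pos with feasible (level L q) (colours q) in eq
  ... | true = at-level (sym (level-target q))
      (partial-cong (λ v → sym (colours-target q v))
        (partial-step (legal q)
          (sound-val sound q (≤-trans pos (m∸n≤m _ (price (level L q) (colours q)))))
          (subst T (sym eq) tt) pos))

  sound-final : ∀ {τ} → Sound τ → ∀ q → Final q → 0 < val τ q → vi G < K
  sound-final sound q (1≤ℓ , no2 , no3) pos =
    partial-final (legal q) no2 no3 1≤ℓ pos (partial-cong (λ v → recolour-fixed 3 (no2 v)) (sound-val sound q pos))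

  -- The inequality that the pass through the codes has to establish. Codes with an empty part are
  -- left out: their source and target are the same cell.
  Closed : (ℕ → ℕ) → Set
  Closed τ = ∀ q → q < suc n * 4 ^ length L → current L n q ≢ 0 → step τ q ≤ τ (q ∸ current L n q)

  module Completeness {τ} (closed : Closed τ) {σ : Fin n → Bool} {ℓ} (1≤ℓ : 1 ≤ ℓ) (ℓ≤n : ℓ ≤ n)
                      (sizes : ∀ u → ¬ T (σ u) → count (reach σ u) ≤ ℓ)
                      (cheap : count σ + ℓ < K) where

    InCover : Colours → Set
    InCover κ = ∀ v → (weight L (toℕ v) ≡ 0 → κ v ≡ 4) × (weight L (toℕ v) ≢ 0 → κ v < 4)

    encode : Colours → ℕ
    encode κ = code L ℓ (extend κ)

    extend-< : ∀ {κ} → InCover κ → ∀ v → weight L v ≢ 0 → extend κ v < 4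
    extend-< {κ} ic v w≢0 with v <? n
    ... | yes v<n = proj₂ (ic (fromℕ< v<n)) (λ z → w≢0 (trans (cong (weight L) (sym (toℕ-fromℕ< v<n))) z))
    ... | no _    = s≤s z≤n

    encode-colours : ∀ {κ} → InCover κ → ∀ v → colours (encode κ) v ≡ κ v
    encode-colours {κ} ic v with weight L (toℕ v) in eq
    ... | zero  = sym (proj₁ (ic v) eq)
    ... | suc w = trans (cong (λ w → ⟦ mod ⟧ (⟦ div ⟧ (encode κ) w) 4) (sym eq))
      (trans (digit-code L ℓ {extend κ} {toℕ v} (extend-< ic) (λ z → 1+n≢0 (trans (sym eq) z)) uniq) (extend-toℕ κ v))

    encode-level : ∀ {κ} → InCover κ → level L (encode κ) ≡ ℓ
    encode-level ic = level-code L ℓ (extend-< ic) uniq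

    encode-< : ∀ {κ} → InCover κ → encode κ < suc n * 4 ^ length L
    encode-< ic = ≤-trans (code-< L ℓ (extend-< ic) uniq) (*-monoˡ-≤ (4 ^ length L) (s≤s ℓ≤n))

    -- A code is determined by its level and its digits, and on the cover the digits are the
    -- colours. This identifies sources and targets, which arise by arithmetic, with encoded
    -- colourings.
    recode : ∀ {κ q} → InCover κ → level L q ≡ ℓ → (∀ v → colours q v ≡ κ v) → q ≡ encode κ
    recode {κ} {q} ic refl same = trans (sym (decode L q uniq)) (code-cong L ℓ digits)
      where
      digits : ∀ v → ¬ All (v ≢_) L → digit L q v ≡ extend κ v
      digits v v∈ with v <? n
      ... | no v≮n = contradiction (beyond L small) v∈
        where
        beyond : ∀ L → All (_< n) L → All (v ≢_) L
        beyond []      []        = []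
        beyond (x ∷ L) (x< ∷ a) = (λ { refl → v≮n x< }) ∷ beyond L a
      ... | yes v<n = trans (shown v (v∈ ∘ weight-0 L))
              (trans (cong (colour L q) (sym (toℕ-fromℕ< v<n))) (same (fromℕ< v<n)))
        where
        shown : ∀ v → weight L v ≢ 0 → digit L q v ≡ colour L q v
        shown v w≢0 with weight L v
        ... | zero  = contradiction refl w≢0
        ... | suc _ = refl

    -- The form that `val` takes at a colouring without colour 2, which is its own source.
    credit : Colours → ℕ
    credit κ = choose (bit (anyF (is κ 1))) (τ (encode κ)) (K ∸ ℓ ∸ count (is κ 0))

    -- The components of the solution `σ` are being added one by one, and `rich` says that the table
    -- does at least as well as `σ` on those added so far. By `closed₁` they have been added
    -- completely.
    record Stage (κ : Colours) : Set where
      field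
        in-cover : InCover κ
        no2      : ∀ v → κ v ≢ 2
        in-σ     : ∀ {v} → κ v ≡ 0 → T (σ v)
        out-σ    : ∀ {v} → T (σ v) → κ v ≡ 0 ⊎ κ v ≡ 4
        closed₁  : ∀ {u v} → κ u ≡ 1 → Star (Avoid σ) u v → κ v ≢ 3
        rich     : K ∸ (ℓ + count (is κ 0) + count (paid σ κ)) ≤ credit κ

    -- The vertices of colour 0 and those paid for are disjoint subsets of `σ`, so by `cheap` a
    -- positive amount is left of the budget.
    stage-final : ∀ {κ} → Stage κ → (∀ v → κ v ≢ 3) →
                  ∃[ q ] q < suc n * 4 ^ length L × Final q × 0 < val τ q
    stage-final {κ} st no3 = encode κ , encode-< in-cover ,
      (≤-trans 1≤ℓ (≤-reflexive (sym (encode-level in-cover))) , shown2 ,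
          (λ v eq → no3 v (trans (sym (same v)) eq))) ,
      ≤-trans (≤-trans (m<n⇒0<n∸m enough) rich) (≤-reflexive (sym val≡))
      where
      open Stage st
      same = encode-colours in-cover
      shown2 : ∀ v → colours (encode κ) v ≢ 2
      shown2 v eq = no2 v (trans (sym (same v)) eq)
      source≡ : encode κ + current L n (encode κ) ≡ encode κ
      source≡ = recode in-cover (trans (level-source (encode κ)) (encode-level in-cover))
        λ v → trans (colours-source (encode κ) v) (trans (recolour-fixed 3 (shown2 v)) (same v))
      val≡ : val τ (encode κ) ≡ credit κ
      val≡ rewrite anyF-cong {p = is (colours (encode κ)) 1} {is κ 1} (λ v → cong (_≡ᵇ 1) (same v))
                 | count-cong {p = is (colours (encode κ)) 0} {is κ 0} (λ v → cong (_≡ᵇ 0) (same v))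
                 | encode-level in-cover | source≡ = refl
      enough : ℓ + count (is κ 0) + count (paid σ κ) < K
      enough = ≤-trans (s≤s (≤-trans (≤-reflexive (+-assoc ℓ (count (is κ 0)) (count (paid σ κ)))) (≤-trans
        (+-monoʳ-≤ ℓ (count-disjoint {p = is κ 0} {paid σ κ} {σ}
          (λ i t → in-σ (≡ᵇ-eq (κ i) t)) (λ i t → ∧-snd {is κ 4 i} (∧-fst t))
          (λ i t t′ → 0≢4 (trans (sym (≡ᵇ-eq (κ i) t)) (≡ᵇ-eq (κ i) (∧-fst (∧-fst t′)))))))
        (≤-reflexive (+-comm ℓ (count σ)))))) cheap
        where
        0≢4 : 0 ≢ 4
        0≢4 ()

    -- The next component is that of any remaining cover vertex `v₀`: its vertices of colour 3
    -- become the part, giving a code whose source is `κ` and whose target is the next stage.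
    module Next {κ} (st : Stage κ) v₀ (v₀3 : κ v₀ ≡ 3) where
      open Stage st

      κ′ κ₊ : Colours
      κ′ u = if is κ 3 u ∧ reach σ v₀ u then 2 else κ u
      κ₊ = recolour 1 ∘ κ′

      picked : ∀ {u} → κ u ≡ 3 → Star (Avoid σ) v₀ u → κ′ u ≡ 2
      picked {u} eq s with is κ 3 u ∧ reach σ v₀ u in e
      ... | true  = refl
      ... | false = ⊥-elim (subst T e (∧-intro (≡ᵇ-true eq) (star⇒reach {σ} {v₀} {u} s)))

      unpicked : ∀ {u c} → c ≢ 2 → κ′ u ≡ c → κ u ≡ c
      unpicked {u} c≢2 eq with is κ 3 u ∧ reach σ v₀ u
      ... | true  = contradiction (sym eq) c≢2
      ... | false = eq

      picked-inv : ∀ {u} → κ′ u ≡ 2 → κ u ≡ 3 × Star (Avoid σ) v₀ u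
      picked-inv {u} eq with is κ 3 u ∧ reach σ v₀ u in e
      ... | true  = ≡ᵇ-eq (κ u) (∧-fst (subst T (sym e) tt)) ,
                    reach⇒star {σ} {v₀} {u} (∧-snd {is κ 3 u} (subst T (sym e) tt))
      ... | false = contradiction eq (no2 u)

      kept : ∀ {u c} → c ≢ 3 → κ u ≡ c → κ′ u ≡ c
      kept {u} c≢3 eq with is κ 3 u ∧ reach σ v₀ u in e
      ... | true  = contradiction (trans (sym eq) (≡ᵇ-eq (κ u) (∧-fst (subst T (sym e) tt)))) c≢3
      ... | false = eq

      before : ∀ u → recolour 3 (κ′ u) ≡ κ u
      before u with is κ 3 u ∧ reach σ v₀ u in e
      ... | true  = sym (≡ᵇ-eq (κ u) (∧-fst (subst T (sym e) tt)))
      ... | false = recolour-fixed 3 (no2 u)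

      in-cover′ : InCover κ′
      in-cover′ v = (λ z → kept (λ ()) (proj₁ (in-cover v) z)) , below
        where
        below : weight L (toℕ v) ≢ 0 → κ′ v < 4
        below w≢0 with is κ 3 v ∧ reach σ v₀ v
        ... | true  = s≤s (s≤s (s≤s z≤n))
        ... | false = proj₂ (in-cover v) w≢0

      in-cover₊ : InCover κ₊
      in-cover₊ v = (λ z → cong (recolour 1) (proj₁ (in-cover′ v) z)) ,
        λ w≢0 → recolour-< {1} {κ′ v} (s≤s (s≤s z≤n)) (proj₂ (in-cover′ v) w≢0)

      q : ℕ
      q = encode κ′

      same : ∀ v → colours q v ≡ κ′ v
      same = encode-colours in-cover′

      source≡ : q + current L n q ≡ encode κ
      source≡ = recode in-cover (trans (level-source q) (encode-level in-cover′))
        λ v → trans (colours-source q v) (trans (cong (recolour 3) (same v)) (before v))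

      target≡ : q ∸ current L n q ≡ encode κ₊
      target≡ = recode in-cover₊ (trans (level-target q) (encode-level in-cover′))
        λ v → trans (colours-target q v) (cong (recolour 1) (same v))

      level≡ : level L q ≡ ℓ
      level≡ = encode-level in-cover′

      v₀2 : colours q v₀ ≡ 2
      v₀2 = trans (same v₀) (picked v₀3 ε)

      -- Otherwise `q` would be its own source, where `v₀` changes from colour 2 to colour 3.
      current≢0 : current L n q ≢ 0
      current≢0 z = 2≢3 (trans (sym v₀2) (trans (cong (λ q → colours q v₀) (sym q+0))
          (trans (colours-source q v₀) (cong (recolour 3) v₀2))))
        where
        q+0 : q + current L n q ≡ q
        q+0 = trans (cong (q +_) z) (+-identityʳ q)

      val≡ : val τ q ≡ credit κ
      val≡ rewrite anyF-cong {p = is (colours q) 1} {is κ 1}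
          (λ v → trans (cong (_≡ᵇ 1) (same v)) (trans (sym (recolour3-≡ᵇ (κ′ v) 1 (λ ()) (λ ())))
              (cong (_≡ᵇ 1) (before v))))
                 | count-cong {p = is (colours q) 0} {is κ 0}
                     (λ v → trans (cong (_≡ᵇ 0) (same v)) (trans (sym (recolour3-≡ᵇ (κ′ v) 0 (λ ()) (λ ())))
                         (cong (_≡ᵇ 0) (before v))))
                 | level≡ | source≡ = refl

      legalκ : Legal (colours q)
      legalκ = legal q

      in-σ′ : ∀ {v} → colours q v ≡ 0 → T (σ v)
      in-σ′ {v} eq = in-σ (unpicked (λ ()) (trans (sym (same v)) eq))

      out-σ′ : ∀ {v} → T (σ v) → colours q v ≡ 0 ⊎ colours q v ≡ 4
      out-σ′ {v} t with out-σ t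
      ... | inj₁ eq = inj₁ (trans (same v) (kept (λ ()) eq))
      ... | inj₂ eq = inj₂ (trans (same v) (kept (λ ()) eq))

      back : ∀ {u v} → Star (Avoid σ) u v → Star (Avoid σ) v u
      back = Star.reverse
        λ { (u∉ , v∉ , e) → v∉ , u∉ , flip e }

      whole : ∀ {u v} → colours q u ≡ 2 → Star (Avoid σ) u v → colours q v ≢ 1 × colours q v ≢ 3
      whole {u} {v} u2 s with picked-inv {u} (trans (sym (same u)) u2)
      ... | u3 , s₀ =
        (λ v1 → closed₁ (unpicked (λ ()) (trans (sym (same v)) v1)) (back s) u3) ,
        (λ v3 → 2≢3 (trans (sym (picked {v} (unpicked (λ ()) (trans (sym (same v)) v3)) (s₀ ◅◅ s)))
                       (trans (sym (same v)) v3)))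

      connected : ∀ {u} → colours q u ≡ 2 → Star (Avoid σ) v₀ u
      connected {u} u2 = proj₂ (picked-inv {u} (trans (sym (same u)) u2))

      v₀∉σ : ¬ T (σ v₀)
      v₀∉σ t with out-σ t
      ... | inj₁ eq with () ← trans (sym v₀3) eq
      ... | inj₂ eq with () ← trans (sym v₀3) eq

      ok : T (feasible ℓ (colours q))
      ok = feasible-component legalκ in-σ′ out-σ′ whole v₀ (sizes v₀ v₀∉σ) connected

      any₊ : anyF (is κ₊ 1) ≡ true
      any₊ with anyF (is κ₊ 1) in eq
      ... | true  = refl
      ... | false = ⊥-elim (subst T eq (any-intro (is κ₊ 1) v₀ (≡ᵇ-true (cong (recolour 1) (picked v₀3 ε)))))

      -- Now `v₀` has colour 1, so the new credit is a table entry, the one at the target, and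
      -- `closed` bounds it from below.
      credit₊ : credit κ ∸ price ℓ (colours q) ≤ credit κ₊
      credit₊ rewrite any₊ = ≤-trans (≤-reflexive (sym step≡))
        (≤-trans (closed q (encode-< in-cover′) current≢0) (≤-reflexive (cong τ target≡)))
        where
        T⇒≡ : ∀ {b} → T b → b ≡ true
        T⇒≡ {true} _ = refl
        step≡ : step τ q ≡ credit κ ∸ price ℓ (colours q)
        step≡ rewrite val≡ | level≡ | T⇒≡ ok = refl

      paid≤ : count (paid σ κ) + price ℓ (colours q) ≤ count (paid σ κ₊)
      paid≤ = ≤-trans (+-monoˡ-≤ (price ℓ (colours q)) (≤-reflexive (count-paid before′)))
        (≤-trans (paid-grows legalκ in-σ′ out-σ′ whole v₀ (sizes v₀ v₀∉σ) connected)
          (≤-reflexive (count-paid λ v → cong (recolour 1) (same v))))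
        where
        before′ : ∀ v → κ v ≡ recolour 3 (colours q v)
        before′ v = trans (sym (before v)) (cong (recolour 3) (sym (same v)))
        count-paid : ∀ {κ₁ κ₂ : Colours} → (∀ v → κ₁ v ≡ κ₂ v) → count (paid σ κ₁) ≡ count (paid σ κ₂)
        count-paid {κ₁} {κ₂} h = count-cong λ v → cong₂ (λ x y → (x ∧ σ v) ∧ y) (cong (_≡ᵇ 4) (h v))
          (anyF-cong {p = λ u → adj v u ∧ (κ₁ u ≡ᵇ 1)} λ u → cong (λ x → adj v u ∧ (x ≡ᵇ 1)) (h u))

      zero₊ : count (is κ₊ 0) ≡ count (is κ 0)
      zero₊ = count-cong pointwise
        where
        pointwise : ∀ v → is κ₊ 0 v ≡ is κ 0 v
        pointwise v with is κ 3 v ∧ reach σ v₀ v in e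
        ... | true rewrite ≡ᵇ-eq (κ v) {3} (∧-fst (subst T (sym e) tt)) = refl
        ... | false rewrite recolour-fixed 1 (no2 v) = refl

      stage₊ : Stage κ₊
      stage₊ = record
        { in-cover = in-cover₊
        ; no2 = λ v eq → no2′ (κ′ v) eq
        ; in-σ = λ {v} eq → in-σ (unpicked (λ ()) (recolour-1 {κ′ v} (λ ()) eq))
        ; out-σ = λ {v} t → Sum.map (λ eq → cong (recolour 1) (kept {v} (λ ()) eq))
            (λ eq → cong (recolour 1) (kept {v} (λ ()) eq)) (out-σ t)
        ; closed₁ = closed₊
        ; rich = ≤-trans (≤-trans (∸-monoʳ-≤ K more) (≤-reflexive
            (sym (∸-+-assoc K (ℓ + count (is κ 0) + count (paid σ κ)) (price ℓ (colours q))))))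
                   (≤-trans (∸-monoˡ-≤ (price ℓ (colours q)) rich) credit₊)
        }
        where
        no2′ : ∀ c → recolour 1 c ≢ 2
        no2′ (suc (suc (suc c))) ()
        more : ℓ + count (is κ 0) + count (paid σ κ) + price ℓ (colours q) ≤ ℓ + count (is κ₊ 0) + count (paid σ κ₊)
        more = ≤-trans (≤-reflexive (+-assoc (ℓ + count (is κ 0)) _ _))
          (+-mono-≤ (≤-reflexive (cong (ℓ +_) (sym zero₊))) paid≤)
        closed₊ : ∀ {u v} → κ₊ u ≡ 1 → Star (Avoid σ) u v → κ₊ v ≢ 3
        closed₊ {u} {v} u1 s v3 with recolour-1-1 {κ′ u} u1
        ... | inj₁ eq = closed₁ (unpicked (λ ()) eq) s (unpicked {v} (λ ()) (recolour-1 {κ′ v} (λ ()) v3))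
        ... | inj₂ eq = 2≢3 (trans (sym (picked {v} (unpicked {v} (λ ()) v3′) (proj₂ (picked-inv {u} eq) ◅◅ s))) v3′)
          where
          v3′ : κ′ v ≡ 3
          v3′ = recolour-1 {κ′ v} (λ ()) v3

      fewer : count (is κ₊ 3) < count (is κ 3)
      fewer = ≤-trans (+-monoˡ-≤ (count (is κ₊ 3)) (count-some {p = λ v → is κ′ 2 v} v₀ (≡ᵇ-true (picked v₀3 ε))))
        (count-disjoint {p = is κ′ 2} {is κ₊ 3} {is κ 3}
          (λ i t → ≡ᵇ-true (proj₁ (picked-inv {i} (≡ᵇ-eq (κ′ i) t))))
          (λ i t → ≡ᵇ-true (unpicked {i} (λ ()) (recolour-1 {κ′ i} (λ ()) (≡ᵇ-eq (κ₊ i) t))))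
          (λ i t t′ → 2≢3 (trans (sym (≡ᵇ-eq (κ′ i) t)) (recolour-1 {κ′ i} (λ ()) (≡ᵇ-eq (κ₊ i) t′)))))

    finish : ∀ m {κ} → count (is κ 3) ≤ m → Stage κ → ∃[ q ] q < suc n * 4 ^ length L × Final q × 0 < val τ q
    finish m {κ} #3 st with T? (anyF (is κ 3))
    ... | no none = stage-final st λ v v3 → none (any-intro (is κ 3) v (≡ᵇ-true v3))
    ... | yes some with any-witness (is κ 3) some
    finish zero    {κ} #3 st | yes some | v , t = contradiction (≤-trans (count-some v t) #3) λ ()
    finish (suc m) {κ} #3 st | yes some | v , t =
      finish m (s≤s⁻¹ (≤-trans fewer #3)) stage₊
      where open Next st v (≡ᵇ-eq (κ v) t)

    initial : Colours
    initial v = choose (weight L (toℕ v)) (if σ v then 0 else 3) 4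

    complete : ∃[ q ] q < suc n * 4 ^ length L × Final q × 0 < val τ q
    complete = finish (count (is initial 3)) ≤-refl (record
      { in-cover = λ v → in4 v , lt4 v
      ; no2 = no2
      ; in-σ = λ {v} → in-σ v
      ; out-σ = λ {v} → out-σ v
      ; closed₁ = λ {u} eq → contradiction eq (no1 u)
      ; rich = rich
      })
      where
      in4 : ∀ v → weight L (toℕ v) ≡ 0 → initial v ≡ 4
      in4 v eq rewrite eq = refl
      lt4 : ∀ v → weight L (toℕ v) ≢ 0 → initial v < 4
      lt4 v h with weight L (toℕ v) | σ v
      ... | zero  | _     = contradiction refl h
      ... | suc _ | true  = s≤s z≤n
      ... | suc _ | false = ≤-refl
      no2 : ∀ v → initial v ≢ 2
      no2 v eq with weight L (toℕ v) | σ v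
      no2 v () | zero  | _
      no2 v () | suc _ | true
      no2 v () | suc _ | false
      no1 : ∀ v → initial v ≢ 1
      no1 v eq with weight L (toℕ v) | σ v
      no1 v () | zero  | _
      no1 v () | suc _ | true
      no1 v () | suc _ | false
      in-σ : ∀ v → initial v ≡ 0 → T (σ v)
      in-σ v eq with weight L (toℕ v) | σ v
      in-σ v ()   | zero  | _
      in-σ v refl | suc _ | true = tt
      in-σ v ()   | suc _ | false
      out-σ : ∀ v → T (σ v) → initial v ≡ 0 ⊎ initial v ≡ 4
      out-σ v t with weight L (toℕ v) | σ v
      ... | zero  | _    = inj₂ refl
      ... | suc _ | true = inj₁ refl
      none : anyF (is initial 1) ≡ false
      none with anyF (is initial 1) in eq
      ... | false = refl
      ... | true with any-witness (is initial 1) (subst T (sym eq) tt)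
      ...   | v , t = contradiction (≡ᵇ-eq (initial v) t) (no1 v)
      rich : K ∸ (ℓ + count (is initial 0) + count (paid σ initial)) ≤ credit initial
      rich rewrite none = ≤-trans (∸-monoʳ-≤ K (m≤m+n (ℓ + count (is initial 0)) _))
        (≤-reflexive (sym (∸-+-assoc K ℓ (count (is initial 0)))))

-- The program

-- Register `i` as seen under `k` summation variables.
ν : ∀ k → Fin 8 → Term (k + 8)
ν k i = var (k ↑ʳ i)

-- Memory layout: the adjacency matrix, then rows of n + 1 cells, one for each
-- node of the search tree, and from the row after the last node on the table.
row : ℕ → ℕ → ℕ → ℕ
row n j v = n * n + (1 + n) * j + v

rowᵗ : ∀ k → Term (k + 8) → Term (k + 8) → Term (k + 8)
rowᵗ k j v = ν k 0F ⊗ ν k 0F ⊕ (con 1 ⊕ ν k 0F) ⊗ j ⊕ v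

andᵗ : ∀ {l} → Term l → Term l → Term l
andᵗ a b = ite a b (con 0)

norᵗ : ∀ {l} → Term l → Term l → Term l
norᵗ a b = ite a (con 0) b

uncoveredᵗ : ∀ k → Term (k + 8) → Term (k + 8) → Term (k + 8)
uncoveredᵗ k j e = andᵗ (at e)
  (norᵗ (at (rowᵗ k j (bin div e (ν k 0F)))) (norᵗ (at (rowᵗ k j (bin mod e (ν k 0F)))) (con 1)))

remainingᵗ : Term 8
remainingᵗ = sum (ν 0 0F ⊗ ν 0 0F) (uncoveredᵗ 1 (ν 1 3F) (var 0F))

halfᵗ : ∀ k → Term (k + 8)
halfᵗ k = bin div (ν k 3F) (con 2)

-- The index of the least uncovered matrix entry, obtained by counting the entries up to and
-- including which nothing is uncovered.
firstᵗ : Term 8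
firstᵗ = sum (ν 0 0F ⊗ ν 0 0F)
  (bin equal (sum (con 1 ⊕ var 0F) (uncoveredᵗ 2 (halfᵗ 2) (var 0F))) (con 0))

pickᵗ : Term 8
pickᵗ = ite (bin mod (ν 0 3F) (con 2)) (bin mod firstᵗ (ν 0 0F)) (bin div firstᵗ (ν 0 0F))

weightᵗ : ∀ k → Term (k + 8) → Term (k + 8)
weightᵗ k v = at (rowᵗ k (ν k 3F) v)

colourᵗ : ∀ k → Term (k + 8) → Term (k + 8)
colourᵗ k v = ite (weightᵗ k v) (bin mod (bin div (ν k 6F) (weightᵗ k v)) (con 4)) (con 4)

isᵗ : ∀ k → ℕ → Term (k + 8) → Term (k + 8)
isᵗ k c v = bin equal (colourᵗ k v) (con c)

nbᵗ : ℕ → Term 9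
nbᵗ c = bin less (con 0) (sum (ν 1 0F) (andᵗ (at (ν 2 0F ⊗ var 1F ⊕ var 0F)) (isᵗ 2 c (var 0F))))

countᵗ : Term 9 → Term 8
countᵗ t = sum (ν 0 0F) t

freshᵗ splitᵗ exclusiveᵗ conflictᵗ : Term 9
freshᵗ     = andᵗ (isᵗ 1 4 (var 0F)) (norᵗ (nbᵗ 1) (nbᵗ 2))
splitᵗ     = andᵗ freshᵗ (nbᵗ 3)
exclusiveᵗ = andᵗ freshᵗ (norᵗ (nbᵗ 3) (con 1))
conflictᵗ  = andᵗ (isᵗ 1 2 (var 0F)) (nbᵗ 3)

levelᵗ priceᵗ feasibleᵗ valᵗ stepᵗ finalᵗ currentᵗ targetᵗ : Term 8
-- Cell `n` of a row, which belongs to no vertex, holds 4 to the size of the cover.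
levelᵗ    = bin div (ν 0 6F) (weightᵗ 0 (ν 0 0F))
priceᵗ    = countᵗ splitᵗ ⊕ (countᵗ (isᵗ 1 2 (var 0F)) ⊕ countᵗ exclusiveᵗ ⊖ levelᵗ)
feasibleᵗ = andᵗ (bin equal (countᵗ conflictᵗ) (con 0))
                 (norᵗ (bin less levelᵗ (countᵗ (isᵗ 1 2 (var 0F)))) (con 1))
valᵗ      = ite (bin less (con 0) (countᵗ (isᵗ 1 1 (var 0F))))
                (at (rowᵗ 0 (con 1 ⊕ ν 0 3F) (ν 0 6F ⊕ ν 0 7F)))
                (ν 0 2F ⊖ levelᵗ ⊖ countᵗ (isᵗ 1 0 (var 0F)))
stepᵗ     = andᵗ feasibleᵗ (valᵗ ⊖ priceᵗ)
finalᵗ    = andᵗ valᵗ (andᵗ levelᵗ (norᵗ (countᵗ (isᵗ 1 2 (var 0F)))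
                                         (norᵗ (countᵗ (isᵗ 1 3 (var 0F))) (con 1))))
currentᵗ  = countᵗ (ite (isᵗ 1 2 (var 0F)) (weightᵗ 1 (var 0F)) (con 0))
targetᵗ   = rowᵗ 0 (con 1 ⊕ ν 0 3F) (ν 0 6F ⊖ ν 0 7F)

decᵗ cellAddressᵗ cellᵗ nextᵗ widthᵗ codesᵗ updateᵗ foundᵗ : Term 8
decᵗ         = ν 0 6F ⊖ con 1
cellAddressᵗ = rowᵗ 0 (ν 0 3F) (ν 0 6F)
-- Putting the branching vertex in front of the parent's list gives it place value 1 and multiplies
-- all other place values by 4, as well as the power of 4 in cell `n`.
cellᵗ        = ite (bin equal (ν 0 6F) (ν 0 5F)) (con 1) (con 4 ⊗ at (rowᵗ 0 (halfᵗ 0) (ν 0 6F)))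
nextᵗ        = con 1 ⊕ ν 0 3F
widthᵗ       = con 1 ⊕ ν 0 0F
codesᵗ       = widthᵗ ⊗ weightᵗ 0 (ν 0 0F)
-- With truncated subtraction this is the maximum of the old entry and the new value.
updateᵗ      = at targetᵗ ⊕ (stepᵗ ⊖ at targetᵗ)
foundᵗ       = ite finalᵗ (con 1) (ν 0 1F)

fillRow grow relax : Program
fillRow = assign 6F decᵗ ⨾ write cellAddressᵗ cellᵗ
grow    = assign 3F nextᵗ ⨾ assign 5F pickᵗ ⨾ assign 6F widthᵗ ⨾ while (reg 6) fillRow ⨾ assign 4F remainingᵗ
relax   = assign 6F decᵗ ⨾ assign 7F currentᵗ ⨾ write targetᵗ updateᵗ ⨾ assign 1F foundᵗ

-- Registers: 0 is n, 1 the answer, 2 is K, where K ∸ 1 is the budget k cut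
-- off at n (and K = 0 if k < 0), 3 the node of the search tree, 4 the number
-- of edges it leaves uncovered, 5 the branching vertex, 6 a loop counter and
-- 7 the weight of the component being added.
cap : Program
cap =
  cond (reg 1) (set 2 (lit 0))
    (cond (op less (reg 2) (reg 0)) (set 2 (op add (reg 2) (lit 1))) (set 2 (op add (reg 0) (lit 1)))) ⨾
  set 1 (op less (reg 0) (reg 2))

tabulateRows scan decide : Program
tabulateRows = assign 6F codesᵗ ⨾ while (reg 6) relax ⨾ set 0 (reg 1)
scan         = write (rowᵗ 0 (con 1) (ν 0 0F)) (con 1) ⨾ assign {8} 3F (con 1) ⨾ assign 4F remainingᵗ ⨾
               while (reg 4) grow ⨾ tabulateRows
decide       = cap ⨾ scan

-- Bounds for the registers that every assignment preserves. The factor `M` appears for node numbers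
-- (register 3), codes (register 6) and the weight of a part (register 7).
Γ : Vec Degree 8
Γ = (1 , 0) ∷ (1 , 0) ∷ (1 , 0) ∷ (1 , 1) ∷ (3 , 0) ∷ (2 , 0) ∷ (3 , 1) ∷ (3 , 1) ∷ []

-- Any values will do that exceed the degrees of the terms of the program.
A τ : ℕ
A = 16
τ = 28

-- The search tree

index-< : ∀ {n} (u v : Fin n) → n * toℕ u + toℕ v < n * n
index-< u v = ≤-trans (≤-reflexive (cong suc (sym (toℕ-combine u v)))) (toℕ<n (combine u v))

entry-input : ∀ {n} (G : Graph n) k u v → mem (input G k) (n * toℕ u + toℕ v) ≡ bit (Graph.adj G u v)
entry-input {n} G k u v with n * toℕ u + toℕ v <? n * n
... | yes a<n² = cong (λ p → bit (Graph.adj G (proj₁ p) (proj₂ p)))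
  (trans (cong (remQuot {n} n) (toℕ-injective (trans (toℕ-fromℕ< a<n²) (sym (toℕ-combine u v)))))
    (remQuot-combine u v))
... | no a≮n² = contradiction (index-< u v) a≮n²

input-≤1 : ∀ {n} (G : Graph n) k a → mem (input G k) a ≤ 1
input-≤1 {n} G k a with a <? n * n
... | yes a<n² = bit-≤ _
... | no _     = z≤n

input-0 : ∀ {n} (G : Graph n) k a → n * n ≤ a → mem (input G k) a ≡ 0
input-0 {n} G k a n²≤a with a <? n * n
... | yes a<n² = contradiction a<n² (≤⇒≯ n²≤a)
... | no _     = refl

-- The prefix sums vanish exactly before the first nonzero value, so the number of vanishing ones is
-- the index of that value.
sumN-first : ∀ N f → (sumN N f ≡ 0) ⊎
  (let r = sumN N (λ e → bit (sumN (suc e) f ≡ᵇ 0)) in r < N × f r ≢ 0)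
sumN-first zero    f = inj₁ refl
sumN-first (suc N) f with sumN-first N f | f N in eq
... | inj₁ z | zero = inj₁ z
... | inj₁ z | suc m = inj₂ (s≤s (≤-reflexive all) , λ w → 1+n≢0 (trans (sym eq) (trans (cong f (sym all)) w)))
  where
  prefix : ∀ {N f} → sumN N f ≡ 0 → sumN N (λ e → bit (sumN (suc e) f ≡ᵇ 0)) ≡ N
  prefix {zero}  z = refl
  prefix {suc N} {f} z = cong₂ _+_ (cong (λ s → bit (s ≡ᵇ 0)) z) (prefix {N} {f} (m+n≡0⇒n≡0 (f N) z))
  all : sumN N (λ e → bit (sumN (suc e) f ≡ᵇ 0)) ≡ N
  all = prefix {N} {f} z
... | inj₂ (r< , fr) | m = inj₂ (subst (λ r → r < suc N × f r ≢ 0) (sym same) (m≤n⇒m≤1+n r< , fr))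
  where
  r : ℕ
  r = sumN N (λ e → bit (sumN (suc e) f ≡ᵇ 0))
  positive : ∀ N r → r < N → f r ≢ 0 → sumN N f ≢ 0
  positive (suc N) r r<N fr z with r ≟ N
  ... | yes refl = fr (m+n≡0⇒m≡0 (f N) z)
  ... | no r≢N   = positive N r (≤∧≢⇒< (s≤s⁻¹ r<N) r≢N) fr (m+n≡0⇒n≡0 (f N) z)
  bit0 : ∀ s → s ≢ 0 → bit (s ≡ᵇ 0) ≡ 0
  bit0 zero    h = contradiction refl h
  bit0 (suc s) h = refl
  same : bit (m + sumN N f ≡ᵇ 0) + r ≡ r
  same = cong (_+ r) (bit0 _ λ z → positive N r r< fr (m+n≡0⇒n≡0 m z))

length-≤ : ∀ {n} (p : Fin n → Bool) L → Unique L → All (λ v → ∃[ i ] v ≡ toℕ i × T (p i)) L →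
           length L ≤ count p
length-≤ p []      uniq        a                      = z≤n
length-≤ p (v ∷ L) (v∉ ∷ uniq) ((i , refl , pi) ∷ a) = ≤-trans
  (+-mono-≤ (count-some {p = λ j → does (j ≟ᶠ i)} i (does-T (i ≟ᶠ i) refl))
    (length-≤ others L uniq (All.zipWith (λ { (v≢ , j , refl , pj) → j , refl ,
      ∧-intro pj (not-intro λ t → v≢ (cong toℕ (sym (T-does (j ≟ᶠ i) t)))) }) (v∉ , a))))
  (count-disjoint {p = λ j → does (j ≟ᶠ i)} {others} {p}
    (λ j t → subst (T ∘ p) (sym (T-does (j ≟ᶠ i) t)) pi) (λ j → ∧-fst)
    (λ j t t′ → not-elim (∧-snd {p j} t′) t))
  where
  others = λ j → p j ∧ not (does (j ≟ᶠ i))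

module Search {n} (G : Graph n) (m : ℕ → ℕ) (entries : ∀ u v → m (n * toℕ u + toℕ v) ≡ bit (Graph.adj G u v)) where

  open Graph G

  uncovered : (ℕ → ℕ) → ℕ → ℕ
  uncovered w e = choose (m e) (choose (w (⟦ div ⟧ e n)) 0 (choose (w (⟦ mod ⟧ e n)) 0 1)) 0

  remaining first : List ℕ → ℕ
  remaining L = sumN (n * n) (uncovered (weight L))
  first L = sumN (n * n) (λ e → bit (sumN (suc e) (uncovered (weight L)) ≡ᵇ 0))

  pick : List ℕ → ℕ → ℕ
  pick L b = choose b (⟦ mod ⟧ (first L) n) (⟦ div ⟧ (first L) n)

  -- The nodes of the search tree are numbered as in a heap, with root 1, so that
  -- the first node without an uncovered edge is one of least depth.
  tree : ℕ → ℕ → List ℕ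
  tree zero    j = []
  tree (suc f) j = if j ≤ᵇ 1 then [] else (pick (tree f (j / 2)) (j % 2) ∷ tree f (j / 2))

  branch : ℕ → List ℕ
  branch j = tree j j

  half-≤ : ∀ {f j} → 2 ≤ j → j ≤ suc f → j / 2 ≤ f
  half-≤ {f} {suc j} 2≤j j≤ = s≤s⁻¹ (≤-trans (m/n<m (suc j) 2 (s≤s (s≤s z≤n))) j≤)

  -- Halving is not structural recursion, so `tree` carries a recursion bound, whose value is
  -- irrelevant from `j` on.
  tree-fuel : ∀ f f′ j → j ≤ f → j ≤ f′ → tree f j ≡ tree f′ j
  tree-fuel zero    zero     j       h h′ = refl
  tree-fuel zero    (suc f′) zero    h h′ = refl
  tree-fuel (suc f) zero     zero    h h′ = refl
  tree-fuel (suc f) (suc f′) zero    h h′ = refl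
  tree-fuel (suc f) (suc f′) (suc zero) h h′ = refl
  tree-fuel (suc f) (suc f′) j@(suc (suc _)) h h′ =
    cong (λ L → pick L (j % 2) ∷ L) (tree-fuel f f′ (j / 2) (half-≤ (s≤s (s≤s z≤n)) h) (half-≤ (s≤s (s≤s z≤n)) h′))

  branch-step : ∀ j → 2 ≤ j → branch j ≡ pick (branch (j / 2)) (j % 2) ∷ branch (j / 2)
  branch-step j@(suc (suc i)) 2≤j =
    cong (λ L → pick L (j % 2) ∷ L) (tree-fuel (suc i) (j / 2) (j / 2) (half-≤ 2≤j ≤-refl) ≤-refl)
  branch-step (suc zero) (s≤s ())

  choose-pos : ∀ c {a} → choose c a 0 ≢ 0 → c ≢ 0 × a ≢ 0
  choose-pos zero    h = contradiction refl h
  choose-pos (suc c) h = 1+n≢0 , h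

  choose-neg : ∀ c {a} → choose c 0 a ≢ 0 → c ≡ 0 × a ≢ 0
  choose-neg zero    h = refl , h
  choose-neg (suc c) h = contradiction refl h

  record Uncovered (L : List ℕ) (e : ℕ) : Set where
    field
      u v  : Fin n
      u≡   : ⟦ div ⟧ e n ≡ toℕ u
      v≡   : ⟦ mod ⟧ e n ≡ toℕ v
      edge : Edge u v
      u∉   : weight L (toℕ u) ≡ 0
      v∉   : weight L (toℕ v) ≡ 0

  decode-edge : ∀ e → e < n * n → ∃[ u ] ∃[ v ] ⟦ div ⟧ e n ≡ toℕ u × ⟦ mod ⟧ e n ≡ toℕ v × n * toℕ u + toℕ v ≡ e
  decode-edge e e<n² = go n e<n²
    where
    go : ∀ n → e < n * n → Σ[ u ∈ Fin n ] Σ[ v ∈ Fin n ] ⟦ div ⟧ e n ≡ toℕ u × ⟦ mod ⟧ e n ≡ toℕ v × n * toℕ u +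
        toℕ v ≡ e
    go (suc k) e< = fromℕ< u< , fromℕ< v< , sym (toℕ-fromℕ< u<) , sym (toℕ-fromℕ< v<) ,
      trans (cong₂ (λ a b → suc k * a + b) (toℕ-fromℕ< u<) (toℕ-fromℕ< v<))
        (trans (+-comm (suc k * (e / suc k)) (e % suc k))
          (trans (cong ((e % suc k) +_) (*-comm (suc k) (e / suc k))) (sym (m≡m%n+[m/n]*n e (suc k)))))
      where
      u< : e / suc k < suc k
      u< = m<n*o⇒m/o<n e<
      v< : e % suc k < suc k
      v< = m%n<n e (suc k)

  uncovered-edge : ∀ L e → e < n * n → uncovered (weight L) e ≢ 0 → Uncovered L e
  uncovered-edge L e e< h with decode-edge e e<
  ... | u , v , u≡ , v≡ , eq with choose-pos (m e) h
  ... | me , h₁ with choose-neg (weight L (⟦ div ⟧ e n)) h₁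
  ... | wu , h₂ with choose-neg (weight L (⟦ mod ⟧ e n)) h₂
  ... | wv , _ = record
    { u = u ; v = v ; u≡ = u≡ ; v≡ = v≡
    ; edge = bit-T (λ z → me (trans (cong m (sym eq)) (trans (entries u v) z)))
    ; u∉ = trans (cong (weight L) (sym u≡)) wu
    ; v∉ = trans (cong (weight L) (sym v≡)) wv }
    where
    bit-T : ∀ {b} → bit b ≢ 0 → T b
    bit-T {true}  h = tt
    bit-T {false} h = h refl

  first-uncovered : ∀ L → remaining L ≢ 0 → Uncovered L (first L)
  first-uncovered L h with sumN-first (n * n) (uncovered (weight L))
  ... | inj₁ z = contradiction z h
  ... | inj₂ (r< , fr) = uncovered-edge L (first L) r< fr

  pick-vertex : ∀ L b → remaining L ≢ 0 → Σ[ i ∈ Fin n ] pick L b ≡ toℕ i × weight L (toℕ i) ≡ 0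
  pick-vertex L b h with first-uncovered L h
  pick-vertex L zero    h | r = let open Uncovered r in u , u≡ , u∉
  pick-vertex L (suc b) h | r = let open Uncovered r in v , v≡ , v∉

  covered : ∀ L → remaining L ≡ 0 → ∀ u v → Edge u v → weight L (toℕ u) ≢ 0 ⊎ weight L (toℕ v) ≢ 0
  covered L z u v e with weight L (toℕ u) in wu | weight L (toℕ v) in wv
  ... | suc _ | _     = inj₁ 1+n≢0
  ... | zero  | suc _ = inj₂ 1+n≢0
  ... | zero  | zero  = contradiction (vanish (n * n) (n * toℕ u + toℕ v) (index-< u v) z) nonzero
    where
    vanish : ∀ N {f} i → i < N → sumN N f ≡ 0 → f i ≡ 0
    vanish (suc N) {f} i i<N z with i ≟ N
    ... | yes refl = m+n≡0⇒m≡0 (f N) z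
    ... | no i≢N   = vanish N i (≤∧≢⇒< (s≤s⁻¹ i<N) i≢N) (m+n≡0⇒n≡0 (f N) z)
    quotient : ∀ {k} (u v : Fin k) → ⟦ div ⟧ (k * toℕ u + toℕ v) k ≡ toℕ u × ⟦ mod ⟧ (k * toℕ u + toℕ v) k ≡ toℕ v
    quotient {suc k} u v =
      trans (/-congˡ {o = suc k} (trans (+-comm _ (toℕ v)) (cong (toℕ v +_) (*-comm (suc k) (toℕ u)))))
        (trans (+-distrib-/-∣ʳ (toℕ v) {toℕ u * suc k} (divides (toℕ u) refl))
          (cong₂ _+_ (m<n⇒m/n≡0 (toℕ<n v)) (m*n/n≡m (toℕ u) (suc k)))) ,
      trans (%-congˡ {o = suc k} (trans (+-comm _ (toℕ v)) (cong (toℕ v +_) (*-comm (suc k) (toℕ u)))))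
        (trans ([m+kn]%n≡m%n (toℕ v) (toℕ u) (suc k)) (m<n⇒m%n≡m (toℕ<n v)))
    nonzero : uncovered (weight L) (n * toℕ u + toℕ v) ≢ 0
    nonzero eq rewrite entries u v | proj₁ (quotient u v) | proj₂ (quotient u v) | wu | wv with adj u v
    ... | true = 1+n≢0 eq

  -- The length of the list is the depth of the node, and a node of depth d has a number at least 2
  -- ^ d. Hence `large`, which turns the bound on the number of nodes visited into a bound on the
  -- number of colourings.
  record Good (j : ℕ) : Set where
    field
      unique : Unique (branch j)
      below  : All (_< n) (branch j)
      large  : 2 ^ length (branch j) ≤ j

  good-1 : Good 1
  good-1 = record { unique = [] ; below = [] ; large = ≤-refl }

  half-pos : ∀ {j} → 2 ≤ j → 1 ≤ j / 2
  half-pos {j} 2≤j = m≥n⇒m/n>0 2≤j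

  half-< : ∀ {j} → 2 ≤ j → j / 2 < j
  half-< {suc j} 2≤j = m/n<m (suc j) 2 (s≤s (s≤s z≤n))

  good-step : ∀ j → 2 ≤ j → remaining (branch (j / 2)) ≢ 0 → Good (j / 2) → Good j
  good-step j 2≤j live g with pick-vertex (branch (j / 2)) (j % 2) live
  ... | i , p≡ , w0 = record
    { unique = subst Unique (sym eq) (weight-0 L w0 ∷ Good.unique g)
    ; below = subst (All (_< n)) (sym eq) (toℕ<n i ∷ Good.below g)
    ; large = large }
    where
    L = branch (j / 2)
    eq : branch j ≡ toℕ i ∷ L
    eq = trans (branch-step j 2≤j) (cong (_∷ L) p≡)
    large : 2 ^ length (branch j) ≤ j
    large rewrite branch-step j 2≤j = ≤-trans (*-monoʳ-≤ 2 (Good.large g))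
      (≤-trans (≤-reflexive (*-comm 2 (j / 2))) (m/n*n≤m j 2))

  weights-≤ : ∀ j → Good j → 4 ^ length (branch j) ≤ j * j
  weights-≤ j g = ≤-trans (≤-reflexive (trans (^-*-assoc 2 2 l)
      (trans (cong (2 ^_) (cong (l +_) (+-identityʳ l))) (^-distribˡ-+-* 2 l l))))
    (*-mono-≤ (Good.large g) (Good.large g))
    where l = length (branch j)

  module Descent (C : Fin n → Bool) (isCover : ∀ u v → Edge u v → T (C u) ⊎ T (C v)) where

    -- The node has been reached by always picking an end that lies in the cover `C`. Its list
    -- consists of distinct members of `C` once the node is good, so its depth is at most the size
    -- of `C`.
    record OnPath (g : ℕ) : Set where
      field
        within-C  : All (λ v → ∃[ i ] v ≡ toℕ i × T (C i)) (branch g)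
        shallow : g < 2 ^ suc (length (branch g))

    onPath-1 : OnPath 1
    onPath-1 = record { within-C = [] ; shallow = ≤-refl }

    child : ∀ g b i → 1 ≤ g → b < 2 → OnPath g → pick (branch g) b ≡ toℕ i → T (C i) → OnPath (2 * g + b)
    child g b i 1≤g b<2 path p≡ c = record
      { within-C = subst (All _) (sym eq) ((i , p≡ , c) ∷ OnPath.within-C path)
      ; shallow = subst (λ L → 2 * g + b < 2 ^ suc (length L)) (sym eq)
          (≤-trans (≤-reflexive (sym (+-suc (2 * g) b))) (≤-trans (+-monoʳ-≤ (2 * g) b<2)
            (≤-trans (≤-reflexive (trans (+-comm (2 * g) 2) (sym (*-suc 2 g))))
                (*-monoʳ-≤ 2 (OnPath.shallow path))))) }
      where
      j = 2 * g + b
      2≤j : 2 ≤ j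
      2≤j = ≤-trans (*-monoʳ-≤ 2 1≤g) (m≤m+n (2 * g) b)
      comm : j ≡ b + g * 2
      comm = trans (+-comm (2 * g) b) (cong (b +_) (*-comm 2 g))
      half : j / 2 ≡ g
      half = trans (/-congˡ {o = 2} (trans comm (+-comm b (g * 2))))
        (trans (+-distrib-/-∣ˡ {g * 2} b (divides g refl))
          (trans (cong₂ _+_ (m*n/n≡m g 2) (m<n⇒m/n≡0 b<2)) (+-identityʳ g)))
      odd : j % 2 ≡ b
      odd = trans (%-congˡ {o = 2} comm) (trans ([m+kn]%n≡m%n b g 2) (m<n⇒m%n≡m b<2))
      eq : branch j ≡ pick (branch g) b ∷ branch g
      eq = trans (branch-step j 2≤j) (cong₂ (λ h p → pick (branch h) p ∷ branch h) half odd)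

    descend : ∀ g → 1 ≤ g → remaining (branch g) ≢ 0 → OnPath g →
              ∃[ b ] b ≤ 1 × OnPath (2 * g + b)
    descend g 1≤g live path with first-uncovered (branch g) live
    ... | r with isCover (Uncovered.u r) (Uncovered.v r) (Uncovered.edge r)
    ... | inj₁ c = 0 , z≤n , child g 0 (Uncovered.u r) 1≤g (s≤s z≤n) path (Uncovered.u≡ r) c
    ... | inj₂ c = 1 , ≤-refl , child g 1 (Uncovered.v r) 1≤g ≤-refl path (Uncovered.v≡ r) c

    onPath-≤ : ∀ {g} → Good g → OnPath g → g < 2 * 2 ^ count C
    onPath-≤ {g} good path = ≤-trans (OnPath.shallow path)
      (*-monoʳ-≤ 2 (^-monoʳ-≤ 2 (length-≤ C (branch g) (Good.unique good) (OnPath.within-C path))))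

    -- The search trails the path into `C`: it stands at a node `j` between the path node `g` and
    -- `2 * g`. When it is about to pass `2 * g`, the node `g` is known to leave an edge uncovered,
    -- so the path continues to one of the children `2 * g` and `2 * g + 1`.
    record Progress (j : ℕ) : Set where
      field
        1≤j   : 1 ≤ j
        good  : ∀ i → 1 ≤ i → i ≤ j → Good i
        live  : ∀ i → 1 ≤ i → i < j → remaining (branch i) ≢ 0
        g     : ℕ
        1≤g   : 1 ≤ g
        g≤j   : g ≤ j
        j≤2g  : j ≤ 2 * g
        path  : OnPath g

    progress-1 : Progress 1
    progress-1 = record
      { 1≤j = ≤-refl ; good = λ { i (s≤s z≤n) (s≤s z≤n) → good-1 } ; live = λ { i (s≤s _) (s≤s ()) }
      ; g = 1 ; 1≤g = ≤-refl ; g≤j = ≤-refl ; j≤2g = s≤s z≤n ; path = onPath-1 }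

    progress-< : ∀ {j} → Progress j → j < 4 * 2 ^ count C
    progress-< {j} pr = ≤-trans (s≤s j≤2g) (≤-trans (≤-trans (m<m+n (2 * g) {2} (s≤s z≤n))
      (≤-trans (≤-reflexive (trans (+-comm (2 * g) 2) (sym (*-suc 2 g))))
          (*-monoʳ-≤ 2 (onPath-≤ (good g 1≤g g≤j) path))))
      (≤-reflexive (sym (*-assoc 2 2 (2 ^ count C)))))
      where open Progress pr

    progress-step : ∀ {j} → remaining (branch j) ≢ 0 → Progress j → Progress (suc j)
    progress-step {j} live-j pr = advance
      where
      open Progress pr
      live′ : ∀ i → 1 ≤ i → i < suc j → remaining (branch i) ≢ 0
      live′ i 1≤i i<sj with i ≟ j
      ... | yes refl = live-j
      ... | no i≢j   = live i 1≤i (≤∧≢⇒< (s≤s⁻¹ i<sj) i≢j)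
      2≤sj : 2 ≤ suc j
      2≤sj = s≤s 1≤j
      good′ : ∀ i → 1 ≤ i → i ≤ suc j → Good i
      good′ i 1≤i i≤ with i ≟ suc j
      ... | no i≢ = good i 1≤i (s≤s⁻¹ (≤∧≢⇒< i≤ i≢))
      ... | yes refl = good-step (suc j) 2≤sj (live′ (suc j / 2) (half-pos 2≤sj) (half-< 2≤sj))
              (good (suc j / 2) (half-pos 2≤sj) (s≤s⁻¹ (half-< 2≤sj)))
      advance : Progress (suc j)
      advance with ≤-<-connex (suc j) (2 * g)
      ... | inj₁ sj≤ = record { 1≤j = s≤s z≤n ; good = good′ ; live = live′ ; g = g ; 1≤g = 1≤g
                             ; g≤j = m≤n⇒m≤1+n g≤j ; j≤2g = sj≤ ; path = path }
      ... | inj₂ 2g< with descend g 1≤g (live′ g 1≤g (s≤s g≤j)) path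
      ...   | b , b≤1 , path′ = record
        { 1≤j = s≤s z≤n ; good = good′ ; live = live′ ; g = 2 * g + b
        ; 1≤g = ≤-trans 1≤g (≤-trans (m≤m+n g (g + 0)) (m≤m+n (2 * g) b))
        ; g≤j = ≤-trans (+-monoʳ-≤ (2 * g) b≤1) (≤-trans (≤-reflexive (+-comm (2 * g) 1)) 2g<)
        ; j≤2g = ≤-trans (s≤s j≤2g) (≤-trans (≤-trans (≤-reflexive (+-comm 1 (2 * g)))
            (+-monoʳ-≤ (2 * g) (≤-trans 1≤g (m≤m+n g (g + 0)))))
                (≤-trans (≤-reflexive (cong (2 * g +_) (sym (+-identityʳ (2 * g))))) (*-monoʳ-≤ 2 (m≤m+n (2 * g) b))))
        ; path = path′ }

-- Execution

opaque
  -- For exponents e up to 32 the power (16 (n + 1)) ^ e has a coefficient of at most 16 ^ 32 and a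
  -- degree of at most 32; one number serves for both. The largest exponent that occurs is `3 + τ`.
  -- It is opaque so that it is never computed with during type checking.
  c : ℕ
  c = 16 ^ 32

  16^32≤c : 16 ^ 32 ≤ c
  16^32≤c = ≤-refl

  32≤c : 32 ≤ c
  32≤c = ≤-trans (≤ᵇ⇒≤ 32 256 tt) (^-monoʳ-≤ 16 {2} {32} (s≤s (s≤s z≤n)))

^-distribʳ-* : ∀ e a b → (a * b) ^ e ≡ a ^ e * b ^ e
^-distribʳ-* zero    a b = refl
^-distribʳ-* (suc e) a b = trans (cong (a * b *_) (^-distribʳ-* e a b)) ([m*n]*[o*p]≡[m*o]*[n*p] a b (a ^ e) (b ^ e))

power-≤ : ∀ n e → e ≤ 32 → (16 * suc n) ^ e ≤ c * suc n ^ c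
power-≤ n e e≤ = begin
  (16 * suc n) ^ e      ≡⟨ ^-distribʳ-* e 16 (suc n) ⟩
  16 ^ e * suc n ^ e    ≤⟨ *-mono-≤ (≤-trans (^-monoʳ-≤ 16 e≤) 16^32≤c) (^-monoʳ-≤ (suc n) (≤-trans e≤ 32≤c)) ⟩
  c * suc n ^ c         ∎
  where open ≤-Reasoning

row-< : ∀ n {j j′} v v′ → j < j′ → v ≤ n → row n j v < row n j′ v′
row-< n {j} {j′} v v′ j<j′ v≤n = begin-strict
  n * n + (1 + n) * j + v          ≡⟨ +-assoc (n * n) ((1 + n) * j) v ⟩
  n * n + ((1 + n) * j + v)        <⟨ +-monoʳ-< (n * n) (+-monoʳ-< ((1 + n) * j) (s≤s v≤n)) ⟩
  n * n + ((1 + n) * j + (1 + n))  ≡⟨ cong (n * n +_) (trans (+-comm ((1 + n) * j) (1 + n)) (sym (*-suc (1 + n) j))) ⟩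
  n * n + (1 + n) * suc j          ≤⟨ +-monoʳ-≤ (n * n) (*-monoʳ-≤ (1 + n) j<j′) ⟩
  n * n + (1 + n) * j′             ≤⟨ m≤m+n _ v′ ⟩
  row n j′ v′                      ∎
  where open ≤-Reasoning

row-injective : ∀ n j {v v′} → row n j v ≡ row n j v′ → v ≡ v′
row-injective n j = +-cancelˡ-≡ (n * n + (1 + n) * j) _ _

n²≤row : ∀ n j v → n * n ≤ row n j v
n²≤row n j v = ≤-trans (m≤m+n (n * n) ((1 + n) * j)) (m≤m+n _ v)

leq : Degree → Degree → Bool
leq (a , b) (a′ , b′) = (a ≤ᵇ a′) ∧ (b ≤ᵇ b′)

div-< : ∀ n e → e < n * n → ⟦ div ⟧ e n < n
div-< (suc n) e e< = m<n*o⇒m/o<n e<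

mod-< : ∀ n e → e < n * n → ⟦ mod ⟧ e n < n
mod-< (suc n) e e< = m%n<n e (suc n)

module Execution {n} (B M W : ℕ) (16n≤B : 16 * suc n ≤ B) (1≤M : 1 ≤ M)
                 (B^a*M≤W : ∀ a → a ≤ A → B ^ a * M ≤ W)
                 (X : ℕ) (B^e≤X : ∀ e → e ≤ τ → B ^ e ≤ X) where

  16≤B : 16 ≤ B
  16≤B = ≤-trans (*-monoʳ-≤ 16 {1} {suc n} (s≤s z≤n)) 16n≤B

  open Triples B M A W 16≤B 1≤M B^a*M≤W Γ public

  size₁₀ : size (1 , 0) ≡ B
  size₁₀ = trans (*-identityʳ (B * 1)) (*-identityʳ B)

  size₁₁ : size (1 , 1) ≡ B * M
  size₁₁ = cong₂ _*_ (*-identityʳ B) (*-identityʳ M)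

  suc-n≤B : suc n ≤ B
  suc-n≤B = ≤-trans (m≤n*m (suc n) 16) 16n≤B

  bounded-set : ∀ {ρ} r {v} → Bounded Γ ρ → v ≤ size (lookup Γ r) → Bounded Γ (ρ [ r ]:= v)
  bounded-set {ρ} r {v} (bounded h) v≤ = bounded go
    where
    go : ∀ i → lookup (ρ [ r ]:= v) i ≤ size (lookup Γ i)
    go i with i ≟ᶠ r
    ... | yes refl = ≤-trans (≤-reflexive (lookup∘update r ρ v)) v≤
    ... | no i≢r   = ≤-trans (≤-reflexive (lookup∘update′ i≢r ρ v)) (h i)

  quick : Term 8 → Bool
  quick t = admissible A Γ t ∧ (suc (timeDegree Γ t) ≤ᵇ τ)

  quick-time : ∀ t → T (quick t) → B ^ suc (timeDegree Γ t) ≤ X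
  quick-time t ok = B^e≤X (suc (timeDegree Γ t))
    (≤ᵇ⇒≤ (suc (timeDegree Γ t)) τ (∧-snd {admissible A Γ t} {suc (timeDegree Γ t) ≤ᵇ τ} ok))

  leq-size : ∀ δ δ′ → T (leq δ δ′) → size δ ≤ size δ′
  leq-size (a , b) (a′ , b′) ok = size-mono {a} {b} {a′} {b′} (≤ᵇ⇒≤ a a′ (∧-fst ok)) (≤ᵇ⇒≤ b b′ (∧-snd {a ≤ᵇ a′} ok))

  -- The bound on the new value is an argument here, for a register such as the node number, whose
  -- degree would grow with every increment.
  assign-any : ∀ r t v {ρ μ} → Bounded Γ ρ → MemBounded μ → T (quick t) → value μ ρ t ≡ v →
    v ≤ size (lookup Γ r) →
    Runs (assign r t) X ρ μ (λ ρ′ μ′ → ρ′ ≡ ρ [ r ]:= v × μ′ ≡ μ × Bounded Γ ρ′)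
  assign-any r t v ρ≤ μ≤ ok refl v≤ = slower {T = B ^ suc (timeDegree Γ t)} {T′ = X} (quick-time t ok)
    (assign-runs r t ρ≤ μ≤ (∧-fst {admissible A Γ t} {suc (timeDegree Γ t) ≤ᵇ τ} ok)
        (refl , refl , bounded-set r ρ≤ v≤))

  assign-auto : ∀ r t v {ρ μ} → Bounded Γ ρ → MemBounded μ →
    T (quick t ∧ leq (degree Γ t) (lookup Γ r)) → value μ ρ t ≡ v →
    Runs (assign r t) X ρ μ (λ ρ′ μ′ → ρ′ ≡ ρ [ r ]:= v × μ′ ≡ μ × Bounded Γ ρ′)
  assign-auto r t v ρ≤ μ≤ ok refl = assign-any r t v ρ≤ μ≤ (∧-fst {quick t} {leq (degree Γ t) (lookup Γ r)} ok) refl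
    (≤-trans (value≤ μ≤ ρ≤ t) (leq-size (degree Γ t) (lookup Γ r)
        (∧-snd {quick t} {leq (degree Γ t) (lookup Γ r)} ok)))

  write-any : ∀ a t w v {ρ μ} → Bounded Γ ρ → MemBounded μ → T (quick a) → T (quick t) →
    value μ ρ a ≡ w → value μ ρ t ≡ v →
    Runs (write a t) X ρ μ (λ ρ′ μ′ → ρ′ ≡ ρ × μ′ ≡ μ [ w ≔ v ])
  write-any a t w v {ρ} {μ} ρ≤ μ≤ oka okt refl refl =
    slower {T = B ^ suc (timeDegree Γ a ⊔ timeDegree Γ t)} {T′ = X} time≤
      (write-runs a t {Q = λ ρ′ μ′ → ρ′ ≡ ρ × μ′ ≡ μ [ value μ ρ a ≔ value μ ρ t ]} ρ≤ μ≤
        (∧-fst {admissible A Γ a} {suc (timeDegree Γ a) ≤ᵇ τ} oka)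
        (∧-fst {admissible A Γ t} {suc (timeDegree Γ t) ≤ᵇ τ} okt) (refl , refl))
    where
    time≤ : B ^ suc (timeDegree Γ a ⊔ timeDegree Γ t) ≤ X
    time≤ with ≤-total (timeDegree Γ a) (timeDegree Γ t)
    ... | inj₁ a≤t = ≤-trans (≤-reflexive (cong (λ e → B ^ suc e) (m≤n⇒m⊔n≡n a≤t))) (quick-time t okt)
    ... | inj₂ t≤a = ≤-trans (≤-reflexive (cong (λ e → B ^ suc e) (m≥n⇒m⊔n≡m t≤a))) (quick-time a oka)

  membounded-set : ∀ {μ a v} → MemBounded μ → v ≤ size (1 , 1) → MemBounded (μ [ a ≔ v ])
  membounded-set {μ} {a} {v} μ≤ v≤ b with b ≡ᵇ a
  ... | true  = v≤
  ... | false = μ≤ b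

  module Fill (f K j e p w : ℕ) (μ₀ : ℕ → ℕ) (2≤j : 2 ≤ j) where

    cell : ℕ → ℕ
    cell v = choose (bit (v ≡ᵇ p)) 1 (4 * μ₀ (row n (j / 2) v))

    record Inv (x : ℕ) (ρ : Vec ℕ 8) (μ : ℕ → ℕ) : Set where
      constructor inv
      field
        form   : ρ ≡ n ∷ f ∷ K ∷ j ∷ e ∷ p ∷ x ∷ w ∷ []
        ρ≤     : Bounded Γ ρ
        μ≤     : MemBounded μ
        x≤     : x ≤ suc n
        filled : ∀ v → x ≤ v → v ≤ n → μ (row n j v) ≡ cell v
        same   : ∀ a → a < row n j x ⊎ row n (suc j) 0 ≤ a → μ a ≡ μ₀ a

    module _ (cell≤ : ∀ v → v ≤ n → cell v ≤ size (1 , 1)) where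

      fillRow-runs : ∀ x ρ μ → Inv x ρ μ → lookup ρ 6F ≢ 0 →
                     ∃[ x′ ] x ≡ suc x′ × Runs fillRow (X + X) ρ μ (Inv x′)
      fillRow-runs zero    ρ μ (inv refl _ _ _ _ _) x≢0 = contradiction refl x≢0
      fillRow-runs (suc x) ρ μ (inv refl ρ≤ μ≤ x≤ filled same) _ = x , refl ,
        sequence (assign-auto 6F decᵗ x ρ≤ μ≤ tt refl) λ { _ _ (refl , refl , ρ≤′) → finish ρ≤′ }
        where
        x≤n : x ≤ n
        x≤n = s≤s⁻¹ x≤
        -- The parent's row has a smaller number, so filling row `j` has not touched it.
        stored : value μ (n ∷ f ∷ K ∷ j ∷ e ∷ p ∷ x ∷ w ∷ []) cellᵗ ≡ cell x
        stored = cong (λ y → choose (bit (x ≡ᵇ p)) 1 (4 * y))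
          (same (row n (j / 2) x) (inj₁ (row-< n x (suc x) (half-< 2≤j) x≤n)))
          where
          half-< : ∀ {j} → 2 ≤ j → j / 2 < j
          half-< {suc j} h = m/n<m (suc j) 2 (s≤s (s≤s z≤n))
        finish : Bounded Γ (n ∷ f ∷ K ∷ j ∷ e ∷ p ∷ x ∷ w ∷ []) → Runs (write cellAddressᵗ cellᵗ) X
            (n ∷ f ∷ K ∷ j ∷ e ∷ p ∷ x ∷ w ∷ []) μ (Inv x)
        finish ρ≤′ = weaken (λ { (refl , refl) →
            inv refl ρ≤′ (membounded-set μ≤ (cell≤ x x≤n)) (m≤n⇒m≤1+n x≤n) filled′ same′ })
          (write-any cellAddressᵗ cellᵗ (row n j x) (cell x) ρ≤′ μ≤ tt tt refl stored)
          where
          filled′ : ∀ v → x ≤ v → v ≤ n → (μ [ row n j x ≔ cell x ]) (row n j v) ≡ cell v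
          filled′ v x≤v v≤n with v ≟ x
          ... | yes refl = update-same μ (row n j x) (cell x)
          ... | no v≢x   = trans (update-other μ (cell x) (λ eq → v≢x (row-injective n j eq)))
                             (filled v (≤∧≢⇒< x≤v (v≢x ∘ sym)) v≤n)
          same′ : ∀ a → a < row n j x ⊎ row n (suc j) 0 ≤ a → (μ [ row n j x ≔ cell x ]) a ≡ μ₀ a
          same′ a (inj₁ a<) = trans (update-other μ (cell x) (<⇒≢ a<))
            (same a (inj₁ (≤-trans a< (+-monoʳ-≤ (n * n + (1 + n) * j) (n≤1+n x)))))
          same′ a (inj₂ ≤a) = trans (update-other μ (cell x)
              (λ eq → <⇒≢ (≤-trans (row-< n x 0 ≤-refl x≤n) ≤a) (sym eq)))
            (same a (inj₂ ≤a))

      at-zero : ∀ {x x′ ρ μ} → x ≡ x′ → Inv x ρ μ → Inv x′ ρ μ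
      at-zero refl i = i

      fill-runs : ∀ x ρ μ → Inv x ρ μ → Runs (while (reg 6) fillRow) (x * (2 + (X + X)) + 2) ρ μ (Inv 0)
      fill-runs x ρ μ i = weaken (λ { (z , _ , i′@(inv refl _ _ _ _ _)) → at-zero z i′ })
        (while-runs 6F Inv fillRow-runs x i)

-- Running the search for a cover

module Growth {n} (G : Graph n) (m : ℕ → ℕ) (entries : ∀ u v → m (n * toℕ u + toℕ v) ≡ bit (Graph.adj G u v))
              (C : Fin n → Bool) (isCover : ∀ u v → Graph.Edge G u v → T (C u) ⊎ T (C v))
              (B M W : ℕ) (16n≤B : 16 * suc n ≤ B) (1≤M : 1 ≤ M)
              (B^a*M≤W : ∀ a → a ≤ A → B ^ a * M ≤ W)
              (X : ℕ) (B^e≤X : ∀ e → e ≤ τ → B ^ e ≤ X)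
              (4^#C≤M : 4 ^ count C ≤ M) (f K : ℕ) where

  open Execution {n} B M W 16n≤B 1≤M B^a*M≤W X B^e≤X public
  open Search G m entries public
  open Descent C isCover public

  HasRow : (ℕ → ℕ) → ℕ → Set
  HasRow μ i = (∀ v → v < n → μ (row n i v) ≡ weight (branch i) v) × μ (row n i n) ≡ 4 ^ length (branch i)

  -- The table begins at the first row after the last node, wherever the search happens to stop;
  -- `zeros` is what makes it empty at that moment.
  record Stored (j : ℕ) (μ : ℕ → ℕ) : Set where
    field
      μ≤    : MemBounded μ
      graph : ∀ a → a < n * n → μ a ≡ m a
      rows  : ∀ i → 1 ≤ i → i ≤ j → HasRow μ i
      zeros : ∀ a → row n (suc j) 0 ≤ a → μ a ≡ 0

  uncovered-value : ∀ {j μ} → Stored j μ → ∀ i → 1 ≤ i → i ≤ j → ∀ e → e < n * n →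
    choose (μ e) (choose (μ (row n i (⟦ div ⟧ e n))) 0 (choose (μ (row n i (⟦ mod ⟧ e n))) 0 1)) 0
      ≡ uncovered (weight (branch i)) e
  uncovered-value st i 1≤i i≤j e e<
    rewrite Stored.graph st e e<
          | proj₁ (Stored.rows st i 1≤i i≤j) (⟦ div ⟧ e n) (div-< n e e<)
          | proj₁ (Stored.rows st i 1≤i i≤j) (⟦ mod ⟧ e n) (mod-< n e e<) = refl

  remaining-value : ∀ {j μ f K e p x w} → Stored j μ → 1 ≤ j →
    value μ (n ∷ f ∷ K ∷ j ∷ e ∷ p ∷ x ∷ w ∷ []) remainingᵗ ≡ remaining (branch j)
  remaining-value {j} st 1≤j = sumN-cong (n * n) (uncovered-value st j 1≤j ≤-refl)

  pick-value : ∀ {i j μ f K e p x w} → Stored i μ → 1 ≤ j / 2 → j / 2 ≤ i →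
    value μ (n ∷ f ∷ K ∷ j ∷ e ∷ p ∷ x ∷ w ∷ []) pickᵗ ≡ pick (branch (j / 2)) (j % 2)
  pick-value {i} {j} {μ} st 1≤ ≤i = cong (λ F → choose (j % 2) (⟦ mod ⟧ F n) (⟦ div ⟧ F n))
    (sumN-cong (n * n) λ e e< → cong (λ s → bit (s ≡ᵇ 0))
      (sumN-cong (suc e) λ e′ e′< → uncovered-value st (j / 2) 1≤ ≤i e′ (≤-trans e′< e<)))

  record Tree (k : ℕ) (ρ : Vec ℕ 8) (μ : ℕ → ℕ) : Set where
    constructor tree-state
    field
      {j p x w} : ℕ
      form     : ρ ≡ n ∷ f ∷ K ∷ j ∷ remaining (branch j) ∷ p ∷ x ∷ w ∷ []
      ρ≤       : Bounded Γ ρ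
      stored   : Stored j μ
      progress : Progress j
      fuel     : k + j ≡ 4 * 2 ^ count C

  nodes-≤ : 4 * 2 ^ count C ≤ B * M
  nodes-≤ = *-mono-≤ (≤-trans (s≤s (s≤s (s≤s (s≤s z≤n)))) 16≤B)
      (≤-trans (^-monoˡ-≤ (count C) {2} {4} (s≤s (s≤s z≤n))) 4^#C≤M)

  square-≤ : ∀ {j} → j ≤ 4 * 2 ^ count C → j * j ≤ 16 * M
  square-≤ {j} j≤ = begin
    j * j                                     ≤⟨ *-mono-≤ j≤ j≤ ⟩
    4 * 2 ^ count C * (4 * 2 ^ count C)             ≡⟨ [m*n]*[o*p]≡[m*o]*[n*p] 4 (2 ^ count C) 4 (2 ^ count C) ⟩
    16 * (2 ^ count C * 2 ^ count C)                ≡⟨ cong (16 *_) (^-distribʳ-* (count C) 2 2) ⟨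
    16 * 4 ^ count C                             ≤⟨ *-monoʳ-≤ 16 4^#C≤M ⟩
    16 * M                                    ∎
    where open ≤-Reasoning

  weights-bound : ∀ {j} → Good j → j ≤ 4 * 2 ^ count C → 4 ^ length (branch j) ≤ 16 * M
  weights-bound {j} good j≤ = ≤-trans (weights-≤ j good) (square-≤ j≤)

  16M≤ : 16 * M ≤ size (1 , 1)
  16M≤ = ≤-trans (*-monoˡ-≤ M 16≤B) (≤-reflexive (sym size₁₁))

  progress-≤ : ∀ {j} → Progress j → j < 4 * 2 ^ count C
  progress-≤ pr = progress-< pr

  growTime : ℕ
  growTime = X + (X + (X + ((suc n * (2 + (X + X)) + 2) + X)))

  grow-runs : ∀ k ρ μ → Tree k ρ μ → lookup ρ 4F ≢ 0 → ∃[ k′ ] k ≡ suc k′ × Runs grow growTime ρ μ (Tree k′)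
  grow-runs zero ρ μ (tree-state refl _ _ pr fuel) _ = contradiction (progress-≤ pr) (≤⇒≯ (≤-reflexive (sym fuel)))
  grow-runs (suc k) ρ μ (tree-state {j} {p} {x₀} {w} refl ρ≤ st pr fuel) live = k , refl ,
    -- The bound on the node number comes from the fuel, not from the degree of the term.
    sequence (assign-any 3F nextᵗ (suc j) ρ≤ μ≤ tt refl sj≤)
    λ { _ _ (refl , refl , ρ₁≤) →
    sequence (assign-auto 5F pickᵗ p′ ρ₁≤ μ≤ tt (pick-value {j = suc j} {f = f} {K} {remaining (branch j)} {p}
        {x₀} {w} st 1≤h h≤j))
    λ { _ _ (refl , refl , ρ₂≤) →
    sequence (assign-auto 6F widthᵗ (suc n) ρ₂≤ μ≤ tt refl)
    λ { _ _ (refl , refl , ρ₃≤) →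
    sequence (fill-runs cell≤ (suc n) _ μ (inv refl ρ₃≤ μ≤ ≤-refl (λ v n<v v≤n → contradiction v≤n (<⇒≱ n<v))
        (λ _ _ → refl)))
    λ { _ μ′ (inv refl ρ₄≤ μ′≤ _ filled same) →
      last μ′ ρ₄≤ μ′≤ (rows-after μ′ μ′≤ (λ v → filled v z≤n)
        (λ a a< → same a (inj₁ (≤-trans a< (≤-reflexive (sym (+-identityʳ _)))))) (λ a ≤a → same a (inj₂ ≤a))) } } } }
    where
    open Stored st
    open Progress pr using (1≤j)
    h = suc j / 2
    2≤sj : 2 ≤ suc j
    2≤sj = s≤s 1≤j
    1≤h : 1 ≤ h
    1≤h = half-pos 2≤sj
    h≤j : h ≤ j
    h≤j = s≤s⁻¹ (half-< 2≤sj)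
    p′ = pick (branch h) (suc j % 2)
    e = remaining (branch j)
    open Fill f K (suc j) e p′ w μ 2≤sj
    pr′ : Progress (suc j)
    pr′ = progress-step live pr
    good′ : Good (suc j)
    good′ = Progress.good pr′ (suc j) (s≤s z≤n) ≤-refl
    sj≤nodes : suc j ≤ 4 * 2 ^ count C
    sj≤nodes = ≤-trans (s≤s (m≤n+m j k)) (≤-reflexive fuel)
    sj≤ : suc j ≤ size (1 , 1)
    sj≤ = ≤-trans sj≤nodes (≤-trans nodes-≤ (≤-reflexive (sym size₁₁)))
    step≡ : branch (suc j) ≡ p′ ∷ branch h
    step≡ = branch-step (suc j) 2≤sj
    -- In particular cell `n` is never overwritten as if it belonged to the branching vertex.
    p′<n : p′ < n
    p′<n with subst (All (_< n)) step≡ (Good.below good′)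
    ... | p< ∷ _ = p<
    cell-weight : ∀ v → v < n → cell v ≡ weight (branch (suc j)) v
    cell-weight v v<n = trans (cong (λ y → choose (bit (v ≡ᵇ p′)) 1 (4 * y)) (proj₁ (rows h 1≤h h≤j) v v<n))
      (cong (λ L → weight L v) (sym step≡))
    cell-last : cell n ≡ 4 ^ length (branch (suc j))
    cell-last rewrite ≢⇒≡ᵇ-false {n} {p′} (λ eq → <⇒≢ p′<n (sym eq)) = trans (cong (4 *_) (proj₂ (rows h 1≤h h≤j)))
      (cong (λ L → 4 ^ length L) (sym step≡))
    cell≤ : ∀ v → v ≤ n → cell v ≤ size (1 , 1)
    cell≤ v v≤n with v ≟ n
    ... | yes refl = ≤-trans (≤-reflexive cell-last) (≤-trans (weights-bound good′ sj≤nodes) 16M≤)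
    ... | no v≢n = ≤-trans (≤-reflexive (cell-weight v (≤∧≢⇒< v≤n v≢n)))
                     (≤-trans (weight-≤ (branch (suc j)) v) (≤-trans (weights-bound good′ sj≤nodes) 16M≤))
    rows-after : ∀ μ′ → MemBounded μ′ →
           (∀ v → v ≤ n → μ′ (row n (suc j) v) ≡ cell v) →
           (∀ a → a < n * n + (1 + n) * suc j → μ′ a ≡ μ a) →
           (∀ a → row n (suc (suc j)) 0 ≤ a → μ′ a ≡ μ a) → Stored (suc j) μ′
    rows-after μ′ μ′≤ filled before after = record
        { μ≤ = μ′≤
        ; graph = λ a a< → trans (before a (≤-trans a< (m≤m+n (n * n) _))) (graph a a<)
        ; rows = rows′
        ; zeros = λ a ≤a → trans (after a ≤a) (zeros a (≤-trans
            (+-monoˡ-≤ 0 (+-monoʳ-≤ (n * n) (*-monoʳ-≤ (1 + n) (n≤1+n (suc j))))) ≤a))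
        }
      where
      row-before : ∀ i v → i ≤ j → v ≤ n → row n i v < n * n + (1 + n) * suc j
      row-before i v i≤j v≤n = ≤-trans (row-< n v 0 (s≤s i≤j) v≤n) (≤-reflexive (+-identityʳ _))
      rows′ : ∀ i → 1 ≤ i → i ≤ suc j → HasRow μ′ i
      rows′ i 1≤i i≤ with i ≟ suc j
      ... | yes refl = (λ v v<n → trans (filled v (<⇒≤ v<n)) (cell-weight v v<n)) , trans (filled n ≤-refl) cell-last
      ... | no i≢ = (λ v v<n → trans (before _ (row-before i v i≤j (<⇒≤ v<n))) (proj₁ (rows i 1≤i i≤j) v v<n)) ,
                    trans (before _ (row-before i n i≤j ≤-refl)) (proj₂ (rows i 1≤i i≤j))
        where
        i≤j : i ≤ j
        i≤j = s≤s⁻¹ (≤∧≢⇒< i≤ i≢)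
    last : ∀ μ′ → Bounded Γ (n ∷ f ∷ K ∷ suc j ∷ e ∷ p′ ∷ 0 ∷ w ∷ []) → MemBounded μ′ →
           Stored (suc j) μ′ →
           Runs (assign 4F remainingᵗ) X (n ∷ f ∷ K ∷ suc j ∷ e ∷ p′ ∷ 0 ∷ w ∷ []) μ′ (Tree k)
    last μ′ ρ≤′ μ′≤ stored′ = weaken (λ { (refl , refl , ρ≤″) → tree-state refl ρ≤″ stored′ pr′
        (trans (+-suc k j) fuel) })
      (assign-any 4F remainingᵗ (remaining (branch (suc j))) ρ≤′ μ′≤ tt value≡
        (subst (_≤ size (3 , 0)) value≡ (value≤ μ′≤ ρ≤′ remainingᵗ)))
      where
      value≡ = remaining-value {f = f} {K} {e} {p′} {0} {w} stored′ (s≤s z≤n)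

  search-runs : ∀ k ρ μ → Tree k ρ μ →
    Runs (while (reg 4) grow) (k * (2 + growTime) + 2) ρ μ (λ ρ′ μ′ → lookup ρ′ 4F ≡ 0 × ∃[ k′ ] Tree k′ ρ′ μ′)
  search-runs k ρ μ t = while-runs 4F Tree grow-runs k t

sumN-shift : ∀ N f → sumN (suc N) f ≡ f 0 + sumN N (f ∘ suc)
sumN-shift zero    f = refl
sumN-shift (suc N) f = trans (cong (f (suc N) +_) (sumN-shift N f))
  (trans (sym (+-assoc (f (suc N)) (f 0) _)) (trans (cong (_+ sumN N (f ∘ suc)) (+-comm (f (suc N)) (f 0)))
      (+-assoc (f 0) _ _)))

sumN-sumF : ∀ {n} f → sumN n f ≡ sumF {n} (f ∘ toℕ)
sumN-sumF {zero}  f = refl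
sumN-sumF {suc n} f = trans (sumN-shift n f) (cong (f 0 +_) (sumN-sumF {n} (f ∘ suc)))

sumN-count : ∀ {n f} (p : Fin n → Bool) → (∀ v → f (toℕ v) ≡ bit (p v)) → sumN n f ≡ count p
sumN-count {n} {f} p h = trans (sumN-sumF {n} f) (sumF-cong h)

bit-any : ∀ {n} (p : Fin n → Bool) → bit (0 <ᵇ count p) ≡ bit (anyF p)
bit-any {zero}  p = refl
bit-any {suc n} p with p zero
... | true  = refl
... | false = bit-any (p ∘ suc)

choose-and : ∀ a b → choose (bit a) (bit b) 0 ≡ bit (a ∧ b)
choose-and true  b = refl
choose-and false b = refl

choose-nor : ∀ a b → choose (bit a) 0 (bit b) ≡ bit (not a ∧ b)
choose-nor true  b = refl
choose-nor false b = refl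

choose-not : ∀ a → choose (bit a) 0 1 ≡ bit (not a)
choose-not true  = refl
choose-not false = refl

choose-keep : ∀ a {f} → f ≢ 0 → choose a 1 f ≢ 0
choose-keep zero    h = h
choose-keep (suc _) h = 1+n≢0

choose-either : ∀ a {f} → choose a 1 f ≢ 0 → a ≢ 0 ⊎ f ≢ 0
choose-either zero    h = inj₂ h
choose-either (suc _) h = inj₁ 1+n≢0

count-all : ∀ {n} {p : Fin n → Bool} → (∀ i → T (p i)) → n ≤ count p
count-all {zero}      h = z≤n
count-all {suc n} {p} h with p zero in eq
... | true  = s≤s (count-all (h ∘ suc))
... | false with () ← subst T eq (h zero)

-- Running the dynamic program

module Relaxation {n} (G : Graph n) (B M W : ℕ) (16n≤B : 16 * suc n ≤ B) (1≤M : 1 ≤ M)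
                  (B^a*M≤W : ∀ a → a ≤ A → B ^ a * M ≤ W)
                  (X : ℕ) (B^e≤X : ∀ e → e ≤ τ → B ^ e ≤ X)
                  (L : List ℕ) (uniq : Unique L) (small : All (_< n) L)
                  (cover : ∀ u v → Graph.Edge G u v → weight L (toℕ u) ≢ 0 ⊎ weight L (toℕ v) ≢ 0)
                  (K J e p : ℕ) where

  open Execution {n} B M W 16n≤B 1≤M B^a*M≤W X B^e≤X public
  open Table G L uniq small cover K public
  open Colouring G
  open Parameters G

  N : ℕ
  N = suc n * 4 ^ length L

  table : (ℕ → ℕ) → ℕ → ℕ
  table μ q = μ (row n (suc J) q)

  record Ready (μ : ℕ → ℕ) : Set where
    field
      graph  : ∀ u v → μ (n * toℕ u + toℕ v) ≡ bit (adj u v)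
      weights : ∀ v → v < n → μ (row n J v) ≡ weight L v
      top    : μ (row n J n) ≡ 4 ^ length L

  module Values {μ} (ready : Ready μ) (f q : ℕ) where
    open Ready ready

    κ : Colours
    κ = colours q

    ρ⟨_⟩ : ℕ → Vec ℕ 8
    ρ⟨ w ⟩ = n ∷ f ∷ K ∷ J ∷ e ∷ p ∷ q ∷ w ∷ []

    colour-value : ∀ v → v < n →
      choose (μ (row n J v)) (⟦ mod ⟧ (⟦ div ⟧ q (μ (row n J v))) 4) 4 ≡ colour L q v
    colour-value v v<n = cong (λ y → choose y (⟦ mod ⟧ (⟦ div ⟧ q y) 4) 4) (weights v v<n)

    current-value : ∀ w → value μ ρ⟨ w ⟩ currentᵗ ≡ current L n q
    current-value w = sumN-cong n λ v v<n →
      cong₂ (λ y z → choose (bit (y ≡ᵇ 2)) z 0) (colour-value v v<n) (weights v v<n)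

    module _ (w : ℕ) where

      is-value : ∀ c v → value μ (toℕ v ∷ ρ⟨ w ⟩) (isᵗ 1 c (var 0F)) ≡ bit (is κ c v)
      is-value c v = cong (λ y → bit (y ≡ᵇ c)) (colour-value (toℕ v) (toℕ<n v))

      nb-value : ∀ c v → value μ (toℕ v ∷ ρ⟨ w ⟩) (nbᵗ c) ≡ bit (nb κ c v)
      nb-value c v = trans (cong (λ s → bit (0 <ᵇ s))
          (sumN-count (λ u → adj v u ∧ is κ c u) λ u →
            trans (cong₂ (λ a y → choose a (bit (y ≡ᵇ c)) 0) (graph v u) (colour-value (toℕ u) (toℕ<n u)))
              (choose-and (adj v u) (is κ c u))))
        (bit-any (λ u → adj v u ∧ is κ c u))

      fresh-value : ∀ v → value μ (toℕ v ∷ ρ⟨ w ⟩) freshᵗ ≡ bit (fresh κ v)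
      fresh-value v = trans (cong₂ (λ a b → choose a b 0) (is-value 4 v)
          (trans (cong₂ (λ a b → choose a 0 b) (nb-value 1 v) (nb-value 2 v)) (choose-nor (nb κ 1 v) (nb κ 2 v))))
        (choose-and (is κ 4 v) _)

      split-value : ∀ v → value μ (toℕ v ∷ ρ⟨ w ⟩) splitᵗ ≡ bit (split κ v)
      split-value v = trans (cong₂ (λ a b → choose a b 0) (fresh-value v) (nb-value 3 v)) (choose-and (fresh κ v) _)

      exclusive-value : ∀ v → value μ (toℕ v ∷ ρ⟨ w ⟩) exclusiveᵗ ≡ bit (exclusive κ v)
      exclusive-value v = trans (cong₂ (λ a b → choose a b 0) (fresh-value v)
          (trans (cong (λ a → choose a 0 1) (nb-value 3 v)) (choose-not (nb κ 3 v))))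
        (choose-and (fresh κ v) _)

      conflict-value : ∀ v → value μ (toℕ v ∷ ρ⟨ w ⟩) conflictᵗ ≡ bit (conflict κ v)
      conflict-value v = trans (cong₂ (λ a b → choose a b 0) (is-value 2 v) (nb-value 3 v)) (choose-and (is κ 2 v) _)

      count-is : ∀ c → value μ ρ⟨ w ⟩ (countᵗ (isᵗ 1 c (var 0F))) ≡ count (is κ c)
      count-is c = sumN-count (is κ c) (is-value c)

      level-value : value μ ρ⟨ w ⟩ levelᵗ ≡ level L q
      level-value = cong (⟦ div ⟧ q) top

      price-value : value μ ρ⟨ w ⟩ priceᵗ ≡ price (level L q) κ
      price-value = cong₂ _+_ (sumN-count (split κ) split-value)
        (cong₂ _∸_ (cong₂ _+_ (count-is 2) (sumN-count (exclusive κ) exclusive-value)) level-value)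

      feasible-value : value μ ρ⟨ w ⟩ feasibleᵗ ≡ bit (feasible (level L q) κ)
      feasible-value = trans (cong₂ (λ a b → choose (bit (a ≡ᵇ 0)) b 0) (sumN-count (conflict κ) conflict-value)
          (trans (cong₂ (λ a b → choose (bit (a <ᵇ b)) 0 1) level-value (count-is 2)) (choose-not _)))
        (choose-and (count (conflict κ) ≡ᵇ 0) _)

    val-value : value μ ρ⟨ current L n q ⟩ valᵗ ≡ val (table μ) q
    val-value = cong₂ (λ a b → choose a (table μ (q + current L n q)) b)
      (trans (cong (λ s → bit (0 <ᵇ s)) (count-is w 1)) (bit-any (is κ 1)))
      (cong₂ (λ a b → K ∸ a ∸ b) (level-value w) (count-is w 0))
      where w = current L n q

    step-value : value μ ρ⟨ current L n q ⟩ stepᵗ ≡ step (table μ) q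
    step-value = cong₂ (λ a b → choose a b 0) (feasible-value w) (cong₂ _∸_ val-value (price-value w))
      where w = current L n q

    final-value : value μ ρ⟨ current L n q ⟩ finalᵗ ≡
      choose (val (table μ) q) (choose (level L q) (choose (count (is κ 2)) 0 (choose (count (is κ 3)) 0 1)) 0) 0
    final-value = cong₂ (λ a b → choose a b 0) val-value (cong₂ (λ a b → choose a b 0) (level-value w)
      (cong₂ (λ a b → choose a 0 (choose b 0 1)) (count-is w 2) (count-is w 3)))
      where w = current L n q

    final-sound : value μ ρ⟨ current L n q ⟩ finalᵗ ≢ 0 → Final q × 0 < val (table μ) q
    final-sound h = go (val (table μ) q) (level L q) _ _ refl refl refl refl (h ∘ trans final-value)
      where
      go : ∀ a b c d → a ≡ val (table μ) q → b ≡ level L q → c ≡ count (is κ 2) → d ≡ count (is κ 3) →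
           choose a (choose b (choose c 0 (choose d 0 1)) 0) 0 ≢ 0 → Final q × 0 < val (table μ) q
      go zero    _       _       _       _  _  _  _  h = contradiction refl h
      go (suc a) zero    _       _       _  _  _  _  h = contradiction refl h
      go (suc a) (suc b) (suc c) _       _  _  _  _  h = contradiction refl h
      go (suc a) (suc b) zero    (suc d) _  _  _  _  h = contradiction refl h
      go (suc a) (suc b) zero    zero    va le #2≡ #3≡ h =
        (≤-trans (s≤s z≤n) (≤-reflexive le) ,
         (λ v eq → contradiction (count-some {p = is κ 2} v (≡ᵇ-true eq)) (≤⇒≯ (≤-reflexive (sym #2≡)))) ,
         (λ v eq → contradiction (count-some {p = is κ 3} v (≡ᵇ-true eq)) (≤⇒≯ (≤-reflexive (sym #3≡))))) ,
        ≤-trans (s≤s z≤n) (≤-reflexive va)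

    final-complete : Final q → 0 < val (table μ) q → value μ ρ⟨ current L n q ⟩ finalᵗ ≡ 1
    final-complete (1≤ℓ , no2 , no3) pos = trans final-value (go _ _ pos 1≤ℓ
        (count-none {p = is κ 2} λ v t → no2 v (≡ᵇ-eq (κ v) t))
            (count-none {p = is κ 3} λ v t → no3 v (≡ᵇ-eq (κ v) t)))
      where
      go : ∀ a b {c d} → 0 < a → 1 ≤ b → c ≡ 0 → d ≡ 0 → choose a (choose b (choose c 0 (choose d 0 1)) 0) 0 ≡ 1
      go (suc a) (suc b) _ _ refl refl = refl

  val-cong : ∀ {τ₁ τ₂} q → τ₁ (q + current L n q) ≡ τ₂ (q + current L n q) → val τ₁ q ≡ val τ₂ q
  val-cong q eq = cong (λ y → choose (bit (anyF (is (colours q) 1))) y (K ∸ level L q ∸ count (is (colours q) 0))) eq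

  step-cong : ∀ {τ₁ τ₂} q → τ₁ (q + current L n q) ≡ τ₂ (q + current L n q) → step τ₁ q ≡ step τ₂ q
  step-cong {τ₁} {τ₂} q eq = cong (λ y → choose (bit (feasible (level L q) (colours q)))
      (y ∸ price (level L q) (colours q)) 0)
    (val-cong {τ₁} {τ₂} q eq)

  step-≤ : ∀ {τ b} q → (∀ a → τ a ≤ b) → K ≤ b → step τ q ≤ b
  step-≤ {τ} {b} q τ≤ K≤ = choose-≤ (bit (feasible (level L q) (colours q)))
    (≤-trans (m∸n≤m _ (price (level L q) (colours q)))
      (choose-≤ (bit (anyF (is (colours q) 1))) (τ≤ _)
        (≤-trans (m∸n≤m _ (count (is (colours q) 0))) (≤-trans (m∸n≤m K (level L q)) K≤))))
    z≤n

  -- The codes from `q` on have been treated. What is claimed of them persists, because later writes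
  -- go to targets below `q`, whereas the treated codes read their sources, which are at least `q`.
  record Relaxed (q : ℕ) (ρ : Vec ℕ 8) (μ : ℕ → ℕ) : Set where
    constructor relaxed
    field
      {f w}    : ℕ
      form     : ρ ≡ n ∷ f ∷ K ∷ J ∷ e ∷ p ∷ q ∷ w ∷ []
      ρ≤       : Bounded Γ ρ
      μ≤       : MemBounded μ
      ready    : Ready μ
      sound    : Sound (table μ)
      closed   : ∀ q′ → q ≤ q′ → q′ < N → current L n q′ ≢ 0 → step (table μ) q′ ≤ table μ (q′ ∸ current L n q′)
      f≤1      : f ≤ 1
      correct  : f ≢ 0 → vi G < K
      trivial  : n < K → f ≢ 0
      detected : ∀ q′ → q ≤ q′ → q′ < N → Final q′ → 0 < val (table μ) q′ → f ≢ 0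

  relax-runs : ∀ k ρ μ → Relaxed k ρ μ → lookup ρ 6F ≢ 0 →
               ∃[ k′ ] k ≡ suc k′ × Runs relax (X + (X + (X + X))) ρ μ (Relaxed k′)
  relax-runs zero ρ μ (relaxed refl _ _ _ _ _ _ _ _ _) 0≢0 = contradiction refl 0≢0
  relax-runs (suc q) ρ μ (relaxed {f} {w} refl ρ≤ μ≤ ready sound closed f≤1 correct trivial detected) _ = q , refl ,
    sequence (assign-auto 6F decᵗ q ρ≤ μ≤ tt refl)
    λ { _ _ (refl , refl , ρ₁≤) →
    sequence (assign-auto 7F currentᵗ cur ρ₁≤ μ≤ tt (current-value w))
    λ { _ _ (refl , refl , ρ₂≤) →
    sequence (write-any targetᵗ updateᵗ target new ρ₂≤ μ≤ tt tt refl (cong (λ s → old + (s ∸ old)) step-value))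
    λ { _ _ (refl , refl) →
    weaken (λ { (refl , refl , ρ₃≤) → relaxed refl ρ₃≤ μ′≤ ready′ sound′ closed′
        (choose-≤ fin ≤-refl f≤1) correct′ (λ h → keep (trivial h)) detected′ })
      (assign-auto 1F foundᵗ (choose fin 1 f) ρ₂≤ μ′≤ tt refl) } } }
    where
    open Values ready f q
    cur = current L n q
    target = row n (suc J) (q ∸ cur)
    old = table μ (q ∸ cur)
    new = old + (step (table μ) q ∸ old)
    μ′ = μ [ target ≔ new ]

    step≤new : step (table μ) q ≤ new
    step≤new = m≤n+m∸n (step (table μ) q) old

    new-either : new ≡ old ⊎ new ≡ step (table μ) q
    new-either with ≤-total (step (table μ) q) old
    ... | inj₁ s≤o = inj₁ (trans (cong (old +_) (m≤n⇒m∸n≡0 s≤o)) (+-identityʳ old))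
    ... | inj₂ o≤s = inj₂ (m+[n∸m]≡n o≤s)

    new≤ : new ≤ size (1 , 1)
    new≤ with new-either
    ... | inj₁ eq = ≤-trans (≤-reflexive eq) (μ≤ target)
    ... | inj₂ eq = ≤-trans (≤-reflexive eq) (step-≤ {table μ} q (λ a → μ≤ _)
                      (≤-trans (within ρ≤ 2F) (size-mono {1} {0} {1} {1} ≤-refl z≤n)))

    μ′≤ : MemBounded μ′
    μ′≤ = membounded-set μ≤ new≤

    at-target : table μ′ (q ∸ cur) ≡ new
    at-target = update-same μ target new

    elsewhere : ∀ q′ → q′ ≢ q ∸ cur → table μ′ q′ ≡ table μ q′
    elsewhere q′ ne = update-other μ new λ eq → ne (row-injective n (suc J) eq)

    grows : ∀ q′ → table μ q′ ≤ table μ′ q′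
    grows q′ with q′ ≟ q ∸ cur
    ... | yes refl = ≤-trans (m≤m+n old _) (≤-reflexive (sym at-target))
    ... | no ne    = ≤-reflexive (sym (elsewhere q′ ne))

    later : ∀ q′ → q < q′ → table μ′ (q′ + current L n q′) ≡ table μ (q′ + current L n q′)
    later q′ q<q′ = elsewhere _ λ eq → <⇒≢ (≤-<-trans (m∸n≤m q cur) (<-≤-trans q<q′ (m≤m+n q′ _))) (sym eq)

    below : ∀ {a} → a < row n (suc J) 0 → μ′ a ≡ μ a
    below a< = update-other μ new (<⇒≢ (<-≤-trans a< (+-monoʳ-≤ (n * n + (1 + n) * suc J) z≤n)))

    ready′ : Ready μ′
    ready′ = record
      { graph = λ u v → trans (below (<-≤-trans (index-< u v) (n²≤row n (suc J) 0))) (Ready.graph ready u v)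
      ; weights = λ v v<n → trans (below (row-< n v 0 ≤-refl (<⇒≤ v<n))) (Ready.weights ready v v<n)
      ; top = trans (below (row-< n n 0 ≤-refl ≤-refl)) (Ready.top ready)
      }

    sound′ : Sound (table μ′)
    sound′ q′ pos with q′ ≟ q ∸ cur
    ... | no ne = subst (Partial K (level L q′) (colours q′)) (sym (elsewhere q′ ne))
                    (sound q′ (≤-trans pos (≤-reflexive (elsewhere q′ ne))))
    ... | yes refl with new-either
    ...   | inj₁ eq = subst (Partial K (level L (q ∸ cur)) (colours (q ∸ cur))) (sym (trans at-target eq))
                        (sound (q ∸ cur) (≤-trans pos (≤-reflexive (trans at-target eq))))
    ...   | inj₂ eq = subst (Partial K (level L (q ∸ cur)) (colours (q ∸ cur))) (sym (trans at-target eq))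
                        (sound-step sound q (≤-trans pos (≤-reflexive (trans at-target eq))))

    closed′ : ∀ q′ → q ≤ q′ → q′ < N → current L n q′ ≢ 0 → step (table μ′) q′ ≤ table μ′ (q′ ∸ current L n q′)
    closed′ q′ q≤q′ q′<N cur≢0 with q ≟ q′
    -- For a nonempty part the target lies strictly below the source, so the write does not change
    -- the value it was computed from.
    ... | yes refl = ≤-trans (≤-reflexive (step-cong {table μ′} {table μ} q (elsewhere (q + cur)
            λ eq → <⇒≢ (≤-<-trans (m∸n≤m q cur) (m<m+n q (n≢0⇒n>0 cur≢0))) (sym eq))))
            (≤-trans step≤new (≤-reflexive (sym at-target)))
    ... | no q≢q′ = ≤-trans (≤-reflexive (step-cong {table μ′} {table μ} q′ (later q′ q<q′)))
            (≤-trans (closed q′ q<q′ q′<N cur≢0) (grows _))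
      where
      q<q′ : q < q′
      q<q′ = ≤∧≢⇒< q≤q′ q≢q′

    fin = value μ′ (n ∷ f ∷ K ∷ J ∷ e ∷ p ∷ q ∷ cur ∷ []) finalᵗ

    keep : f ≢ 0 → choose fin 1 f ≢ 0
    keep = choose-keep fin

    correct′ : choose fin 1 f ≢ 0 → vi G < K
    correct′ h with choose-either fin h
    ... | inj₂ f≢0   = correct f≢0
    ... | inj₁ fin≢0 with Values.final-sound ready′ f q fin≢0
    ...   | final , pos = sound-final sound′ q final pos

    detected′ : ∀ q′ → q ≤ q′ → q′ < N → Final q′ → 0 < val (table μ′) q′ → choose fin 1 f ≢ 0
    detected′ q′ q≤q′ q′<N final pos with q ≟ q′
    -- The answer is updated after the write, so the test for a final code refers to the new table.
    ... | yes refl = λ z → 1+n≢0 (trans (sym (cong (λ a → choose a 1 f)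
        (Values.final-complete ready′ f q final pos))) z)
    ... | no q≢q′  = keep (detected q′ q<q′ q′<N final
            (≤-trans pos (≤-reflexive (val-cong {table μ′} {table μ} q′ (later q′ q<q′)))))
      where
      q<q′ : q < q′
      q<q′ = ≤∧≢⇒< q≤q′ q≢q′

  table-runs : ∀ k ρ μ → Relaxed k ρ μ →
    Runs (while (reg 6) relax) (k * (2 + (X + (X + (X + X)))) + 2) ρ μ
      (λ ρ′ μ′ → lookup ρ′ 6F ≡ 0 × ∃[ k′ ] Relaxed k′ ρ′ μ′)
  table-runs k ρ μ r = while-runs 6F Relaxed relax-runs k r

  -- The size bound of an optimal solution is replaced by its minimum with `n`, because the codes
  -- provide for levels up to `n` only. If that minimum is 0, every vertex has been deleted, since
  -- the component of a kept vertex contains the vertex itself; then `n < K`, and the answer was yes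
  -- from the start.
  relaxed-complete : ∀ {ρ μ} (r : Relaxed 0 ρ μ) → vi G < K → Relaxed.f r ≢ 0
  relaxed-complete {ρ} {μ} r vi<K with vi-attained
  ... | inj₁ eq = Relaxed.trivial r (subst (_< K) eq vi<K)
  ... | inj₂ (σ , ℓ , eq , sizes) with ℓ ⊓ n in cut
  ...   | zero  = Relaxed.trivial r (≤-<-trans (≤-trans (count-all all) (m≤m+n (count σ) ℓ)) (subst (_< K) eq vi<K))
    where
    all : ∀ u → T (σ u)
    all u with T? (σ u)
    ... | yes t = t
    ... | no ¬t = contradiction (≤-trans (count-some {p = reach σ u} u (star⇒reach {σ} {u} {u} ε))
                    (≤-trans (⊓-glb (sizes u ¬t) (count-≤ (reach σ u))) (≤-reflexive cut))) λ ()
  ...   | suc ℓ′ with Completeness.complete {table μ} (λ q q<N → Relaxed.closed r q z≤n q<N) {σ} {suc ℓ′} (s≤s z≤n)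
                        (≤-trans (≤-reflexive (sym cut)) (m⊓n≤n ℓ n))
                        (λ u u∉ → ≤-trans (⊓-glb (sizes u u∉) (count-≤ (reach σ u))) (≤-reflexive cut))
                        (≤-<-trans (+-monoʳ-≤ (count σ) (≤-trans (≤-reflexive (sym cut)) (m⊓n≤m ℓ n)))
                            (subst (_< K) eq vi<K))
  ...     | q , q<N , final , pos = Relaxed.detected r q z≤n q<N final pos

-- The budget, the whole program and its running time

open import Data.Integer using (ℤ; +_; -[1+_]; +≤+; _≤?_) renaming (_≤_ to _≤ᶻ_)

-- The number k of the input may exceed the word bound, so it is incremented only after a comparison
-- with `n`. Cutting it off at `n` preserves the answer because `vi G ≤ n`.
budgetOf : ℕ → ℤ → ℕ
budgetOf n -[1+ _ ] = 0
budgetOf n (+ m)    = if m <ᵇ n then m + 1 else n + 1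

budgetOf-≤ : ∀ n k → budgetOf n k ≤ suc n
budgetOf-≤ n -[1+ _ ] = z≤n
budgetOf-≤ n (+ m) with m <ᵇ n in eq
... | true  = ≤-trans (≤-reflexive (+-comm m 1)) (m≤n⇒m≤1+n (<ᵇ⇒< m n (subst T (sym eq) tt)))
... | false = ≤-reflexive (+-comm n 1)

<budget⇒≤ : ∀ {n k v} → v < budgetOf n k → + v ≤ᶻ k
<budget⇒≤ {n} {+ m} {v} v< with m <ᵇ n in eq
... | true  = +≤+ (s≤s⁻¹ (≤-trans v< (≤-reflexive (+-comm m 1))))
... | false = +≤+ (≤-trans (s≤s⁻¹ (≤-trans v< (≤-reflexive (+-comm n 1))))
                (≮⇒≥ λ m<n → subst T eq (<⇒<ᵇ m<n)))

≤⇒<budget : ∀ {n k v} → v ≤ n → + v ≤ᶻ k → v < budgetOf n k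
≤⇒<budget {n} {+ m} {v} v≤n (+≤+ v≤m) with m <ᵇ n
... | true  = ≤-trans (s≤s v≤m) (≤-reflexive (+-comm 1 m))
... | false = ≤-trans (s≤s v≤n) (≤-reflexive (+-comm 1 n))

bit-does : ∀ {P : Set} (d : Dec P) {f} → f ≤ 1 → (P → f ≢ 0) → (f ≢ 0 → P) → f ≡ bit (does d)
bit-does (yes p) {zero}        f≤1 to from = contradiction refl (to p)
bit-does (yes p) {suc zero}    f≤1 to from = refl
bit-does (yes p) {suc (suc f)} (s≤s ()) to from
bit-does (no ¬p) {zero}        f≤1 to from = refl
bit-does (no ¬p) {suc f}       f≤1 to from = contradiction (from 1+n≢0) ¬p

capped : ℕ → ℤ → Vec ℕ 8
capped n k = n ∷ bit (n <ᵇ budgetOf n k) ∷ budgetOf n k ∷ 0 ∷ 0 ∷ 0 ∷ 0 ∷ 0 ∷ []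

cap-runs : ∀ {n} (G : Graph n) k W → n + 1 ≤ W → ∃[ t ] ∃[ f ]
  (W ⊢ cap , input G k ⇓[ t ] state f (mem (input G k))) × t ≤ 16 × (∀ i → f (toℕ i) ≡ lookup (capped n k) i)
cap-runs {n} G -[1+ _ ] W n<W = _ , _ ,
  ⇓-seq (⇓-then _ (λ ()) (⇓-set _)) (⇓-set (_ , _ , ≤-trans (bit-≤ (n <ᵇ 0)) (≤-trans (m≤n+m 1 n) n<W))) ,
  ≤ᵇ⇒≤ _ 16 tt ,
  λ { 0F → refl ; 1F → refl ; 2F → refl ; 3F → refl ; 4F → refl ; 5F → refl ; 6F → refl ; 7F → refl }
cap-runs {n} G (+ a) W n<W with a <ᵇ n in a<n
... | true = _ , _ ,
  ⇓-seq (⇓-else _ refl (⇓-then (_ , _ , ≤-trans (bit-≤ (a <ᵇ n)) (≤-trans (m≤n+m 1 n) n<W))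
      (λ z → 1+n≢0 (trans (cong bit (sym a<n)) z))
      (⇓-set (_ , _ , ≤-trans (+-monoˡ-≤ 1 (<⇒≤ (<ᵇ⇒< a n (subst T (sym a<n) tt)))) n<W))))
    (⇓-set (_ , _ , ≤-trans (bit-≤ (n <ᵇ a + 1)) (≤-trans (m≤n+m 1 n) n<W))) ,
  ≤ᵇ⇒≤ _ 16 tt ,
  λ { 0F → refl ; 1F → refl ; 2F → refl ; 3F → refl ; 4F → refl ; 5F → refl ; 6F → refl ; 7F → refl }
... | false = _ , _ ,
  ⇓-seq (⇓-else _ refl (⇓-else (_ , _ , ≤-trans (bit-≤ (a <ᵇ n)) (≤-trans (m≤n+m 1 n) n<W)) (cong bit a<n)
      (⇓-set (_ , _ , n<W))))
    (⇓-set (_ , _ , ≤-trans (bit-≤ (n <ᵇ n + 1)) (≤-trans (m≤n+m 1 n) n<W))) ,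
  ≤ᵇ⇒≤ _ 16 tt ,
  λ { 0F → refl ; 1F → refl ; 2F → refl ; 3F → refl ; 4F → refl ; 5F → refl ; 6F → refl ; 7F → refl }

module Assembly {n} (G : Graph n) (k : ℤ) (B M W : ℕ) (16n≤B : 16 * suc n ≤ B) (1≤M : 1 ≤ M)
                (B^a*M≤W : ∀ a → a ≤ A → B ^ a * M ≤ W)
                (X : ℕ) (B^e≤X : ∀ e → e ≤ τ → B ^ e ≤ X)
                (C : Fin n → Bool) (isCover : ∀ u v → Graph.Edge G u v → T (C u) ⊎ T (C v))
                (4^#C≤M : 4 ^ count C ≤ M) (X≤W : M * (B * (B * (B * X))) ≤ W) where

  m : ℕ → ℕ
  m = mem (input G k)

  K : ℕ
  K = budgetOf n k

  open Growth G m (entry-input G k) C isCover B M W 16n≤B 1≤M B^a*M≤W X B^e≤X 4^#C≤M (bit (n <ᵇ K)) K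
  open Parameters G using (vi≤n)

  ρ₁ : Vec ℕ 8
  ρ₁ = capped n k

  B≤W : B ≤ W
  B≤W = ≤-trans (≤-trans (m≤m*n B M) (≤-reflexive (cong (_* M) (sym (*-identityʳ B))))) (B^a*M≤W 1 (s≤s z≤n))

  1+n≤W : n + 1 ≤ W
  1+n≤W = ≤-trans (≤-reflexive (+-comm n 1)) (≤-trans suc-n≤B B≤W)

  1≤X : 1 ≤ X
  1≤X = B^e≤X 0 z≤n

  16≤X : 16 ≤ X
  16≤X = ≤-trans 16≤B (≤-trans (≤-reflexive (sym (*-identityʳ B))) (B^e≤X 1 (s≤s z≤n)))

  small≤ : ∀ {x} → x ≤ suc n → x ≤ size (1 , 0)
  small≤ x≤ = ≤-trans x≤ (≤-trans suc-n≤B (≤-reflexive (sym size₁₀)))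

  ρ₁≤ : Bounded Γ ρ₁
  ρ₁≤ = bounded λ
    { 0F → small≤ (n≤1+n n) ; 1F → small≤ (≤-trans (bit-≤ (n <ᵇ K)) (s≤s z≤n)) ; 2F → small≤ (budgetOf-≤ n k)
    ; 3F → z≤n ; 4F → z≤n ; 5F → z≤n ; 6F → z≤n ; 7F → z≤n }

  m≤ : MemBounded m
  m≤ a = ≤-trans (input-≤1 G k a) (1≤size (1 , 1))

  -- The row of the root, whose list is empty: all place values are 0, as the memory already is, and
  -- cell `n` holds 4 ^ 0.
  μ₁ : ℕ → ℕ
  μ₁ = m [ row n 1 n ≔ 1 ]

  stored-1 : Stored 1 μ₁
  stored-1 = record
    { μ≤ = membounded-set m≤ (1≤size (1 , 1))
    ; graph = λ a a< → update-other m 1 (<⇒≢ (<-≤-trans a< (n²≤row n 1 n)))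
    ; rows = λ { i (s≤s z≤n) (s≤s z≤n) →
        (λ v v<n → trans (update-other m 1 (λ eq → <⇒≢ v<n (row-injective n 1 eq))) (input-0 G k _ (n²≤row n 1 v))) ,
        update-same m (row n 1 n) 1 }
    ; zeros = λ a ≤a → trans (update-other m 1 (λ eq → <⇒≢ (<-≤-trans (row-< n {1} {2} n 0 ≤-refl ≤-refl) ≤a)
        (sym eq)))
        (input-0 G k a (≤-trans (n²≤row n 2 0) ≤a))
    }

  -- One less than the bound on the node numbers, since the search starts at node 1.
  fuel : ℕ
  fuel = 4 * 2 ^ count C ∸ 1

  fuel+1 : fuel + 1 ≡ 4 * 2 ^ count C
  fuel+1 = m∸n+n≡m (≤-trans (m^n>0 2 (count C)) (m≤m+n (2 ^ count C) _))

  copy-runs : ∀ {ρ μ} → Runs (set 0 (reg 1)) X ρ μ (λ ρ′ μ′ → lookup ρ′ 0F ≡ lookup ρ 1F)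
  copy-runs {ρ} = runs λ f h → _ , _ , ρ [ 0F ]:= lookup ρ 1F , _ , ⇓-set _ , ≤-trans (s≤s (s≤s z≤n)) 16≤X ,
    holds f h , lookup∘update 0F ρ (lookup ρ 1F)
    where
    holds : ∀ f → Holds f ρ → Holds (f [ 0 ≔ f 1 ]) (ρ [ 0F ]:= lookup ρ 1F)
    holds f h i with i ≟ᶠ 0F
    ... | yes refl = trans (h 1F) (sym (lookup∘update 0F ρ (lookup ρ 1F)))
    ... | no i≢0   = trans (update-other f {0} (f 1) (λ eq → i≢0 (toℕ-injective eq)))
                       (trans (h i) (sym (lookup∘update′ i≢0 ρ _)))

  codes : ℕ
  codes = suc n * (16 * M)

  relaxTime : ℕ
  relaxTime = 2 + (X + (X + (X + X)))

  scanTime : ℕ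
  scanTime = X + (X + (X + ((fuel * (2 + growTime) + 2) + (X + ((codes * relaxTime + 2) + X)))))

  answer-runs : Runs scan scanTime ρ₁ m
                  (λ ρ′ _ → lookup ρ′ 0F ≡ bit (does (+ vi G ≤? k)))
  answer-runs =
    sequence (write-any (rowᵗ 0 (con 1) (ν 0 0F)) (con 1) (row n 1 n) 1 ρ₁≤ m≤ tt tt refl refl)
    λ { _ _ (refl , refl) →
    sequence (assign-auto 3F (con 1) 1 ρ₁≤ (Stored.μ≤ stored-1) tt refl)
    λ { _ _ (refl , refl , ρ₂≤) →
    sequence (assign-auto 4F remainingᵗ (remaining (branch 1)) ρ₂≤ (Stored.μ≤ stored-1) tt
      (remaining-value {f = bit (n <ᵇ K)} {K} {0} {0} {0} {0} stored-1 ≤-refl))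
    λ { _ _ (refl , refl , ρ₃≤) →
    sequence (search-runs fuel _ _ (tree-state refl ρ₃≤ stored-1 progress-1 fuel+1))
    λ { _ _ (z , _ , tree-state {j} {p} {x} {w} refl ρ₄≤ st pr _) → solve z ρ₄≤ st pr } } } }
    where
    solve : ∀ {j p x w μ} → remaining (branch j) ≡ 0 →
      Bounded Γ (n ∷ bit (n <ᵇ K) ∷ K ∷ j ∷ remaining (branch j) ∷ p ∷ x ∷ w ∷ []) →
      Stored j μ → Progress j →
      Runs tabulateRows (X + ((codes * relaxTime + 2) + X))
        (n ∷ bit (n <ᵇ K) ∷ K ∷ j ∷ remaining (branch j) ∷ p ∷ x ∷ w ∷ []) μ
        (λ ρ′ _ → lookup ρ′ 0F ≡ bit (does (+ vi G ≤? k)))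
    solve {j} {p} {x} {w} {μ} z ρ≤ st pr =
      sequence (assign-auto 6F codesᵗ N ρ≤ (Stored.μ≤ st) tt (cong (suc n *_) (proj₂ row-j)))
      λ { _ _ (refl , refl , ρ′≤) →
      sequence (slower (+-monoˡ-≤ 2 (*-monoˡ-≤ relaxTime N≤)) (R.table-runs N _ μ (start ρ′≤)))
      λ { _ μ′ (q0 , _ , r) → finish q0 r } }
      where
      good = Progress.good pr j (Progress.1≤j pr) ≤-refl
      module R = Relaxation G B M W 16n≤B 1≤M B^a*M≤W X B^e≤X (branch j) (Good.unique good) (Good.below good)
                   (covered (branch j) z) K j (remaining (branch j)) p
      open R using (N; Relaxed; relaxed; table)
      row-j = Stored.rows st j (Progress.1≤j pr) ≤-refl
      N≤ : N ≤ codes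
      N≤ = *-monoʳ-≤ (suc n) (weights-bound good (<⇒≤ (progress-≤ pr)))
      start : Bounded Γ (n ∷ bit (n <ᵇ K) ∷ K ∷ j ∷ remaining (branch j) ∷ p ∷ N ∷ w ∷ []) →
              Relaxed N (n ∷ bit (n <ᵇ K) ∷ K ∷ j ∷ remaining (branch j) ∷ p ∷ N ∷ w ∷ []) μ
      start ρ′≤ = relaxed refl ρ′≤ (Stored.μ≤ st)
        (record { graph = λ u v → trans (Stored.graph st _ (index-< u v)) (entry-input G k u v)
                ; weights = proj₁ row-j ; top = proj₂ row-j })
        (λ q pos → contradiction (Stored.zeros st (row n (suc j) q) (+-monoʳ-≤ (n * n + (1 + n) * suc j) z≤n))
            (>⇒≢ pos))
        (λ q N≤q q<N → contradiction q<N (≤⇒≯ N≤q))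
        (bit-≤ (n <ᵇ K))
        (λ f≢0 → ≤-<-trans vi≤n (<ᵇ⇒< n K (bit-T f≢0)))
        (λ n<K f≡0 → T-bit (<⇒<ᵇ n<K) f≡0)
        (λ q N≤q q<N → contradiction q<N (≤⇒≯ N≤q))
        where
        bit-T : ∀ {b} → bit b ≢ 0 → T b
        bit-T {true}  h = tt
        bit-T {false} h = h refl
        T-bit : ∀ {b} → T b → bit b ≢ 0
        T-bit {true} _ = 1+n≢0
      finish : ∀ {q ρ μ′} → lookup ρ 6F ≡ 0 → Relaxed q ρ μ′ →
               Runs (set 0 (reg 1)) X ρ μ′ (λ ρ′ _ → lookup ρ′ 0F ≡ bit (does (+ vi G ≤? k)))
      finish refl r@(relaxed {f} {w} refl _ _ _ _ _ f≤1 correct _ _) = weaken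
        (λ eq → trans eq (bit-does (+ vi G ≤? k) f≤1
          (λ vi≤k → R.relaxed-complete r (≤⇒<budget vi≤n vi≤k))
          (λ f≢0 → <budget⇒≤ {n} {k} (correct f≢0))))
        copy-runs

  -- The unit of account is `Y`. A round of the search costs at most `B * X`, and there are at most
  -- `4 * M` rounds. A code costs at most `6 * X`, and there are `16 * suc n * M` codes at most,
  -- where `16 * suc n ≤ B`. With the remaining assignments this makes `20 * Y`, and two further
  -- factors `B` exceed 20.
  time-≤ : 16 + scanTime ≤ M * (B * (B * (B * X)))
  time-≤ = begin
    16 + scanTime
      ≤⟨ +-monoˡ-≤ scanTime 16≤X ⟩
    X + (X + (X + (X + ((fuel * (2 + growTime) + 2) + (X + ((codes * relaxTime + 2) + X))))))
      ≤⟨ +-mono-≤ X≤Y (+-mono-≤ X≤Y (+-mono-≤ X≤Y (+-mono-≤ X≤Y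
          (+-mono-≤ search≤ (+-mono-≤ X≤Y (+-mono-≤ table≤ X≤Y)))))) ⟩
    Y + (Y + (Y + (Y + (6 * Y + (Y + (8 * Y + Y))))))  ≡⟨ collect Y ⟩
    20 * Y                              ≤⟨ *-monoˡ-≤ Y (≤-trans (≤ᵇ⇒≤ 20 256 tt) (*-mono-≤ 16≤B 16≤B)) ⟩
    B * B * (M * (B * X))               ≡⟨ *-assoc B B _ ⟩
    B * (B * (M * (B * X)))             ≡⟨ cong (B *_) (swap B M (B * X)) ⟩
    B * (M * (B * (B * X)))             ≡⟨ swap B M (B * (B * X)) ⟩
    M * (B * (B * (B * X)))             ∎
    where
    open ≤-Reasoning
    open +-*-Solver
    Y = M * (B * X)
    swap : ∀ a b c → a * (b * c) ≡ b * (a * c)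
    swap = solve 3 (λ a b c → a :* (b :* c) := b :* (a :* c)) refl
    collect : ∀ y → y + (y + (y + (y + (6 * y + (y + (8 * y + y)))))) ≡ 20 * y
    collect = solve 1 (λ y → y :+ (y :+ (y :+ (y :+ (con 6 :* y :+ (y :+ (con 8 :* y :+ y)))))) := con 20 :* y) refl
      where open +-*-Solver using (con)
    1≤B : 1 ≤ B
    1≤B = ≤-trans (s≤s z≤n) 16≤B
    X≤BX : X ≤ B * X
    X≤BX = ≤-trans (≤-reflexive (sym (+-identityʳ X))) (*-monoˡ-≤ X 1≤B)
    X≤Y : X ≤ Y
    X≤Y = ≤-trans X≤BX (≤-trans (≤-reflexive (sym (+-identityʳ (B * X)))) (*-monoˡ-≤ (B * X) 1≤M))
    2≤2Y : 2 ≤ 2 * Y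
    2≤2Y = *-monoʳ-≤ 2 (≤-trans 1≤X X≤Y)
    s = suc n
    2≤2X : 2 ≤ 2 * X
    2≤2X = *-monoʳ-≤ 2 1≤X
    grow≤ : 2 + growTime ≤ B * X
    grow≤ = begin
      2 + (X + (X + (X + ((s * (2 + (X + X)) + 2) + X))))
        ≤⟨ +-mono-≤ 2≤2X (+-monoʳ-≤ X (+-monoʳ-≤ X (+-monoʳ-≤ X
            (+-monoˡ-≤ X (+-mono-≤ (*-monoʳ-≤ s (+-monoˡ-≤ (X + X) 2≤2X)) 2≤2X))))) ⟩
      2 * X + (X + (X + (X + ((s * (2 * X + (X + X)) + 2 * X) + X))))
        ≡⟨ solve 2 (λ x s → con 2 :* x :+ (x :+ (x :+ (x :+ ((s :* (con 2 :* x :+ (x :+ x)) :+ con 2 :* x) :+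
            x)))) := (con 8 :+ con 4 :* s) :* x) refl X s ⟩
      (8 + 4 * s) * X     ≤⟨ *-monoˡ-≤ X (+-monoˡ-≤ (4 * s) (*-monoʳ-≤ 8 {1} {s} (s≤s z≤n))) ⟩
      (8 * s + 4 * s) * X ≤⟨ *-monoˡ-≤ X (≤-trans (≤-reflexive (sym (*-distribʳ-+ s 8 4)))
          (≤-trans (*-monoˡ-≤ s (≤ᵇ⇒≤ 12 16 tt)) 16n≤B)) ⟩
      B * X               ∎
      where open +-*-Solver using (con)
    search≤ : fuel * (2 + growTime) + 2 ≤ 6 * Y
    search≤ = begin
      fuel * (2 + growTime) + 2  ≤⟨ +-mono-≤ (*-mono-≤ fuel≤ grow≤) 2≤2Y ⟩
      4 * M * (B * X) + 2 * Y    ≡⟨ cong (_+ 2 * Y) (*-assoc 4 M (B * X)) ⟩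
      4 * Y + 2 * Y              ≡⟨ *-distribʳ-+ Y 4 2 ⟨
      6 * Y                      ∎
      where
      fuel≤ : fuel ≤ 4 * M
      fuel≤ = ≤-trans (m∸n≤m _ 1) (*-monoʳ-≤ 4 (≤-trans (^-monoˡ-≤ (count C) {2} {4} (s≤s (s≤s z≤n))) 4^#C≤M))
    table≤ : codes * relaxTime + 2 ≤ 8 * Y
    table≤ = begin
      s * (16 * M) * (2 + (X + (X + (X + X)))) + 2
        ≤⟨ +-mono-≤ (*-monoʳ-≤ (s * (16 * M)) (+-monoˡ-≤ (X + (X + (X + X))) 2≤2X)) 2≤2Y ⟩
      s * (16 * M) * (2 * X + (X + (X + (X + X)))) + 2 * Y
        ≡⟨ cong (_+ 2 * Y) (solve 3 (λ s m x → s :* (con 16 :* m) :* (con 2 :* x :+ (x :+ (x :+ (x :+ x)))) :=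
            con 6 :* (m :* (con 16 :* s :* x))) refl s M X) ⟩
      6 * (M * (16 * s * X)) + 2 * Y  ≤⟨ +-monoˡ-≤ (2 * Y) (*-monoʳ-≤ 6 (*-monoʳ-≤ M (*-monoˡ-≤ X 16n≤B))) ⟩
      6 * Y + 2 * Y                   ≡⟨ *-distribʳ-+ Y 6 2 ⟨
      8 * Y                           ∎
      where open +-*-Solver using (con)

  decides : ∃[ t ] ∃[ s ] (W ⊢ decide , input G k ⇓[ t ] s) × t ≤ 16 + scanTime × regs s 0 ≡ bit (does (+ vi G ≤? k))
  decides = run-after {r = 0F} (cap-runs G k W 1+n≤W) answer-runs

  decides-within : ∃[ t ] ∃[ s ] (W ⊢ decide , input G k ⇓[ t ] s) × t ≤ W × regs s 0 ≡ bit (does (+ vi G ≤? k))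
  decides-within = let t , s , r , t≤ , eq = decides in t , s , r , ≤-trans t≤ (≤-trans time-≤ X≤W) , eq

opaque
  -- Opaque, so that the power is not expanded when the pieces are put together; the two lemmas
  -- below are its interface.
  unit : ℕ → ℕ
  unit B = B ^ τ

  ^≤unit : ∀ B .{{_ : NonZero B}} e → e ≤ τ → B ^ e ≤ unit B
  ^≤unit B e e≤ = ^-monoʳ-≤ B {e} {τ} e≤

  cube-unit : ∀ B → B * (B * (B * unit B)) ≡ B ^ (3 + τ)
  cube-unit B = refl

unit-≤ : ∀ n → 16 * suc n * (16 * suc n * (16 * suc n * unit (16 * suc n))) ≤ c * suc n ^ c
unit-≤ n = subst (_≤ c * suc n ^ c) (sym (cube-unit (16 * suc n))) (power-≤ n (3 + τ) (≤ᵇ⇒≤ 31 32 tt))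

∈⇒T : ∀ {n} (C : Subset n) {u} → u ∈ C → T (lookup C u)
∈⇒T C u∈ = subst T (sym ([]=⇒lookup u∈)) tt

count-lookup : ∀ {n} (C : Subset n) → count (lookup C) ≡ ∣ C ∣
count-lookup C = trans (sym (∣tabulate∣ (lookup C))) (cong ∣_∣ (tabulate∘lookup C))

theorem14 : ∃[ p ] ∃[ c ] ∀ (n : ℕ) (G : Graph n) (k : ℤ) →
    ∃[ t ] ∃[ s ]
    (bound c G ⊢ p , input G k ⇓[ t ] s) × t ≤ bound c G ×
    regs s 0 ≡ bit (does (+ vi G ≤? k))
theorem14 = decide , c , solution
  where
  solution : ∀ n (G : Graph n) k → ∃[ t ] ∃[ s ]
    (bound c G ⊢ decide , input G k ⇓[ t ] s) × t ≤ bound c G ×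
    regs s 0 ≡ bit (does (+ vi G ≤? k))
  solution n G k =
    -- This minimum cover is known to the proof only: it bounds the search, whereas the dynamic
    -- program uses the cover that the search finds.
    let C , isCover , #C = Parameters.vc-attained G in
    Assembly.decides-within G k (16 * suc n) (5 ^ vc G) (bound c G) ≤-refl (m^n>0 5 (vc G))
      (λ a a≤ → ≤-trans (≤-reflexive (*-comm _ (5 ^ vc G)))
        (*-monoʳ-≤ (5 ^ vc G) (power-≤ n a (≤-trans a≤ (≤ᵇ⇒≤ 16 32 tt)))))
      (unit (16 * suc n)) (^≤unit (16 * suc n))
      (lookup C) (λ u v e → Sum.map (∈⇒T C) (∈⇒T C) (isCover u v e))
      -- The number of colourings is governed by 4 to the size of the minimum cover, which
      -- `5 ^ vc G` dominates.
      (≤-trans (^-monoˡ-≤ (count (lookup C)) {4} {5} (s≤s (s≤s (s≤s (s≤s z≤n)))))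
        (≤-reflexive (cong (5 ^_) (trans (count-lookup C) #C))))
      (*-monoʳ-≤ (5 ^ vc G) (unit-≤ n))
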